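{- For every $n\ge 4$, the binary matrices $\mathcal{S}^{\{(n,n)\}}(M_n)$, $\mathcal{S}^{G_{n-1}}(H_{n-1})$, $\mathcal{S}^{Q_n}(D_n)$ and $\mathcal{S}^{Q_{n+1}}(T_{n+1})$ are minimally non-firm, where $G_{n-1}=\{(n-1,2),(n-1,n)\}$, $Q_n=\{(1,2),(2,1),(n,n)\}$ and $Q_{n+1}=\{(1,2),(2,1),(n+1,n+1)\}$. In addition, $\mathcal{S}^{Q_n}(D_n)$ and $\mathcal{S}^{Q_{n+1}}(T_{n+1})$ are totally balanced.
   Context: For $X=(x_{i,j})\in\{0,1\}^{m\times n}$, $\operatorname{supp}(X)=\{(i,j):x_{i,j}=1\}$. A submatrix of $X$ indexed by $I\times J$ ($I\subseteq[m]$, $J\subseteq[n]$) is obtained by deleting rows not in $I$ and columns not in $J$; it is proper if $I\ne[m]$ or $J\ne[n]$. A rectangle of $X$ is a submatrix $I\times J$ with $I\times J\subseteq\operatorname{supp}(X)$. The Boolean rank $br(X)$ is the minimum number of rectangles whose union contains $\operatorname{supp}(X)$. An isolated set is a set $S\subseteq\operatorname{supp}(X)$ such that for any distinct $(i_1,j_1),(i_2,j_2)\in S$: $i_1\ne i_2$, $j_1\ne j_2$, and $x_{i_1,j_2}=0$ or $x_{i_2,j_1}=0$; $i(X)$ is the maximum size of an isolated set. $X$ is firm if $i(X')=br(X')$ for every submatrix $X'$ of $X$ (including $X$); $X$ is minimally non-firm if it is not firm but every proper submatrix is firm. Stretching: for $X\in\{0,1\}^{m\times n}$ and nonempty $Q\subseteq\operatorname{supp}(X)$,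 list $Q=\{q_1,\dots,q_t\}$ with $q_s=(\ell_s,k_s)$ in non-decreasing order of row index and then column index. $\mathcal{S}^Q(X)$ is the $(m+t)\times(n+t)$ binary matrix whose top-left $m\times n$ block is $X$, which for each $s\in[t]$ has entries equal to $1$ at $(\ell_s,n+s)$, $(m+s,k_s)$ and $(m+s,n+s)$, and whose other entries are $0$. Matrices: $C_k$ ($k\ge3$) is the $k\times k$ matrix with $1$s exactly at $(i,i),(i,i+1)$ for $i\in[k-1]$ and $(k,1),(k,k)$. $H_k=[\mathbf 1,C_k]$ is the $k\times(k+1)$ matrix whose first column is all ones followed by $C_k$. For $k\ge4$, $M_k$ is the $k\times k$ matrix with $1$s exactly at $(i,i),(i,i+1)$ for $i\in[k-2]$, at $(k-1,1),(k-1,k-1),(k-1,k)$, and at $(k,k-1),(k,k)$ (i.e. $M_{k}=\mathcal{S}^{\{(k-1,k-1)\}}(C_{k-1})$). For $k\ge4$, $D_k$ is the $k\times k$ matrix whose row $1$ has $1$s exactly in columns $2,3$; row $2$ in columns $1,2,3$; row $3$ in all columns $1,\dots,k$; and row $i$ for $4\le i\le k$ in columns $i-1,i$. For $k\ge5$, $T_k$ is the $k\times k$ matrix whose row $1$ has $1$s exactly in columns $2,4$; row $2$ in columns $1,3$; row $3$ in columns $2,3,4$; row $4$ in columns $1,3,4,5,\dots,k$; and row $i$ for $5\le i\le k$ in columns $i-1,i$. A binary matrix is totally balanced if it has no submatrix which, after permuting its rows and columns, equals $C_k$ for some $k\ge 3$. -}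

module Defs where

open import Data.Nat using (ℕ; zero; suc; _+_; _∸_; _≤_; _≡ᵇ_; _<ᵇ_; _≤ᵇ_)
open import Data.Bool using (Bool; true; false; _∧_; _∨_; if_then_else_)
open import Data.Fin using (Fin; toℕ)
open import Data.Fin.Subset using (Subset; _∈_; _⊆_; ⊤)
open import Data.List using (List; []; _∷_; length)
open import Data.Maybe using (Maybe; just; nothing)
open import Data.Product using (Σ; ∃; _×_; _,_; proj₁; proj₂)
open import Data.Sum using (_⊎_)
open import Relation.Binary.PropositionalEquality using (_≡_; _≢_)
open import Relation.Nullary using (¬_)
open import Function.Definitions using (Injective)

BMat : ℕ → ℕ → Set
BMat m n = Fin m → Fin n → Bool

-- Auxiliary "1-based" description of a matrix by a function ℕ → ℕ → Bool;
-- toMat m n P is the m × n matrix whose (i,j) entry (1-based) is P i j.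
toMat : (m n : ℕ) → (ℕ → ℕ → Bool) → BMat m n
toMat m n P i j = P (suc (toℕ i)) (suc (toℕ j))

-- Submatrices, support, rectangles, Boolean rank, isolated sets.
-- A submatrix of X is given by index sets I ⊆ [m], J ⊆ [n].

module _ {m n : ℕ} (X : BMat m n) where

  InSupp : Subset m → Subset n → Fin m → Fin n → Set
  InSupp I J i j = i ∈ I × j ∈ J × X i j ≡ true

  IsRect : Subset m → Subset n → Subset m × Subset n → Set
  IsRect I J (R , C) =
    R ⊆ I × C ⊆ J × (∀ i j → i ∈ R → j ∈ C → X i j ≡ true)

  HasCover : Subset m → Subset n → ℕ → Set
  HasCover I J k =
    Σ (Fin k → Subset m × Subset n) λ rs →
      (∀ a → IsRect I J (rs a)) ×
      (∀ i j → InSupp I J i j → ∃ λ a → i ∈ proj₁ (rs a) × j ∈ proj₂ (rs a))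

  IsBoolRank : Subset m → Subset n → ℕ → Set
  IsBoolRank I J r = HasCover I J r × (∀ k → HasCover I J k → r ≤ k)

  -- p enumerates an isolated set of X[I × J] of size k
  -- (distinct rows guarantee that the k positions are distinct)
  IsIsolated : Subset m → Subset n → (k : ℕ) → (Fin k → Fin m × Fin n) → Set
  IsIsolated I J k p =
    (∀ a → InSupp I J (proj₁ (p a)) (proj₂ (p a))) ×
    (∀ a b → a ≢ b →
       proj₁ (p a) ≢ proj₁ (p b) ×
       proj₂ (p a) ≢ proj₂ (p b) ×
       (X (proj₁ (p a)) (proj₂ (p b)) ≡ false ⊎
        X (proj₁ (p b)) (proj₂ (p a)) ≡ false))

  IsIsolationNumber : Subset m → Subset n → ℕ → Set
  IsIsolationNumber I J r =
    (Σ (Fin r → Fin m × Fin n) (IsIsolated I J r)) ×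
    (∀ k p → IsIsolated I J k p → k ≤ r)

  FirmSub : Subset m → Subset n → Set
  FirmSub I J =
    ∀ I' J' → I' ⊆ I → J' ⊆ J →
      Σ ℕ λ r → IsBoolRank I' J' r × IsIsolationNumber I' J' r

  Firm : Set
  Firm = FirmSub ⊤ ⊤

  MinimallyNonFirm : Set
  MinimallyNonFirm =
    ¬ Firm × (∀ I J → (I ≢ ⊤ ⊎ J ≢ ⊤) → FirmSub I J)

Cℕ : ℕ → ℕ → ℕ → Bool
Cℕ k i j = (j ≡ᵇ i) ∨ ((i <ᵇ k) ∧ (j ≡ᵇ suc i)) ∨ ((i ≡ᵇ k) ∧ (j ≡ᵇ 1))

C : (k : ℕ) → BMat k k
C k = toMat k k (Cℕ k)

-- H_k = [1, C_k]  (k × (k+1))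
Hℕ : ℕ → ℕ → ℕ → Bool
Hℕ k i j = (j ≡ᵇ 1) ∨ ((2 ≤ᵇ j) ∧ Cℕ k i (j ∸ 1))

Mℕ : ℕ → ℕ → ℕ → Bool
Mℕ k i j =
  ((i ≤ᵇ (k ∸ 2)) ∧ ((j ≡ᵇ i) ∨ (j ≡ᵇ suc i))) ∨
  ((i ≡ᵇ (k ∸ 1)) ∧ ((j ≡ᵇ 1) ∨ (j ≡ᵇ (k ∸ 1)) ∨ (j ≡ᵇ k))) ∨
  ((i ≡ᵇ k) ∧ ((j ≡ᵇ (k ∸ 1)) ∨ (j ≡ᵇ k)))

Dℕ : ℕ → ℕ → ℕ → Bool
Dℕ k i j =
  ((i ≡ᵇ 1) ∧ ((j ≡ᵇ 2) ∨ (j ≡ᵇ 3))) ∨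
  ((i ≡ᵇ 2) ∧ (j ≤ᵇ 3)) ∨
  (i ≡ᵇ 3) ∨
  ((4 ≤ᵇ i) ∧ ((j ≡ᵇ (i ∸ 1)) ∨ (j ≡ᵇ i)))

Tℕ : ℕ → ℕ → ℕ → Bool
Tℕ k i j =
  ((i ≡ᵇ 1) ∧ ((j ≡ᵇ 2) ∨ (j ≡ᵇ 4))) ∨
  ((i ≡ᵇ 2) ∧ ((j ≡ᵇ 1) ∨ (j ≡ᵇ 3))) ∨
  ((i ≡ᵇ 3) ∧ ((j ≡ᵇ 2) ∨ (j ≡ᵇ 3) ∨ (j ≡ᵇ 4))) ∨
  ((i ≡ᵇ 4) ∧ ((j ≡ᵇ 1) ∨ (j ≡ᵇ 3) ∨ (4 ≤ᵇ j))) ∨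
  ((5 ≤ᵇ i) ∧ ((j ≡ᵇ (i ∸ 1)) ∨ (j ≡ᵇ i)))

-- Stretching.  Q is given as the list q_1, …, q_t of 1-based positions
-- (ℓ_s , k_s), already in non-decreasing order of row, then column index.

nth : List (ℕ × ℕ) → ℕ → Maybe (ℕ × ℕ)
nth []       _             = nothing
nth (x ∷ xs) zero          = nothing
nth (x ∷ xs) (suc zero)    = just x
nth (x ∷ xs) (suc (suc s)) = nth xs (suc s)

Stretchℕ : ℕ → ℕ → (ℕ → ℕ → Bool) → List (ℕ × ℕ) → ℕ → ℕ → Bool
Stretchℕ m n X Q i j =
  if i ≤ᵇ m
  then (if j ≤ᵇ n then X i j else rowPart (nth Q (j ∸ n)))
  else (if j ≤ᵇ n then colPart (nth Q (i ∸ m)) else ((j ∸ n) ≡ᵇ (i ∸ m)))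
  where
    rowPart : Maybe (ℕ × ℕ) → Bool
    rowPart (just (l , _)) = i ≡ᵇ l
    rowPart nothing        = false
    colPart : Maybe (ℕ × ℕ) → Bool
    colPart (just (_ , k)) = j ≡ᵇ k
    colPart nothing        = false

Stretch : (m n : ℕ) → (ℕ → ℕ → Bool) → (Q : List (ℕ × ℕ)) →
          BMat (m + length Q) (n + length Q)
Stretch m n X Q = toMat (m + length Q) (n + length Q) (Stretchℕ m n X Q)

-- Totally balanced: no submatrix which, after permuting rows and columns,
-- equals C_k for some k ≥ 3 (i.e. no injective row/column choices f, g
-- with X (f a) (g b) = C_k a b).

TotallyBalanced : {m n : ℕ} → BMat m n → Set
TotallyBalanced {m} {n} X =
  ∀ k → 3 ≤ k → (f : Fin k → Fin m) (g : Fin k → Fin n) →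
    Injective _≡_ _≡_ f → Injective _≡_ _≡_ g →
    ¬ (∀ a b → X (f a) (g b) ≡ C k a b)

{-# OPTIONS --safe #-}
-- Call two ones of a matrix adjacent if they lie in a common rectangle. Rectangles are then the
-- cliques and isolated sets the independent sets of this graph, so a matrix is firm when, for every
-- submatrix, the clique cover number and the independence number of the graph agree. Deleting the
-- neighbourhood of a simplicial vertex, deleting a dominated vertex, and shrinking an induced path of
-- three vertices with middle vertex of degree two to one vertex all preserve this, in both directions.
-- Some ones thereby become optional: rectangles may use them but need not cover them.
--
-- Each of the four matrices (H after transposition) is a fixed core with a path attached, where one
-- apex row contains every column of the path. The new row and column of a stretch form a simplicial
-- vertex; if both are present their removal makes the stretched entry optional, otherwise a core row
-- or column disappears. An incomplete path is eliminated from the gap towards both ends. A complete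
-- path is contracted to a single row. What remains are finitely many small graphs, which are searched
-- exhaustively; the only one where the numbers differ comes from the whole matrix, where 2N + 1 ones,
-- no three in a rectangle, face independence number N.
--
-- Total balancedness follows from an ordering of rows and columns without a submatrix Γ = [1 1; 1 0].

module Submission where

open import Defs
open import Data.Bool using (Bool; true; false; _∧_; _∨_; not; if_then_else_; T)
open import Data.Bool.ListAction using (any; all)
open import Data.Bool.Properties using (T-≡; T?; ∨-comm; ∨-identityʳ; ∧-zeroʳ; ∧-identityʳ) renaming (_≟_ to _B≟_)
open import Data.Empty using (⊥; ⊥-elim)
open import Data.Fin using (Fin; zero; suc; toℕ; fromℕ<; punchIn; punchOut)
import Data.Fin as Fin
import Data.Fin.Properties as F
open import Data.Fin.Subset using (Subset; _⊆_; ⊤) renaming (_∈_ to _∈ₛ_)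
open import Data.Fin.Subset.Properties using (_∈?_; ∈⊤; ⊆⊤; ⊆-antisym)
open import Data.List using (List; []; _∷_; filterᵇ; map; upTo)
open import Data.List.Membership.Propositional using (_∈_; find; lose)
open import Data.List.Membership.Propositional.Properties using (∈-map⁺; ∈-map⁻; ∈-filter⁺; ∈-filter⁻; ∈-upTo⁺; ∈-upTo⁻)
import Data.List.Relation.Unary.All as All
import Data.List.Relation.Unary.All.Properties as All
open import Data.List.Relation.Unary.Any using (here; there; any?)
import Data.List.Relation.Unary.Any.Properties as Any
open import Data.Maybe using (just)
open import Data.Nat using (ℕ; zero; suc; pred; _+_; _∸_; _≤_; _<_; z≤n; s≤s; _≡ᵇ_; _<ᵇ_; _≤ᵇ_; >-nonZero)
import Data.Nat.Properties as N
open import Data.Product using (Σ; ∃; _×_; _,_; proj₁; proj₂; swap)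
open import Data.Product.Properties using (≡-dec)
open import Data.Sum using (_⊎_; inj₁; inj₂; [_,_]′)
import Data.Sum as Sum
open import Data.Sum.Properties using (inj₁-injective; inj₂-injective) renaming (≡-dec to ⊎-≡-dec)
open import Data.Vec using (tabulate; lookup; []; _∷_)
open import Data.Vec.Properties using (lookup⇒[]=; []=⇒lookup; lookup∘tabulate)
open import Function using (_∘_; id; flip)
open import Function.Bundles using (Equivalence)
open import Function.Definitions using (Injective)
open import Relation.Binary.Definitions using (DecidableEquality; tri<; tri≈; tri>)
open import Relation.Binary.PropositionalEquality using (_≡_; _≢_; refl; sym; trans; cong; cong₂; subst)
open import Relation.Nullary using (¬_; Dec; yes; no; contradiction; ¬?)
open import Relation.Nullary.Decidable using (⌊_⌋; _×-dec_; _→-dec_; recompute)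

-- The proper submatrices and the whole matrix ask for opposite conclusions, so the `up` lemmas
-- carry tightness back from the small graphs and the `down` lemmas carry a supposed tightness of
-- the whole matrix down to one small graph. The obstacle is the path: its length is unbounded and a
-- submatrix may damage it anywhere. On an intact path `(pᵢ, qᵢ)` has the non-adjacent neighbours
-- `(pᵢ, qᵢ₋₁)` and `(pᵢ₊₁, qᵢ)`, so it is not simplicial and contraction has to do the work. The
-- apex entries that would raise its degree are dominated, because the apex row contains the path
-- row, and they go beforehand. Next to a missing row one of the two neighbours is absent and the
-- entry is simplicial. Its removal leaves a trace in the apex row only, as an optional entry. So
-- one search over the core, with every set of marks in the apex row, serves all lengths and all
-- positions of the gap. In the exceptional graph the `2N + 1` ones form an induced odd cycle, of
-- length 5 for `D` and `H` and 7 for `M` and `T`.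

true≢false : ∀ {b : Bool} → b ≡ true → b ≡ false → ⊥
true≢false refl ()

-- Clique covers and independent sets of equal size, and reductions that preserve them

-- The covered set `A` and the set `B` of possible representatives are separate because the search
-- shrinks them differently: `A` loses a clique, `B` a whole neighbourhood. A colour may depend on
-- the membership proof, which only means that cliques may overlap.
record TightIn {V : Set} (adj : V → V → Bool) (A B : V → Set) : Set where
  constructor tight
  field
    size   : ℕ
    colour : ∀ u → A u → Fin size
    clique : ∀ u v p q → colour u p ≡ colour v q → adj u v ≡ true
    rep    : Fin size → V
    rep∈   : ∀ a → B (rep a)
    indep  : ∀ a b → adj (rep a) (rep b) ≡ true → a ≡ b

-- For the ones of a matrix, adjacent when they share a rectangle, the cliques are the parts of
-- rectangles, so this says that Boolean rank and isolation number agree.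
Tight : {V : Set} → (V → V → Bool) → (V → Set) → Set
Tight adj A = TightIn adj A A

-- Colours are pulled back along `f` and representatives carried along `g`. Each map only has to
-- reflect adjacency, and the two need not be inverse to each other.
transport : ∀ {V V′ : Set} {adj : V → V → Bool} {adj′ : V′ → V′ → Bool}
  {A : V → Set} {A′ : V′ → Set} (f : V → V′) (g : V′ → V) →
  (∀ u → A u → A′ (f u)) → (∀ u → A′ u → A (g u)) →
  (∀ u v → A u → A v → adj′ (f u) (f v) ≡ true → adj u v ≡ true) →
  (∀ u v → A′ u → A′ v → adj (g u) (g v) ≡ true → adj′ u v ≡ true) →
  Tight adj′ A′ → Tight adj A
transport f g Af Ag adjf adjg t = record
  { size   = size
  ; colour = λ u p → colour (f u) (Af u p)
  ; clique = λ u v p q e → adjf u v p q (clique _ _ _ _ e)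
  ; rep    = g ∘ rep
  ; rep∈   = λ a → Ag _ (rep∈ a)
  ; indep  = λ a b e → indep a b (adjg _ _ (rep∈ a) (rep∈ b) e)
  } where open TightIn t

module _ {V : Set} {adj : V → V → Bool} where

  cast : {A A′ : V → Set} → (∀ u → A u → A′ u) → (∀ u → A′ u → A u) →
         Tight adj A′ → Tight adj A
  cast to from = transport id id to from (λ _ _ _ _ e → e) (λ _ _ _ _ e → e)

  Simplicial : (V → Set) → V → Set
  Simplicial A v = A v ×
    (∀ u w → A u → A w → adj v u ≡ true → adj v w ≡ true → adj u w ≡ true)

  AwayFrom : V → (V → Set) → V → Set
  AwayFrom v A u = A u × adj v u ≡ false

module _ {V : Set} {adj : V → V → Bool}
         (adj-sym : ∀ u v → adj u v ≡ true → adj v u ≡ true) where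

  -- The neighbourhood of `v` is one further clique, and `v` is one further representative, adjacent
  -- to nothing that is left.
  simplicial-up : ∀ {A v} → Simplicial {adj = adj} A v →
                  Tight adj (AwayFrom {adj = adj} v A) → Tight adj A
  simplicial-up {A} {v} (Av , cl) t = record
    { size = suc size ; colour = col ; clique = cliq ; rep = rp
    ; rep∈ = λ { zero → Av ; (suc a) → proj₁ (rep∈ a) }
    ; indep = ind }
    where
    open TightIn t
    col′ : ∀ u → A u → (b : Bool) → adj v u ≡ b → Fin (suc size)
    col′ u p true  e = zero
    col′ u p false e = suc (colour u (p , e))
    col : ∀ u → A u → Fin (suc size)
    col u p = col′ u p (adj v u) refl
    cliq′ : ∀ u w p q b b′ e e′ → col′ u p b e ≡ col′ w q b′ e′ → adj u w ≡ true
    cliq′ u w p q true  true  e e′ _  = cl u w p q e e′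
    cliq′ u w p q false false e e′ eq = clique u w _ _ (F.suc-injective eq)
    cliq : ∀ u w p q → col u p ≡ col w q → adj u w ≡ true
    cliq u w p q = cliq′ u w p q _ _ refl refl
    rp : Fin (suc size) → V
    rp zero    = v
    rp (suc a) = rep a
    ind : ∀ a b → adj (rp a) (rp b) ≡ true → a ≡ b
    ind zero    zero    _ = refl
    ind zero    (suc b) e = ⊥-elim (true≢false e (proj₂ (rep∈ b)))
    ind (suc a) zero    e = ⊥-elim (true≢false (adj-sym _ _ e) (proj₂ (rep∈ a)))
    ind (suc a) (suc b) e = cong suc (indep a b e)

  -- No vertex away from `v` shares the colour of `v`, so this colour can be punched out.
  -- Representatives adjacent to `v` are adjacent to each other, so there is at most one, and
  -- dropping it (or any one, if there is none) restores the count.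
  simplicial-down : ∀ {A v} → Simplicial {adj = adj} A v → (∀ u → A u → adj u u ≡ true) →
                    Tight adj A → Tight adj (AwayFrom {adj = adj} v A)
  simplicial-down {A} {v} (Av , cl) adj-refl (tight zero colour _ _ _ _) with () ← colour v Av
  simplicial-down {A} {v} (Av , cl) adj-refl (tight (suc r) colour clique rep rep∈ indep) = record
    { size = r
    ; colour = λ u p → punchOut (differs u p)
    ; clique = λ u w p q e → clique u w _ _ (F.punchOut-injective (differs u p) (differs w q) e)
    ; rep = rep ∘ punchIn (proj₁ drop)
    ; rep∈ = λ a → rep∈ _ , proj₂ drop _ (F.punchInᵢ≢i (proj₁ drop) a)
    ; indep = λ a b e → F.punchIn-injective (proj₁ drop) a b (indep _ _ e)
    }
    where
    differs : ∀ u (p : AwayFrom {adj = adj} v A u) → colour v Av ≢ colour u (proj₁ p)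
    differs u (p , e) eq = true≢false (clique _ _ _ _ eq) e
    away : ∀ b → adj v b ≢ true → adj v b ≡ false
    away b ne with adj v b
    ... | true  = contradiction refl ne
    ... | false = refl
    drop : Σ (Fin (suc r)) λ k → ∀ a → a ≢ k → adj v (rep a) ≡ false
    drop with F.any? (λ a → adj v (rep a) B≟ true)
      where open import Data.Bool.Properties using () renaming (_≟_ to _B≟_)
    ... | yes (k , e) = k , λ a a≢k → away _ λ e′ → a≢k (indep a k (cl _ _ (rep∈ a) (rep∈ k) e′ e))
    ... | no none     = zero , λ a _ → away _ λ e → none (a , e)

  module Dominated (_≟_ : DecidableEquality V) {A : V → Set} (e e′ : V) (Ae′ : A e′) (e′≢e : e′ ≢ e)
                   (adj-refl : ∀ u → A u → adj u u ≡ true)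
                   (dom : ∀ u → A u → adj e′ u ≡ true → adj e u ≡ true) where

    Without : V → Set
    Without u = A u × u ≢ e

    -- Every neighbour of `e′` is a neighbour of `e`, so `e` can join the clique of `e′`.
    dominated-up : Tight adj Without → Tight adj A
    dominated-up t = record
      { size = size ; colour = λ u p → col u p (u ≟ e)
      ; clique = λ u v p q → cliq u v p q (u ≟ e) (v ≟ e)
      ; rep = rep ; rep∈ = proj₁ ∘ rep∈ ; indep = indep }
      where
      open TightIn t
      col : ∀ u → A u → Dec (u ≡ e) → Fin size
      col u p (yes _)  = colour e′ (Ae′ , e′≢e)
      col u p (no u≢e) = colour u (p , u≢e)
      cliq : ∀ u v p q d d′ → col u p d ≡ col v q d′ → adj u v ≡ true
      cliq u v p q (yes refl) (yes refl) _ = adj-refl u p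
      cliq u v p q (yes refl) (no _) eq = dom v q (clique _ _ _ _ eq)
      cliq u v p q (no _) (yes refl) eq = adj-sym _ _ (dom u p (adj-sym _ _ (clique _ _ _ _ eq)))
      cliq u v p q (no _) (no _) eq = clique _ _ _ _ eq

    -- If `e` is a representative, `e′` can take its place, having no neighbours beyond those of
    -- `e`.
    dominated-down : Tight adj A → Tight adj Without
    dominated-down t = record
      { size = size ; colour = λ u p → colour u (proj₁ p)
      ; clique = λ u v p q → clique _ _ _ _
      ; rep = λ a → rp a (rep a ≟ e) ; rep∈ = λ a → in′ a (rep a ≟ e)
      ; indep = λ a b → ind a b (rep a ≟ e) (rep b ≟ e) }
      where
      open TightIn t
      rp : ∀ a → Dec (rep a ≡ e) → V
      rp a (yes _) = e′
      rp a (no _)  = rep a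
      in′ : ∀ a d → Without (rp a d)
      in′ a (yes _) = Ae′ , e′≢e
      in′ a (no ne) = rep∈ a , ne
      ind : ∀ a b d d′ → adj (rp a d) (rp b d′) ≡ true → a ≡ b
      ind a b (yes p) (yes q) _ = indep a b (subst (λ z → adj (rep a) z ≡ true) (trans p (sym q)) (adj-refl _ (rep∈ a)))
      ind a b (yes p) (no _) eq = indep a b (subst (λ z → adj z (rep b) ≡ true) (sym p) (dom _ (rep∈ b) eq))
      ind a b (no _) (yes q) eq = indep a b (subst (λ z → adj (rep a) z ≡ true) (sym q) (adj-sym _ _ (dom _ (rep∈ a) (adj-sym _ _ eq))))
      ind a b (no _) (no _) eq = indep a b eq

-- Contracting an induced path of three vertices

-- The induced path α – β – γ, with β of degree two, is shrunk to the single vertex δ.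
record Contraction {V V′ : Set} (adj : V → V → Bool) (adj′ : V′ → V′ → Bool)
                   (A : V → Set) (A′ : V′ → Set) : Set where
  field
    α β γ : V
    δ     : V′
    f     : V → V′
    g     : V′ → V
  Special : V → Set
  Special u = u ≡ α ⊎ u ≡ β ⊎ u ≡ γ
  Plain : V → Set
  Plain u = A u × ¬ Special u
  field
    _≟_   : DecidableEquality V
    _≟′_  : DecidableEquality V′
    adj-sym  : ∀ u v → adj u v ≡ true → adj v u ≡ true
    adj′-sym : ∀ u v → adj′ u v ≡ true → adj′ v u ≡ true
    adj-refl  : ∀ u → A u → adj u u ≡ true
    adj′-refl : adj′ δ δ ≡ true
    Aα : A α
    Aβ : A β
    Aγ : A γ
    Aδ : A′ δ
    αβ : adj α β ≡ true
    βγ : adj β γ ≡ true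
    αγ : adj α γ ≡ false
    β-nbrs : ∀ u → A u → adj β u ≡ true → Special u
    f-alive : ∀ u → Plain u → A′ (f u) × f u ≢ δ
    g-alive : ∀ u → A′ u → u ≢ δ → Plain (g u) × f (g u) ≡ u
    f-adj : ∀ u v → Plain u → Plain v → adj′ (f u) (f v) ≡ adj u v
    δ-adj : ∀ u → Plain u → adj′ δ (f u) ≡ adj α u ∨ adj γ u
    -- Neighbours of `α` and neighbours of `γ` are never adjacent, so a clique through `δ` lies on
    -- one side only.
    no-chord : ∀ u w → Plain u → Plain w → adj α u ≡ true → adj γ w ≡ true → adj u w ≡ false
    A?    : ∀ u → Dec (A u)
    -- `V` may be infinite. A finite list of the neighbours of `γ` makes it decidable on which side
    -- the clique of `δ` lies.
    near  : List V
    near-complete : ∀ u → Plain u → adj γ u ≡ true → u ∈ near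

  special? : ∀ u → Dec (Special u)
  special? u with u ≟ α | u ≟ β | u ≟ γ
  ... | yes p | _ | _ = yes (inj₁ p)
  ... | no _ | yes p | _ = yes (inj₂ (inj₁ p))
  ... | no _ | no _ | yes p = yes (inj₂ (inj₂ p))
  ... | no x | no y | no z = no λ { (inj₁ p) → x p ; (inj₂ (inj₁ p)) → y p ; (inj₂ (inj₂ p)) → z p }

  plain? : ∀ u → Dec (Plain u)
  plain? u with A? u | special? u
  ... | yes p | no q = yes (p , q)
  ... | no p | _ = no λ x → p (proj₁ x)
  ... | yes _ | yes q = no λ x → proj₂ x q

  ∨-split : ∀ a b → a ∨ b ≡ true → a ≡ true ⊎ b ≡ true
  ∨-split true  b e = inj₁ refl
  ∨-split false b e = inj₂ e

  ∨-left : ∀ {a} b → a ≡ true → a ∨ b ≡ true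
  ∨-left b refl = refl

  ∨-right : ∀ a {b} → b ≡ true → a ∨ b ≡ true
  ∨-right true  refl = refl
  ∨-right false refl = refl

module _ {V V′ : Set} {adj : V → V → Bool} {adj′ : V′ → V′ → Bool} {A : V → Set} {A′ : V′ → Set}
         (con : Contraction adj adj′ A A′) where
  open Contraction con

  private
    pattern isα = inj₁ refl
    pattern isβ = inj₂ (inj₁ refl)
    pattern isγ = inj₂ (inj₂ refl)

    irrelevant-clash : ∀ {b : Bool} {X : Set} → b ≡ true → b ≡ false → X
    irrelevant-clash p q = ⊥-elim (true≢false p q)

  -- Both numbers grow by one. If the clique of `δ` lies on the side of `γ`, it takes `γ` in place
  -- of `δ`, and `α`, `β` form the new clique; otherwise `α` and `γ` change roles. A representative
  -- `δ` splits into `α` and `γ`; without it `β` is added.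
  contract-up : Tight adj′ A′ → Tight adj A
  contract-up t = record
    { size = suc size
    ; colour = λ u p → col u p (special? u)
    ; clique = λ u v p q → cliq u v p q (special? u) (special? v)
    ; rep = proj₁ reps ; rep∈ = proj₁ (proj₂ reps) ; indep = proj₂ (proj₂ reps) }
    where
    open TightIn t
    κ : Fin size
    κ = colour δ Aδ
    -- A colour may depend on the membership proof. Recomputing the proof from its decision gives
    -- each vertex one definite shade, on which `meets?` relies.
    shade : ∀ u → .(Plain u) → Fin size
    shade u p = colour (f u) (proj₁ (f-alive u (recompute (plain? u) p)))
    shade-clique : ∀ u v p q → shade u p ≡ shade v q → adj u v ≡ true
    shade-clique u v p q eq = trans (sym (f-adj u v p q)) (clique _ _ _ _ eq)
    κ-near : ∀ u p → shade u p ≡ κ → adj α u ≡ true ⊎ adj γ u ≡ true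
    κ-near u p eq = ∨-split _ _ (trans (sym (δ-adj u p)) (clique _ _ _ _ (sym eq)))
    Meets : V → Set
    Meets u = Σ (Plain u) λ p → adj γ u ≡ true × shade u p ≡ κ
    meets? : ∀ u → Dec (Meets u)
    meets? u = decide (plain? u)
      where
      decide : Dec (Plain u) → Dec (Meets u)
      decide (no np) = no (np ∘ proj₁)
      decide (yes p) with adj γ u | shade u p F.≟ κ
      ... | true  | yes q = yes (p , refl , q)
      ... | false | _ = no λ { (_ , () , _) }
      ... | true  | no nq = no λ { (p′ , _ , q′) → nq q′ }
    -- Does the clique of δ lie on the side of γ or on the side of α?
    Side : Set
    Side = (∀ u p → shade u p ≡ κ → adj γ u ≡ true) ⊎ (∀ u p → shade u p ≡ κ → adj α u ≡ true)
    side : Side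
    side with any? meets? near
    ... | yes w with find w
    ... | w , _ , pw , γw , κw = inj₁ λ u p κu → case-γ u p κu (κ-near u p κu)
      where
      case-γ : ∀ u p → shade u p ≡ κ → adj α u ≡ true ⊎ adj γ u ≡ true → adj γ u ≡ true
      case-γ u p κu (inj₂ γu) = γu
      case-γ u p κu (inj₁ αu) =
        irrelevant-clash (shade-clique u w p pw (trans κu (sym κw))) (no-chord u w p pw αu γw)
    side | no none = inj₂ λ u p κu → case-α u p κu (κ-near u p κu)
      where
      case-α : ∀ u p → shade u p ≡ κ → adj α u ≡ true ⊎ adj γ u ≡ true → adj α u ≡ true
      case-α u p κu (inj₁ αu) = αu
      case-α u p κu (inj₂ γu) = contradiction (lose (near-complete u p γu) (p , γu , κu)) none

    end-colour : Side → Fin (suc size) × Fin (suc size)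
    end-colour (inj₁ _) = zero , suc κ
    end-colour (inj₂ _) = suc κ , zero

    col′ : Side → ∀ u → A u → Dec (Special u) → Fin (suc size)
    col′ s u p (yes isα) = proj₁ (end-colour s)
    col′ s u p (yes isβ) = zero
    col′ s u p (yes isγ) = proj₂ (end-colour s)
    col′ s u p (no ns)   = suc (shade u (p , ns))
    col : ∀ u → A u → Dec (Special u) → Fin (suc size)
    col = col′ side

    swap-adj : ∀ {u v} → adj u v ≡ true → adj v u ≡ true
    swap-adj = adj-sym _ _

    cliq′ : ∀ s u v p q d d′ → col′ s u p d ≡ col′ s v q d′ → adj u v ≡ true
    cliq′ s u v p q (yes isα) (yes isα) _ = adj-refl u p
    cliq′ s u v p q (yes isα) (yes isβ) _ = αβ
    cliq′ (inj₁ _) u v p q (yes isα) (yes isγ) ()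
    cliq′ (inj₂ _) u v p q (yes isα) (yes isγ) ()
    cliq′ s u v p q (yes isβ) (yes isα) _ = swap-adj αβ
    cliq′ s u v p q (yes isβ) (yes isβ) _ = adj-refl u p
    cliq′ s u v p q (yes isβ) (yes isγ) _ = βγ
    cliq′ (inj₁ _) u v p q (yes isγ) (yes isα) ()
    cliq′ (inj₂ _) u v p q (yes isγ) (yes isα) ()
    cliq′ s u v p q (yes isγ) (yes isβ) _ = swap-adj βγ
    cliq′ s u v p q (yes isγ) (yes isγ) _ = adj-refl u p
    cliq′ (inj₁ _) u v p q (yes isα) (no _) ()
    cliq′ (inj₂ h) u v p q (yes isα) (no n) eq = h v (q , n) (sym (F.suc-injective eq))
    cliq′ s u v p q (yes isβ) (no _) ()
    cliq′ (inj₁ h) u v p q (yes isγ) (no n) eq = h v (q , n) (sym (F.suc-injective eq))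
    cliq′ (inj₂ _) u v p q (yes isγ) (no _) ()
    cliq′ (inj₁ _) u v p q (no _) (yes isα) ()
    cliq′ (inj₂ h) u v p q (no n) (yes isα) eq = swap-adj (h u (p , n) (F.suc-injective eq))
    cliq′ s u v p q (no _) (yes isβ) ()
    cliq′ (inj₁ h) u v p q (no n) (yes isγ) eq = swap-adj (h u (p , n) (F.suc-injective eq))
    cliq′ (inj₂ _) u v p q (no _) (yes isγ) ()
    cliq′ s u v p q (no n) (no n′) eq = shade-clique u v (p , n) (q , n′) (F.suc-injective eq)

    cliq : ∀ u v p q d d′ → col u p d ≡ col v q d′ → adj u v ≡ true
    cliq = cliq′ side

    rep-plain : ∀ a → rep a ≢ δ → Plain (g (rep a)) × f (g (rep a)) ≡ rep a
    rep-plain a = g-alive (rep a) (rep∈ a)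
    g-indep : ∀ a b → rep a ≢ δ → rep b ≢ δ → adj (g (rep a)) (g (rep b)) ≡ true → a ≡ b
    g-indep a b na nb e with rep-plain a na | rep-plain b nb
    ... | pa , ea | pb , eb = indep a b (trans (cong₂ adj′ (sym ea) (sym eb)) (trans (f-adj _ _ pa pb) e))

    δ-edge : ∀ a → rep a ≢ δ → adj α (g (rep a)) ∨ adj γ (g (rep a)) ≡ true → adj′ δ (rep a) ≡ true
    δ-edge a na e with rep-plain a na
    ... | pa , ea = trans (cong (adj′ δ) (sym ea)) (trans (δ-adj _ pa) e)

    β-far : ∀ a → rep a ≢ δ → adj β (g (rep a)) ≡ true → ⊥
    β-far a na e with rep-plain a na
    ... | (p , n) , _ = n (β-nbrs _ p e)

    Reps : Set
    Reps = Σ (Fin (suc size) → V) λ rp → (∀ a → A (rp a)) × (∀ a b → adj (rp a) (rp b) ≡ true → a ≡ b)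

    reps : Reps
    reps with F.any? (λ a → rep a ≟′ δ)
    ... | no none = rp , in′ , ind
      where
      nδ : ∀ a → rep a ≢ δ
      nδ a e = none (a , e)
      rp : Fin (suc size) → V
      rp zero    = β
      rp (suc a) = g (rep a)
      in′ : ∀ a → A (rp a)
      in′ zero    = Aβ
      in′ (suc a) = proj₁ (proj₁ (rep-plain a (nδ a)))
      ind : ∀ a b → adj (rp a) (rp b) ≡ true → a ≡ b
      ind zero    zero    _ = refl
      ind zero    (suc b) e = ⊥-elim (β-far b (nδ b) e)
      ind (suc a) zero    e = ⊥-elim (β-far a (nδ a) (swap-adj e))
      ind (suc a) (suc b) e = cong suc (g-indep a b (nδ a) (nδ b) e)
    ... | yes (k , rk) = rp , in′ , ind
      where
      at-k : ∀ a → rep a ≢ δ → adj′ δ (rep a) ≡ true → ⊥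
      at-k a na e = na (trans (cong rep (sym (indep k a (trans (cong (λ z → adj′ z (rep a)) rk) e)))) rk)
      rp′ : ∀ a → Dec (rep a ≡ δ) → V
      rp′ a (yes _) = α
      rp′ a (no _)  = g (rep a)
      rp : Fin (suc size) → V
      rp zero    = γ
      rp (suc a) = rp′ a (rep a ≟′ δ)
      in″ : ∀ a d → A (rp′ a d)
      in″ a (yes _) = Aα
      in″ a (no n)  = proj₁ (proj₁ (rep-plain a n))
      in′ : ∀ a → A (rp a)
      in′ zero    = Aγ
      in′ (suc a) = in″ a (rep a ≟′ δ)
      γ-far : ∀ a d → adj γ (rp′ a d) ≡ true → ⊥
      γ-far a (yes _) e = true≢false (swap-adj e) αγ
      γ-far a (no n)  e = at-k a n (δ-edge a n (∨-right _ e))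
      ind′ : ∀ a b d d′ → adj (rp′ a d) (rp′ b d′) ≡ true → a ≡ b
      ind′ a b (yes p) (yes q) _ = indep a b (trans (cong₂ adj′ p q) adj′-refl)
      ind′ a b (yes _) (no n)  e = ⊥-elim (at-k b n (δ-edge b n (∨-left _ e)))
      ind′ a b (no n)  (yes _) e = ⊥-elim (at-k a n (δ-edge a n (∨-left _ (swap-adj e))))
      ind′ a b (no n)  (no n′) e = g-indep a b n n′ e
      ind : ∀ a b → adj (rp a) (rp b) ≡ true → a ≡ b
      ind zero    zero    _ = refl
      ind zero    (suc b) e = ⊥-elim (γ-far b (rep b ≟′ δ) e)
      ind (suc a) zero    e = ⊥-elim (γ-far a (rep a ≟′ δ) (swap-adj e))
      ind (suc a) (suc b) e = cong suc (ind′ a b (rep a ≟′ δ) (rep b ≟′ δ) e)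

  -- Both numbers drop by one. The clique of `β` contains only vertices of the path, so its colour
  -- can be punched out. Representatives `α` and `γ` merge into `δ`; in every other case at most one
  -- vertex of the path is a representative and it is dropped.
  contract-down : Tight adj A → Tight adj′ A′
  contract-down (tight zero colour _ _ _ _) with () ← colour α Aα
  contract-down (tight (suc r) colour clique rep rep∈ indep) = record
    { size = r ; colour = λ u p → col u p (u ≟′ δ)
    ; clique = λ u v p q → cliq u v p q (u ≟′ δ) (v ≟′ δ)
    ; rep = proj₁ reps ; rep∈ = proj₁ (proj₂ reps) ; indep = proj₂ (proj₂ reps) }
    where
    swap-adj : ∀ {u v} → adj u v ≡ true → adj v u ≡ true
    swap-adj = adj-sym _ _
    κ : Fin (suc r)
    κ = colour β Aβ
    κ≢ : ∀ u p → ¬ Special u → κ ≢ colour u p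
    κ≢ u p n e = n (β-nbrs u p (clique _ _ _ _ e))
    -- One of the two ends of the path is not in the clique of β; δ joins its clique.
    heir : Σ V λ h → Σ (A h) λ p → κ ≢ colour h p ×
           (∀ u → adj h u ≡ true → adj α u ∨ adj γ u ≡ true)
    heir with κ F.≟ colour α Aα
    ... | no ne = α , Aα , ne , λ u e → ∨-left _ e
    ... | yes e = γ , Aγ , (λ e′ → true≢false (clique _ _ _ _ (trans (sym e) e′)) αγ) , λ u → ∨-right _
    gp : ∀ u → A′ u → u ≢ δ → Plain (g u)
    gp u p n = proj₁ (g-alive u p n)
    fg : ∀ u → (p : A′ u) (n : u ≢ δ) → f (g u) ≡ u
    fg u p n = proj₂ (g-alive u p n)
    κ≢g : ∀ u p n → κ ≢ colour (g u) (proj₁ (gp u p n))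
    κ≢g u p n = κ≢ _ _ (proj₂ (gp u p n))
    κ≢h : κ ≢ colour (proj₁ heir) (proj₁ (proj₂ heir))
    κ≢h = proj₁ (proj₂ (proj₂ heir))
    col : ∀ u → A′ u → Dec (u ≡ δ) → Fin r
    col u p (yes _) = punchOut κ≢h
    col u p (no n)  = punchOut (κ≢g u p n)
    δ-edge : ∀ u p n → adj (proj₁ heir) (g u) ≡ true → adj′ δ u ≡ true
    δ-edge u p n e = trans (cong (adj′ δ) (sym (fg u p n)))
      (trans (δ-adj _ (gp u p n)) (proj₂ (proj₂ (proj₂ heir)) _ e))
    cliq : ∀ u v p q d d′ → col u p d ≡ col v q d′ → adj′ u v ≡ true
    cliq u v p q (yes refl) (yes refl) _ = adj′-refl
    cliq u v p q (yes refl) (no n) e = δ-edge v q n (clique _ _ _ _ (F.punchOut-injective κ≢h (κ≢g v q n) e))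
    cliq u v p q (no n) (yes refl) e = adj′-sym _ _ (δ-edge u p n
      (clique _ _ _ _ (sym (F.punchOut-injective (κ≢g u p n) κ≢h e))))
    cliq u v p q (no n) (no n′) e = trans (cong₂ adj′ (sym (fg u p n)) (sym (fg v q n′)))
      (trans (f-adj _ _ (gp u p n) (gp v q n′)) (clique _ _ _ _ (F.punchOut-injective (κ≢g u p n) (κ≢g v q n′) e)))

    Reps : Set
    Reps = Σ (Fin r → V′) λ rp → (∀ a → A′ (rp a)) × (∀ a b → adj′ (rp a) (rp b) ≡ true → a ≡ b)

    same : ∀ {a b u} → rep a ≡ u → rep b ≡ u → a ≡ b
    same {a} {b} refl eq = indep a b (subst (λ z → adj (rep a) z ≡ true) (sym eq) (adj-refl _ (rep∈ a)))

    dropping : ∀ k → (∀ a → a ≢ k → ¬ Special (rep a)) → Reps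
    dropping k h = (λ a → f (rep (punchIn k a))) , (λ a → proj₁ (f-alive _ (pl a))) ,
      λ a b e → F.punchIn-injective k a b (indep _ _ (trans (sym (f-adj _ _ (pl a) (pl b))) e))
      where
      pl : ∀ a → Plain (rep (punchIn k a))
      pl a = rep∈ _ , h _ (F.punchInᵢ≢i k a)

    reps : Reps
    reps with F.any? (λ a → rep a ≟ α) | F.any? (λ a → rep a ≟ γ) | F.any? (λ a → rep a ≟ β)
    ... | yes (k , ek) | yes (l , el) | _ = rp , in′ , λ a b → ind a b (punchIn k a F.≟ l) (punchIn k b F.≟ l)
      where
      nβ : ∀ a → rep a ≢ β
      nβ a ea with trans (sym ek) (trans (cong rep k≡l) el)
        where
        k≡l : k ≡ l
        k≡l = trans (indep k a (trans (cong₂ adj ek ea) αβ)) (indep a l (trans (cong₂ adj ea el) βγ))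
      ... | αγ≡ = true≢false (trans (cong (adj α) (sym αγ≡)) (adj-refl α Aα)) αγ
      rp′ : ∀ a → Dec (punchIn k a ≡ l) → V′
      rp′ a (yes _) = δ
      rp′ a (no _)  = f (rep (punchIn k a))
      rp : Fin r → V′
      rp a = rp′ a (punchIn k a F.≟ l)
      pl : ∀ a → punchIn k a ≢ l → Plain (rep (punchIn k a))
      pl a n = rep∈ _ , λ { (inj₁ e) → F.punchInᵢ≢i k a (same e ek)
                          ; (inj₂ (inj₁ e)) → nβ _ e
                          ; (inj₂ (inj₂ e)) → n (same e el) }
      in″ : ∀ a d → A′ (rp′ a d)
      in″ a (yes _) = Aδ
      in″ a (no n)  = proj₁ (f-alive _ (pl a n))
      in′ : ∀ a → A′ (rp a)
      in′ a = in″ a (punchIn k a F.≟ l)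
      δ-far : ∀ a n → adj′ δ (rp′ a (no n)) ≡ true → ⊥
      δ-far a n e with ∨-split _ _ (trans (sym (δ-adj _ (pl a n))) e)
      ... | inj₁ p = F.punchInᵢ≢i k a (sym (indep _ _ (trans (cong (λ z → adj z _) ek) p)))
      ... | inj₂ p = n (sym (indep _ _ (trans (cong (λ z → adj z _) el) p)))
      ind : ∀ a b d d′ → adj′ (rp′ a d) (rp′ b d′) ≡ true → a ≡ b
      ind a b (yes p) (yes q) _ = F.punchIn-injective k a b (trans p (sym q))
      ind a b (yes _) (no n)  e = ⊥-elim (δ-far b n e)
      ind a b (no n)  (yes _) e = ⊥-elim (δ-far a n (adj′-sym _ _ e))
      ind a b (no n)  (no n′) e = F.punchIn-injective k a b (indep _ _ (trans (sym (f-adj _ _ (pl a n) (pl b n′))) e))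
    ... | yes (k , ek) | no nγ | _ = dropping k λ
      { a ne (inj₁ e) → ne (same e ek)
      ; a ne (inj₂ (inj₁ e)) → ne (sym (indep k a (trans (cong₂ adj ek e) αβ)))
      ; a ne (inj₂ (inj₂ e)) → nγ (a , e) }
    ... | no nα | yes (l , el) | _ = dropping l λ
      { a ne (inj₁ e) → nα (a , e)
      ; a ne (inj₂ (inj₁ e)) → ne (indep a l (trans (cong₂ adj e el) βγ))
      ; a ne (inj₂ (inj₂ e)) → ne (same e el) }
    ... | no nα | no nγ | yes (k , ek) = dropping k λ
      { a ne (inj₁ e) → nα (a , e)
      ; a ne (inj₂ (inj₁ e)) → ne (same e ek)
      ; a ne (inj₂ (inj₂ e)) → nγ (a , e) }
    -- Without a representative on the path any one may be dropped to lower the count.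
    ... | no nα | no nγ | no nβ = dropping zero λ
      { a ne (inj₁ e) → nα (a , e)
      ; a ne (inj₂ (inj₁ e)) → nβ (a , e)
      ; a ne (inj₂ (inj₂ e)) → nγ (a , e) }

-- Submatrices with optional ones, and elimination of rows and columns

∧-intro : ∀ {a b} → a ≡ true → b ≡ true → a ∧ b ≡ true
∧-intro refl refl = refl

∧-left : ∀ {a b} → a ∧ b ≡ true → a ≡ true
∧-left {true} _ = refl

∧-right : ∀ {a b} → a ∧ b ≡ true → b ≡ true
∧-right {true} e = e

≢true : ∀ {b} → b ≢ true → b ≡ false
≢true {true}  n = contradiction refl n
≢true {false} _ = refl

bool-cases : ∀ b → b ≡ true ⊎ b ≡ false
bool-cases true  = inj₁ refl
bool-cases false = inj₂ refl

module _ {P : Set} (_≟_ : DecidableEquality P) where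

  remove : P → (P → Bool) → P → Bool
  remove p I x = I x ∧ not ⌊ x ≟ p ⌋

  remove-≢ : ∀ {p I x} → remove p I x ≡ true → x ≢ p
  remove-≢ {p} {I} {x} e with I x | x ≟ p
  ... | true | no n = n

  remove-∈ : ∀ {p} I {x} → I x ≡ true → x ≢ p → remove p I x ≡ true
  remove-∈ {p} I {x} e n with I x | x ≟ p
  ... | true | no _  = refl
  ... | true | yes q = contradiction q n

  remove-self : ∀ {p I} → remove p I p ≡ false
  remove-self {p} {I} = ≢true λ e → remove-≢ {p} {I} e refl

  remove-false : ∀ {p I x} → I x ≡ false → remove p I x ≡ false
  remove-false e rewrite e = refl

module _ {R C : Set} (_≟R_ : DecidableEquality R) (_≟C_ : DecidableEquality C) where

  mark : R → C → (R → C → Bool) → R → C → Bool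
  mark a b W x y = W x y ∨ (⌊ x ≟R a ⌋ ∧ ⌊ y ≟C b ⌋)

  mark-old : ∀ {a b W x y} → W x y ≡ true → mark a b W x y ≡ true
  mark-old e rewrite e = refl

  mark-inv : ∀ {a b W x y} → mark a b W x y ≡ true → W x y ≡ true ⊎ (x ≡ a × y ≡ b)
  mark-inv {a} {b} {W} {x} {y} e with W x y | x ≟R a | y ≟C b
  ... | true  | _     | _     = inj₁ refl
  ... | false | yes p | yes q = inj₂ (p , q)

  mark-false : ∀ {a b W x y} → mark a b W x y ≡ false → W x y ≡ false × ¬ (x ≡ a × y ≡ b)
  mark-false {a} {b} {W} {x} {y} e with W x y | x ≟R a | y ≟C b
  ... | false | no n  | _    = refl , λ z → n (proj₁ z)
  ... | false | yes _ | no n = refl , λ z → n (proj₂ z)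

  mark-untouched : ∀ {a b W x y} → W x y ≡ false → ¬ (x ≡ a × y ≡ b) → mark a b W x y ≡ false
  mark-untouched {W = W} w n = ≢true λ e → [ (λ w′ → true≢false w′ w) , n ]′ (mark-inv {W = W} e)

-- Two ones lie in a common rectangle exactly when the other two corners of the block they span are
-- ones. Pairwise adjacency therefore makes the product of all rows and columns occurring in a set a
-- rectangle. Marks are not consulted, so optional ones still support edges.
entry-adj : ∀ {R C : Set} → (R → C → Bool) → R × C → R × C → Bool
entry-adj X (i , j) (p , q) = X i q ∧ X p j

entry-adj-sym : ∀ {R C : Set} (X : R → C → Bool) u v → entry-adj X u v ≡ true → entry-adj X v u ≡ true
entry-adj-sym X (i , j) (p , q) e = ∧-intro (∧-right {X i q} e) (∧-left e)

-- The entries of the submatrix I × J that still have to be covered; those marked by W are ones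
-- that rectangles may use but need not cover.
Alive : ∀ {R C : Set} → (R → C → Bool) → (R → Bool) → (C → Bool) → (R → C → Bool) → R × C → Set
Alive X I J W (x , y) = I x ≡ true × J y ≡ true × X x y ≡ true × W x y ≡ false

alive-refl : ∀ {R C : Set} (X : R → C → Bool) {I J W} u → Alive X I J W u → entry-adj X u u ≡ true
alive-refl X u (_ , _ , e , _) = ∧-intro e e

module Elimination {R C : Set} (_≟R_ : DecidableEquality R) (_≟C_ : DecidableEquality C)
                   (X : R → C → Bool) where

  TightM : (R → Bool) → (C → Bool) → (R → C → Bool) → Set
  TightM I J W = Tight (entry-adj X) (Alive X I J W)

  _∖R_ : (R → Bool) → R → R → Bool
  I ∖R p = remove _≟R_ p I

  _∖C_ : (C → Bool) → C → C → Bool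
  J ∖C q = remove _≟C_ q J

  Away : R × C → (R → Bool) → (C → Bool) → (R → C → Bool) → R × C → Set
  Away v I J W = AwayFrom {adj = entry-adj X} v (Alive X I J W)

  Simp : R × C → (R → Bool) → (C → Bool) → (R → C → Bool) → Set
  Simp v I J W = Simplicial {adj = entry-adj X} (Alive X I J W) v

  module _ {I : R → Bool} {J : C → Bool} {W : R → C → Bool} where

    private
      absent-row : ∀ {p} → (∀ y → ¬ Alive X I J W (p , y)) →
                   ∀ u → Alive X I J W u → Alive X (I ∖R p) J W u
      absent-row none (x , y) (i , j , r) =
        remove-∈ _≟R_ I i (λ { refl → none y (i , j , r) }) , j , r

      absent-col : ∀ {q} → (∀ x → ¬ Alive X I J W (x , q)) →
                   ∀ u → Alive X I J W u → Alive X I (J ∖C q) W u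
      absent-col none (x , y) (i , j , r) =
        i , remove-∈ _≟C_ J j (λ { refl → none x (i , j , r) }) , r

    drop-row : ∀ p → (∀ y → ¬ Alive X I J W (p , y)) → TightM (I ∖R p) J W → TightM I J W
    drop-row p none = cast (absent-row none) λ { (x , y) (i , r) → ∧-left i , r }

    drop-col : ∀ q → (∀ x → ¬ Alive X I J W (x , q)) → TightM I (J ∖C q) W → TightM I J W
    drop-col q none = cast (absent-col none) λ { (x , y) (i , j , r) → i , ∧-left j , r }

    -- A neighbour of `(p , b)` must lie in column `b`, and the ones of a column form a clique. So
    -- `(p , b)` is simplicial, and what lies away from it is exactly what avoids row `p` and column
    -- `b`.
    pendant-row : ∀ p b → (∀ y → J y ≡ true → X p y ≡ true → y ≡ b) →
                  Alive X I J W (p , b) → TightM (I ∖R p) (J ∖C b) W → TightM I J W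
    pendant-row p b row v∈ t =
      simplicial-up (entry-adj-sym X) simp (cast away unaway t)
      where
      simp : Simp (p , b) I J W
      simp = v∈ , λ { (x , y) (x′ , y′) (_ , j , e , _) (_ , j′ , e′ , _) n n′ → clq x y x′ y′ e e′
                        (row y j (∧-left n)) (row y′ j′ (∧-left n′)) }
        where
        clq : ∀ x y x′ y′ → X x y ≡ true → X x′ y′ ≡ true → y ≡ b → y′ ≡ b → X x y′ ∧ X x′ y ≡ true
        clq x y x′ y′ e e′ refl refl = ∧-intro e e′
      away : ∀ u → Away (p , b) I J W u → Alive X (I ∖R p) (J ∖C b) W u
      away (x , y) ((i , j , e , w) , n) = remove-∈ _≟R_ I i x≢p , remove-∈ _≟C_ J j y≢b , e , w
        where
        pb : X p b ≡ true
        pb = proj₁ (proj₂ (proj₂ v∈))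
        y≢b : y ≢ b
        y≢b refl = true≢false (∧-intro pb e) n
        x≢p : x ≢ p
        x≢p refl = y≢b (row y j e)
      unaway : ∀ u → Alive X (I ∖R p) (J ∖C b) W u → Away (p , b) I J W u
      unaway (x , y) (i , j , e , w) = (∧-left i , ∧-left j , e , w) ,
        ≢true λ n → remove-≢ _≟C_ {b} {J} j (row y (∧-left j) (∧-left n))

    pendant-col : ∀ a q → (∀ x → I x ≡ true → X x q ≡ true → x ≡ a) →
                  Alive X I J W (a , q) → TightM (I ∖R a) (J ∖C q) W → TightM I J W
    pendant-col a q col v∈ t =
      simplicial-up (entry-adj-sym X) simp (cast away unaway t)
      where
      simp : Simp (a , q) I J W
      simp = v∈ , λ { (x , y) (x′ , y′) (i , _ , e , _) (i′ , _ , e′ , _) n n′ → clq x y x′ y′ e e′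
                        (col x i (∧-right {X a y} n)) (col x′ i′ (∧-right {X a y′} n′)) }
        where
        clq : ∀ x y x′ y′ → X x y ≡ true → X x′ y′ ≡ true → x ≡ a → x′ ≡ a → X x y′ ∧ X x′ y ≡ true
        clq x y x′ y′ e e′ refl refl = ∧-intro e′ e
      away : ∀ u → Away (a , q) I J W u → Alive X (I ∖R a) (J ∖C q) W u
      away (x , y) ((i , j , e , w) , n) = remove-∈ _≟R_ I i x≢a , remove-∈ _≟C_ J j y≢q , e , w
        where
        aq : X a q ≡ true
        aq = proj₁ (proj₂ (proj₂ v∈))
        x≢a : x ≢ a
        x≢a refl = true≢false (∧-intro e aq) n
        y≢q : y ≢ q
        y≢q refl = x≢a (col x i e)
      unaway : ∀ u → Alive X (I ∖R a) (J ∖C q) W u → Away (a , q) I J W u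
      unaway (x , y) (i , j , e , w) = (∧-left i , ∧-left j , e , w) ,
        ≢true λ n → remove-≢ _≟R_ {a} {I} i (col x (∧-left i) (∧-right {X a y} n))

    -- All neighbours of `(p , q)` lie in the block of rows `p`, `a` and columns `b`, `q`, which
    -- consists of ones, so `(p , q)` is simplicial. Deleting row `p` and column `q` disposes of
    -- this neighbourhood except for `(a , b)`, which stays as a cell but becomes optional.
    module Square (p : R) (q : C) (a : R) (b : C)
      (row : ∀ y → J y ≡ true → X p y ≡ true → y ≡ b ⊎ y ≡ q)
      (col : ∀ x → I x ≡ true → X x q ≡ true → x ≡ p ⊎ x ≡ a)
      (pb : X p b ≡ true) (aq : X a q ≡ true) (ab : X a b ≡ true)
      (v∈ : Alive X I J W (p , q)) where

      private
        pq : X p q ≡ true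
        pq = proj₁ (proj₂ (proj₂ v∈))
        simp : Simp (p , q) I J W
        simp = v∈ , λ { (x , y) (x′ , y′) (i , j , _) (i′ , j′ , _) n n′ →
          ∧-intro (block x y′ (col x i (∧-right {X p y} n)) (row y′ j′ (∧-left n′)))
                  (block x′ y (col x′ i′ (∧-right {X p y′} n′)) (row y j (∧-left n))) }
          where
          block : ∀ x y → x ≡ p ⊎ x ≡ a → y ≡ b ⊎ y ≡ q → X x y ≡ true
          block x y (inj₁ refl) (inj₁ refl) = pb
          block x y (inj₁ refl) (inj₂ refl) = pq
          block x y (inj₂ refl) (inj₁ refl) = ab
          block x y (inj₂ refl) (inj₂ refl) = aq
        away : ∀ u → Away (p , q) I J W u → Alive X (I ∖R p) (J ∖C q) (mark _≟R_ _≟C_ a b W) u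
        away (x , y) ((i , j , e , w) , n) =
          remove-∈ _≟R_ I i (λ { refl → true≢false (∧-intro e pq) n }) ,
          remove-∈ _≟C_ J j (λ { refl → true≢false (∧-intro pq e) n }) , e ,
          mark-untouched _≟R_ _≟C_ {W = W} w λ { (refl , refl) → true≢false (∧-intro pb aq) n }
        unaway : ∀ u → Alive X (I ∖R p) (J ∖C q) (mark _≟R_ _≟C_ a b W) u → Away (p , q) I J W u
        unaway (x , y) (i , j , e , w) = (∧-left i , ∧-left j , e , proj₁ w′) ,
          ≢true λ n → clash (col x (∧-left i) (∧-right {X p y} n)) (row y (∧-left j) (∧-left n))
          where
          w′ : W x y ≡ false × ¬ (x ≡ a × y ≡ b)
          w′ = mark-false _≟R_ _≟C_ {a} {b} {W} w
          clash : x ≡ p ⊎ x ≡ a → y ≡ b ⊎ y ≡ q → ⊥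
          clash (inj₁ x≡p) _ = remove-≢ _≟R_ {p} {I} i x≡p
          clash (inj₂ _) (inj₂ y≡q) = remove-≢ _≟C_ {q} {J} j y≡q
          clash (inj₂ x≡a) (inj₁ y≡b) = proj₂ w′ (x≡a , y≡b)

      square-up : TightM (I ∖R p) (J ∖C q) (mark _≟R_ _≟C_ a b W) → TightM I J W
      square-up t = simplicial-up (entry-adj-sym X) simp (cast away unaway t)

      square-down : TightM I J W → TightM (I ∖R p) (J ∖C q) (mark _≟R_ _≟C_ a b W)
      square-down t = cast unaway away (simplicial-down (entry-adj-sym X) simp (alive-refl X) t)

≡ᵇ-sound : ∀ {m n} → (m ≡ᵇ n) ≡ true → m ≡ n
≡ᵇ-sound e = N.≡ᵇ⇒≡ _ _ (Equivalence.from T-≡ e)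

≡ᵇ-refl : ∀ n → (n ≡ᵇ n) ≡ true
≡ᵇ-refl n = Equivalence.to T-≡ (N.≡⇒≡ᵇ n n refl)

≡ᵇ-≢ : ∀ {m n} → m ≢ n → (m ≡ᵇ n) ≡ false
≡ᵇ-≢ n = ≢true (n ∘ ≡ᵇ-sound)

bool-ext : ∀ {a b} → (a ≡ true → b ≡ true) → (b ≡ true → a ≡ true) → a ≡ b
bool-ext {true}  {b}     f g = sym (f refl)
bool-ext {false} {true}  f g = g refl
bool-ext {false} {false} f g = refl

∨-elim : ∀ {a b} → a ∨ b ≡ true → a ≡ true ⊎ b ≡ true
∨-elim {true}  e = inj₁ refl
∨-elim {false} e = inj₂ e

∨-introˡ : ∀ {a b} → a ≡ true → a ∨ b ≡ true
∨-introˡ refl = refl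

∨-introʳ : ∀ {a b} → b ≡ true → a ∨ b ≡ true
∨-introʳ {true}  _ = refl
∨-introʳ {false} e = e

-- A core with a path under an apex row, and the contraction of the path by one row

-- Indices are unbounded; the size of the matrix enters through the sets `I` and `J`. Shortening the
-- path is then mere renaming by `up` and `down`, and core indices keep their names for every
-- length.
data Ix : Set where
  core path : ℕ → Ix

core-inj : ∀ {x y} → core x ≡ core y → x ≡ y
core-inj refl = refl

_≟I_ : DecidableEquality Ix
core x ≟I core y with x N.≟ y
... | yes refl = yes refl
... | no n = no λ { refl → n refl }
core x ≟I path y = no λ ()
path x ≟I core y = no λ ()
path x ≟I path y with x N.≟ y
... | yes refl = yes refl
... | no n = no λ { refl → n refl }

_≟E_ : DecidableEquality (Ix × Ix)
_≟E_ = ≡-dec _≟I_ _≟I_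

-- The path rows are p₀ … pₘ and the path columns q₀ … qₘ₋₁, where pᵢ has its ones in qᵢ₋₁ and qᵢ
-- with q₋₁ = c and qₘ = d; the apex row r contains c, d and every qⱼ.
record Frame : Set where
  field
    K      : ℕ → ℕ → Bool
    r c d  : ℕ
    K-rc   : K r c ≡ true
    K-rd   : K r d ≡ true
    c≢d    : c ≢ d
    -- A second core row through both ends of the path would create chords when the path is
    -- contracted.
    only-r : ∀ x → K x c ≡ true → K x d ≡ true → x ≡ r

  X : ℕ → Ix → Ix → Bool
  X m (core x) (core y) = K x y
  X m (core x) (path j) = x ≡ᵇ r
  X m (path i) (core y) = ((i ≡ᵇ 0) ∧ (y ≡ᵇ c)) ∨ ((i ≡ᵇ m) ∧ (y ≡ᵇ d))
  -- Row `path m` also receives a one in column `path m`. That column is beyond the last path column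
  -- and is kept out by the bound on `J`.
  X m (path i) (path j) = (j ≡ᵇ i) ∨ (suc j ≡ᵇ i)

  prev : ℕ → Ix
  prev zero    = core c
  prev (suc i) = path i

  X-path-core : ∀ m i y → X m (path i) (core y) ≡ true → (i ≡ 0 × y ≡ c) ⊎ (i ≡ m × y ≡ d)
  X-path-core m i y e with ∨-elim {(i ≡ᵇ 0) ∧ (y ≡ᵇ c)} e
  ... | inj₁ p = inj₁ (≡ᵇ-sound (∧-left p) , ≡ᵇ-sound (∧-right {i ≡ᵇ 0} p))
  ... | inj₂ p = inj₂ (≡ᵇ-sound (∧-left p) , ≡ᵇ-sound (∧-right {i ≡ᵇ m} p))

  X-path-path : ∀ m i j → X m (path i) (path j) ≡ true → j ≡ i ⊎ suc j ≡ i
  X-path-path m i j e with ∨-elim {j ≡ᵇ i} e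
  ... | inj₁ p = inj₁ (≡ᵇ-sound p)
  ... | inj₂ p = inj₂ (≡ᵇ-sound p)

  X-prev : ∀ m i → X m (path i) (prev i) ≡ true
  X-prev m zero    = ∨-introˡ (≡ᵇ-refl c)
  X-prev m (suc i) = ∨-introʳ {i ≡ᵇ suc i} (≡ᵇ-refl i)

  X-same : ∀ m i → X m (path i) (path i) ≡ true
  X-same m i = ∨-introˡ (≡ᵇ-refl i)

  X-last : ∀ m → X m (path m) (core d) ≡ true
  X-last m = ∨-introʳ {(m ≡ᵇ 0) ∧ (d ≡ᵇ c)} (∧-intro (≡ᵇ-refl m) (≡ᵇ-refl d))

  X-r-prev : ∀ m i → X m (core r) (prev i) ≡ true
  X-r-prev m zero    = K-rc
  X-r-prev m (suc i) = ≡ᵇ-refl r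

  up : Ix → Ix
  up (core x) = core x
  up (path i) = path (suc i)

  down : Ix → Ix
  down (core x) = core x
  down (path i) = path (pred i)

  down-up : ∀ x → down (up x) ≡ x
  down-up (core x) = refl
  down-up (path x) = refl

  up≢0 : ∀ x → up x ≢ path 0
  up≢0 (core x) ()
  up≢0 (path x) ()

  up-down : ∀ x → x ≢ path 0 → up (down x) ≡ x
  up-down (core x) n = refl
  up-down (path zero) n = contradiction refl n
  up-down (path (suc x)) n = refl

  up-core : ∀ {x y} → up x ≡ core y → x ≡ core y
  up-core {core x} refl = refl

  -- The short matrix arises from the long one by deleting row and column `path 0`; the only cell
  -- that changes is `δ`, the image of the zero in row `path 1` and column `c`. In the long matrix
  -- row `r` contains row `path 0`, so `τ` is dominated through `β` and `ρ` through `α`; once both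
  -- are gone, `β` has no neighbours but `α` and `γ`. In the short matrix `ρ` is dominated through
  -- `δ`.
  module Shrink (m : ℕ) {I J : Ix → Bool} {W : Ix → Ix → Bool}
    (I0 : I (path 0) ≡ true) (I1 : I (path 1) ≡ true)
    (Jc : J (core c) ≡ true) (J0 : J (path 0) ≡ true)
    (Wα : W (path 0) (core c) ≡ false) (Wβ : W (path 0) (path 0) ≡ false)
    (Wγ : W (path 1) (path 0) ≡ false) (Wδ : W (path 1) (core c) ≡ false) where

    L S : Ix → Ix → Bool
    L = X (suc m)
    S = X m

    I′ J′ : Ix → Bool
    I′ x = I (up x)
    J′ y = J (up y)
    W′ : Ix → Ix → Bool
    W′ x y = W (up x) (up y)

    -- α and δ are the same pair of indices, α in the long and δ in the short matrix.
    α β γ τ ρ δ : Ix × Ix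
    α = path 0 , core c
    β = path 0 , path 0
    γ = path 1 , path 0
    τ = core r , path 0
    ρ = core r , core c
    δ = path 0 , core c

    AL AS : Ix × Ix → Set
    AL = Alive L I J W
    AS = Alive S I′ J′ W′

    L1c : L (path 1) (core c) ≡ false
    L1c = ≢true λ e → [ (λ { (() , _) }) , (λ z → c≢d (proj₂ z)) ]′ (X-path-core (suc m) 1 c e)

    ALα : AL α
    ALα = I0 , Jc , X-prev (suc m) 0 , Wα
    ALβ : AL β
    ALβ = I0 , J0 , X-same (suc m) 0 , Wβ
    ALγ : AL γ
    ALγ = I1 , J0 , X-prev (suc m) 1 , Wγ
    ASδ : AS δ
    ASδ = I1 , Jc , X-prev m 0 , Wδ

    row0 : ∀ y → L (path 0) y ≡ true → y ≡ core c ⊎ y ≡ path 0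
    row0 (core y) e with X-path-core (suc m) 0 y e
    ... | inj₁ (_ , refl) = inj₁ refl
    row0 (path j) e with X-path-path (suc m) 0 j e
    ... | inj₁ refl = inj₂ refl

    col0 : ∀ x → L x (path 0) ≡ true → x ≡ core r ⊎ x ≡ path 0 ⊎ x ≡ path 1
    col0 (core x) e = inj₁ (cong core (≡ᵇ-sound e))
    col0 (path i) e with X-path-path (suc m) i 0 e
    ... | inj₁ refl = inj₂ (inj₁ refl)
    ... | inj₂ refl = inj₂ (inj₂ refl)

    row0-r : ∀ y → L (path 0) y ≡ true → L (core r) y ≡ true
    row0-r y e with row0 y e
    ... | inj₁ refl = K-rc
    ... | inj₂ refl = ≡ᵇ-refl r

    S-row0-r : ∀ y → S (path 0) y ≡ true → S (core r) y ≡ true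
    S-row0-r (core y) e with X-path-core m 0 y e
    ... | inj₁ (_ , refl) = K-rc
    ... | inj₂ (_ , refl) = K-rd
    S-row0-r (path j) e = ≡ᵇ-refl r

    L-dominates : ∀ {A : Ix × Ix → Set} z u → A u →
      entry-adj L (path 0 , z) u ≡ true → entry-adj L (core r , z) u ≡ true
    L-dominates z (x , y) _ e = ∧-intro (row0-r y (∧-left e)) (∧-right {L (path 0) y} e)

    S-dominates : ∀ u → AS u → entry-adj S δ u ≡ true → entry-adj S ρ u ≡ true
    S-dominates (x , y) _ e = ∧-intro (S-row0-r y (∧-left e)) (∧-right {S (path 0) y} e)

    core≢path : ∀ {x i y z} → _≢_ {A = Ix × Ix} (path i , y) (core x , z)
    core≢path ()

    module D1 = Dominated (entry-adj-sym L) _≟E_ {AL} τ β ALβ core≢path (alive-refl L) (L-dominates (path 0))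
    B1 : Ix × Ix → Set
    B1 = D1.Without
    B1-refl : ∀ u → B1 u → entry-adj L u u ≡ true
    B1-refl u p = alive-refl L {I} {J} {W} u (proj₁ p)
    module D2 = Dominated (entry-adj-sym L) _≟E_ {B1} ρ α (ALα , core≢path) core≢path B1-refl (L-dominates (core c))
    B2 : Ix × Ix → Set
    B2 = D2.Without
    module D3 = Dominated (entry-adj-sym S) _≟E_ {AS} ρ δ ASδ core≢path (alive-refl S) S-dominates
    B3 : Ix × Ix → Set
    B3 = D3.Without

    Sp : Ix × Ix → Set
    Sp u = u ≡ α ⊎ u ≡ β ⊎ u ≡ γ
    Pl : Ix × Ix → Set
    Pl u = B2 u × ¬ Sp u

    L-on : ∀ {x y} → Pl (x , y) → L x y ≡ true
    L-on (((( _ , _ , e , _) , _) , _) , _) = e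

    S-L : ∀ x y → ¬ (x ≡ path 0 × y ≡ core c) → S x y ≡ L (up x) (up y)
    S-L (core x) (core y) n = refl
    S-L (core x) (path j) n = refl
    S-L (path (suc i)) (core y) n = refl
    S-L (path zero) (core y) n rewrite ≡ᵇ-≢ {y} {c} (λ { refl → n (refl , refl) }) = refl
    S-L (path i) (path j) n = refl

    row≢ : ∀ {x y} → Pl (x , y) → x ≢ path 0
    row≢ {y = y} p refl with row0 y (L-on p)
    ... | inj₁ refl = proj₂ p (inj₁ refl)
    ... | inj₂ refl = proj₂ p (inj₂ (inj₁ refl))
    col≢ : ∀ {x y} → Pl (x , y) → y ≢ path 0
    col≢ {x = x} p refl with col0 x (L-on p)
    ... | inj₁ refl = proj₂ (proj₁ (proj₁ p)) refl
    ... | inj₂ (inj₁ refl) = proj₂ p (inj₂ (inj₁ refl))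
    ... | inj₂ (inj₂ refl) = proj₂ p (inj₂ (inj₂ refl))

    data Up : Ix × Ix → Set where
      upped : ∀ x y → Up (up x , up y)
    up-view : ∀ u → Pl u → Up u
    up-view (x , y) p = subst Up (cong₂ _,_ (up-down x (row≢ p)) (up-down y (col≢ p))) (upped (down x) (down y))

    not-δ : ∀ x y → Pl (up x , up y) → ¬ (x ≡ path 0 × y ≡ core c)
    not-δ x y p (refl , refl) = true≢false (L-on p) L1c

    fm gm : Ix × Ix → Ix × Ix
    fm (x , y) = down x , down y
    gm (x , y) = up x , up y
    fg : ∀ u → fm (gm u) ≡ u
    fg (x , y) = cong₂ _,_ (down-up x) (down-up y)

    -- Apart from `path 0`, row `path 1` has its ones in path columns, which `r` alone among the
    -- core rows meets, and possibly in `d`, which `only-r` excludes.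
    cross : ∀ x y → K x c ≡ true → x ≢ r → L (path 1) y ≡ true → y ≢ path 0 → L (core x) y ≡ false
    cross x (path j) _ n _ _ = ≡ᵇ-≢ n
    cross x (core y) kc n e _ with X-path-core (suc m) 1 y e
    ... | inj₂ (_ , refl) = ≢true λ kd → n (only-r x kc kd)

    cross′ : ∀ x y y′ → Pl (up x , core c) → Pl (path 1 , y′) → y ≡ y′ → L (up x) y ≡ false
    cross′ (core x) y y′ p q refl =
      cross x y (L-on p) (λ { refl → proj₂ (proj₁ p) refl }) (L-on q) (col≢ q)
    cross′ (path i) y y′ p q refl with X-path-core (suc m) (suc i) c (L-on p)
    ... | inj₂ (_ , e) = contradiction e c≢d

    far : ∀ u → Pl u → B3 (fm u) × fm u ≢ δ
    far u p with up-view u p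
    far _ p@(((( i , j , e , w) , _) , nρ) , _) | upped x y =
      subst (λ u → B3 u × u ≢ δ) (sym (fg (x , y)))
        (((i , j , trans (S-L x y (not-δ x y p)) e , w) , λ { refl → nρ refl })
        , λ { refl → not-δ x y p (refl , refl) })

    back : ∀ u → B3 u → u ≢ δ → Pl (gm u) × fm (gm u) ≡ u
    back (x , y) ((i , j , e , w) , nρ) nδ =
      (( ((i , j , trans (sym (S-L x y λ { (refl , refl) → nδ refl })) e , w)
         , λ e′ → up≢0 y (cong proj₂ e′))
       , λ e′ → nρ (cong₂ _,_ (up-core (cong proj₁ e′)) (up-core (cong proj₂ e′))))
      , λ { (inj₁ e′) → up≢0 x (cong proj₁ e′)
          ; (inj₂ (inj₁ e′)) → up≢0 x (cong proj₁ e′)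
          ; (inj₂ (inj₂ e′)) → up≢0 y (cong proj₂ e′) })
      , fg (x , y)

    is-δ? : ∀ x y → Dec (x ≡ path 0 × y ≡ core c)
    is-δ? x y = (x ≟I path 0) ×-dec (y ≟I core c)

    -- An edge could be gained only through the changed cell. Then one vertex lies in row `path 1`,
    -- the other in column `c` of the long matrix, and by `cross′` the opposite corner of their
    -- block is zero.
    adj-same : ∀ u v → Pl u → Pl v → entry-adj S (fm u) (fm v) ≡ entry-adj L u v
    adj-same u v p q with up-view u p | up-view v q
    ... | upped x y | upped x′ y′ =
      trans (cong₂ (entry-adj S) (fg (x , y)) (fg (x′ , y′))) (go (is-δ? x y′) (is-δ? x′ y))
      where
      go : Dec (x ≡ path 0 × y′ ≡ core c) → Dec (x′ ≡ path 0 × y ≡ core c) →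
           S x y′ ∧ S x′ y ≡ L (up x) (up y′) ∧ L (up x′) (up y)
      go (no n) (no n′) = cong₂ _∧_ (S-L x y′ n) (S-L x′ y n′)
      go (yes (refl , refl)) (yes (refl , refl)) = ⊥-elim (true≢false (L-on p) L1c)
      go (yes (refl , refl)) (no n′) rewrite S-L x′ y n′ | cross′ x′ (up y) (up y) q p refl | L1c =
        ∧-zeroʳ _
      go (no n) (yes (refl , refl)) rewrite S-L x y′ n | cross′ x (up y′) (up y′) p q refl = refl

    δ-same : ∀ u → Pl u → entry-adj S δ (fm u) ≡ entry-adj L α u ∨ entry-adj L γ u
    δ-same u p with up-view u p
    ... | upped x y = trans (cong (entry-adj S δ) (fg (x , y))) (bool-ext (fwd x y p) (bwd x y p))
      where
      fwd : ∀ x y → Pl (up x , up y) → S (path 0) y ∧ S x (core c) ≡ true →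
            (L (path 0) (up y) ∧ L (up x) (core c)) ∨ (L (path 1) (up y) ∧ L (up x) (path 0)) ≡ true
      fwd x (core y) p e with X-path-core m 0 y (∧-left e)
      fwd (core x) (core y) p e | inj₁ (_ , refl) =
        ∨-introˡ (∧-intro (X-prev (suc m) 0) (∧-right {S (path 0) (core c)} e))
      fwd (path x) (core y) p e | inj₁ (_ , refl) with X-path-core (suc m) (suc x) c (L-on p)
      ... | inj₂ (_ , z) = contradiction z c≢d
      -- For `m = 0` the row of `δ` also contains `d`. A core row with both `c` and `d` is the apex,
      -- and it supports the edge to `γ`.
      fwd (core x) (core y) p e | inj₂ (refl , refl)
        with only-r x (∧-right {S (path 0) (core y)} e) (L-on p)
      ... | refl = ∨-introʳ {L (path 0) (core y) ∧ K r c} (∧-intro (X-last 1) (≡ᵇ-refl r))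
      fwd (path x) (core y) p e | inj₂ (refl , refl) with X-path-core m x c (∧-right {S (path 0) (core y)} e)
      ... | inj₁ (refl , _) = ∨-introʳ {L (path 0) (core y) ∧ L (path 1) (core c)} (∧-intro (X-last 1) refl)
      ... | inj₂ (_ , z) = contradiction z c≢d
      fwd x (path j) p e with X-path-path m 0 j (∧-left e)
      fwd (core x) (path _) p e | inj₁ refl =
        L-on p
      fwd (path x) (path _) p e | inj₁ refl with X-path-core m x c (∧-right {S (path 0) (path 0)} e)
      ... | inj₁ (refl , _) = refl
      ... | inj₂ (_ , z) = contradiction z c≢d

      bwd : ∀ x y → Pl (up x , up y) →
            (L (path 0) (up y) ∧ L (up x) (core c)) ∨ (L (path 1) (up y) ∧ L (up x) (path 0)) ≡ true →
            S (path 0) y ∧ S x (core c) ≡ true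
      bwd x y p e with ∨-elim {L (path 0) (up y) ∧ L (up x) (core c)} e
      bwd x y p e | inj₁ e′ with row0 (up y) (∧-left e′)
      ... | inj₂ z = contradiction z (up≢0 y)
      bwd (core x) (core y) p e | inj₁ e′ | inj₁ refl = ∧-intro (X-prev m 0) (∧-right {L (path 0) (core y)} e′)
      bwd (path x) (core y) p e | inj₁ e′ | inj₁ refl with X-path-core (suc m) (suc x) c (L-on p)
      ... | inj₂ (_ , z) = contradiction z c≢d
      bwd x y p e | inj₂ e′ with col0 (up x) (∧-right {L (path 1) (up y)} e′)
      ... | inj₂ (inj₁ z) = contradiction z (up≢0 x)
      bwd (core x) y p e | inj₂ e′ | inj₁ refl = ∧-intro (S0 y (∧-left e′)) K-rc
        where
        S0 : ∀ y → L (path 1) (up y) ≡ true → S (path 0) y ≡ true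
        S0 (core y) e = ∨-introʳ {y ≡ᵇ c} e
        S0 (path j) e = e
      bwd (path zero) y p e | inj₂ e′ | inj₂ (inj₂ z) = ∧-intro (S0 y (∧-left e′)) (X-prev m 0)
        where
        S0 : ∀ y → L (path 1) (up y) ≡ true → S (path 0) y ≡ true
        S0 (core y) e = ∨-introʳ {y ≡ᵇ c} e
        S0 (path j) e = e

    chordless : ∀ u w → Pl u → Pl w → entry-adj L α u ≡ true → entry-adj L γ w ≡ true → entry-adj L u w ≡ false
    chordless u w p q e e′ with up-view u p | up-view w q
    ... | upped x y | upped x′ y′ with row0 (up y) (∧-left e) | col0 (up x′) (∧-right {L (path 1) (up y′)} e′)
    ... | inj₂ z | _ = contradiction z (up≢0 y)
    ... | _ | inj₂ (inj₁ z) = contradiction z (up≢0 x′)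
    ... | inj₁ z | inj₂ (inj₂ z′) = ≢true λ a →
      true≢false (subst (λ t → L t (core c) ≡ true) z′ (subst (λ t → L (up x′) t ≡ true) z (∧-right {L (up x) (up y′)} a))) L1c
    chordless u w p q e e′ | upped (core x) (core y) | upped x′ y′ | inj₁ refl | inj₁ z′ = ≢true λ a →
      true≢false (∧-left a) (cross x (up y′) (L-on p) (λ { refl → proj₂ (proj₁ p) refl }) (∧-left e′) (up≢0 y′))
    chordless u w p q e e′ | upped (path i) (core y) | upped x′ y′ | inj₁ refl | inj₁ z′
      with X-path-core (suc m) (suc i) c (L-on p)
    ... | inj₂ (_ , t) = contradiction t c≢d

    next-only : ∀ y → L (path 1) y ≡ true → y ≢ path 0 → y ≡ core d ⊎ y ≡ path 1
    next-only (core y) e n with X-path-core (suc m) 1 y e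
    ... | inj₂ (_ , refl) = inj₁ refl
    next-only (path j) e n with X-path-path (suc m) 1 j e
    ... | inj₁ refl = inj₂ refl
    ... | inj₂ refl = contradiction refl n

    nearγ : List (Ix × Ix)
    nearγ = (core r , core d) ∷ (core r , path 1) ∷ (path 1 , core d) ∷ (path 1 , path 1) ∷ []
    nearγ-complete : ∀ u → Pl u → entry-adj L γ u ≡ true → u ∈ nearγ
    nearγ-complete (x , y) p e with col0 x (∧-right {L (path 1) y} e) | next-only y (∧-left e) (col≢ p)
    ... | inj₁ refl | inj₁ refl = here refl
    ... | inj₁ refl | inj₂ refl = there (here refl)
    ... | inj₂ (inj₁ refl) | _ = contradiction refl (row≢ p)
    ... | inj₂ (inj₂ refl) | inj₁ refl = there (there (here refl))
    ... | inj₂ (inj₂ refl) | inj₂ refl = there (there (there (here refl)))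

    alive? : ∀ u → Dec (B2 u)
    alive? (x , y) = (( (I x B≟ true) ×-dec (J y B≟ true) ×-dec (L x y B≟ true) ×-dec (W x y B≟ false))
                      ×-dec ¬? ((x , y) ≟E τ)) ×-dec ¬? ((x , y) ≟E ρ)
      where open import Data.Bool.Properties using () renaming (_≟_ to _B≟_)

    αβγ : Contraction (entry-adj L) (entry-adj S) B2 B3
    αβγ = record
      { α = α ; β = β ; γ = γ ; δ = δ ; f = fm ; g = gm ; _≟_ = _≟E_ ; _≟′_ = _≟E_
      ; adj-sym = entry-adj-sym L ; adj′-sym = entry-adj-sym S
      ; adj-refl = λ u p → B1-refl u (proj₁ p) ; adj′-refl = alive-refl S {I′} {J′} {W′} δ ASδ
      ; Aα = (ALα , λ ()) , λ () ; Aβ = (ALβ , λ ()) , λ () ; Aγ = (ALγ , λ ()) , λ ()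
      ; Aδ = ASδ , λ ()
      ; αβ = ∧-intro (X-same (suc m) 0) (X-prev (suc m) 0)
      ; βγ = ∧-intro (X-same (suc m) 0) (X-prev (suc m) 1)
      ; αγ = ≢true λ e → true≢false (∧-right {L (path 0) (path 0)} e) L1c
      ; β-nbrs = β-nbrs
      ; f-alive = far ; g-alive = back ; f-adj = adj-same ; δ-adj = δ-same
      ; no-chord = chordless ; A? = alive? ; near = nearγ ; near-complete = nearγ-complete }
      where
      β-nbrs : ∀ u → B2 u → entry-adj L β u ≡ true → Sp u
      β-nbrs (x , y) p e with row0 y (∧-left e) | col0 x (∧-right {L (path 0) y} e)
      ... | inj₁ refl | inj₁ refl = contradiction refl (proj₂ p)
      ... | inj₁ refl | inj₂ (inj₁ refl) = inj₁ refl
      ... | inj₁ refl | inj₂ (inj₂ refl) = ⊥-elim (true≢false (proj₁ (proj₂ (proj₂ (proj₁ (proj₁ p))))) L1c)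
      ... | inj₂ refl | inj₁ refl = contradiction refl (proj₂ (proj₁ p))
      ... | inj₂ refl | inj₂ (inj₁ refl) = inj₂ (inj₁ refl)
      ... | inj₂ refl | inj₂ (inj₂ refl) = inj₂ (inj₂ refl)

    -- Domination is used in opposite directions on the two sides: `ρ` leaves the short matrix
    -- before the expansion, and `ρ` and `τ` return to the long one after it.
    shrink-up : Tight (entry-adj S) AS → Tight (entry-adj L) AL
    shrink-up t = D1.dominated-up (D2.dominated-up (contract-up αβγ (D3.dominated-down t)))

    shrink-down : Tight (entry-adj L) AL → Tight (entry-adj S) AS
    shrink-down t = D3.dominated-up (contract-down αβγ (D2.dominated-down (D1.dominated-down t)))

-- Stripping a damaged path from the gap to both ends

_⊑_ : {P : Set} → (P → Bool) → (P → Bool) → Set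
I′ ⊑ I = ∀ x → I′ x ≡ true → I x ≡ true

⊑-false : {P : Set} {I′ I : P → Bool} {x : P} → I′ ⊑ I → I x ≡ false → I′ x ≡ false
⊑-false s e = ≢true λ e′ → true≢false (s _ e′) e

module Stripping {R C : Set} (_≟R_ : DecidableEquality R) (_≟C_ : DecidableEquality C)
                 (X : R → C → Bool) where
  open Elimination _≟R_ _≟C_ X

  private
    alive-or-dead : ∀ I J W x y → X x y ≡ true → Alive X I J W (x , y) ⊎ ¬ Alive X I J W (x , y)
    alive-or-dead I J W x y e with I x in i | J y in j | W x y in w
    ... | true  | true  | false = inj₁ (refl , refl , e , refl)
    ... | false | _     | _     = inj₂ λ { (() , _) }
    ... | true  | false | _     = inj₂ λ { (_ , () , _) }
    ... | true  | true  | true  = inj₂ λ { (_ , _ , _ , ()) }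

  -- Column `b` disappears with row `p` only if `(p , b)` is alive. The continuation sees just what
  -- is common to both cases: the sets shrink and `p` is gone.
  cut-row : ∀ {I J W} p b → X p b ≡ true → (∀ y → J y ≡ true → X p y ≡ true → y ≡ b) →
            (∀ I′ J′ → I′ ⊑ I → J′ ⊑ J → I′ p ≡ false → TightM I′ J′ W) → TightM I J W
  cut-row {I} {J} {W} p b pb row k with alive-or-dead I J W p b pb
  ... | inj₁ v∈ = pendant-row p b row v∈
          (k _ _ (λ _ → ∧-left) (λ _ → ∧-left) (remove-self _≟R_ {p} {I}))
  ... | inj₂ none = drop-row p none′
          (k _ _ (λ _ → ∧-left) (λ _ e → e) (remove-self _≟R_ {p} {I}))
    where
    none′ : ∀ y → ¬ Alive X I J W (p , y)
    none′ y v∈@(_ , j , e , _) with row y j e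
    ... | refl = none v∈

  cut-col : ∀ {I J W} a q → X a q ≡ true → (∀ x → I x ≡ true → X x q ≡ true → x ≡ a) →
            (∀ I′ J′ → I′ ⊑ I → J′ ⊑ J → J′ q ≡ false → TightM I′ J′ W) → TightM I J W
  cut-col {I} {J} {W} a q aq col k with alive-or-dead I J W a q aq
  ... | inj₁ v∈ = pendant-col a q col v∈
          (k _ _ (λ _ → ∧-left) (λ _ → ∧-left) (remove-self _≟C_ {q} {J}))
  ... | inj₂ none = drop-col q none′
          (k _ _ (λ _ e → e) (λ _ → ∧-left) (remove-self _≟C_ {q} {J}))
    where
    none′ : ∀ x → ¬ Alive X I J W (x , q)
    none′ x v∈@(i , _ , e , _) with col x i e
    ... | refl = none v∈

  -- According to the presence of row `p` and column `q` this is a simplicial corner, a pendant row,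
  -- a pendant column or nothing at all. The continuation hides the difference; at most `(a , b)`
  -- has become optional.
  strip : ∀ {I J W} p q a b →
    (∀ y → J y ≡ true → X p y ≡ true → y ≡ b ⊎ y ≡ q) →
    (∀ x → I x ≡ true → X x q ≡ true → x ≡ p ⊎ x ≡ a) →
    X p q ≡ true → X p b ≡ true → X a q ≡ true → X a b ≡ true → W p q ≡ false →
    (∀ I′ J′ W′ → I′ ⊑ I → J′ ⊑ J → I′ p ≡ false → J′ q ≡ false →
       (∀ x y → W′ x y ≡ true → W x y ≡ true ⊎ (x ≡ a × y ≡ b)) → TightM I′ J′ W′) →
    TightM I J W
  strip {I} {J} {W} p q a b row col pq pb aq ab w k with bool-cases (I p) | bool-cases (J q)
  ... | inj₁ i | inj₁ j = Square.square-up p q a b row col pb aq ab (i , j , pq , w)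
        (k _ _ _ (λ _ → ∧-left) (λ _ → ∧-left) (remove-self _≟R_ {p} {I}) (remove-self _≟C_ {q} {J})
           λ x y → mark-inv _≟R_ _≟C_ {a} {b} {W})
  ... | inj₁ i | inj₂ j = cut-row p b pb row′
        λ I′ J′ I⊑ J⊑ e → k I′ J′ W I⊑ J⊑ e (⊑-false J⊑ j) (λ _ _ → inj₁)
    where
    row′ : ∀ y → J y ≡ true → X p y ≡ true → y ≡ b
    row′ y jy e with row y jy e
    ... | inj₁ z    = z
    ... | inj₂ refl = ⊥-elim (true≢false jy j)
  ... | inj₂ i | inj₁ j = cut-col a q aq col′
        λ I′ J′ I⊑ J⊑ e → k I′ J′ W I⊑ J⊑ (⊑-false I⊑ i) e (λ _ _ → inj₁)
    where
    col′ : ∀ x → I x ≡ true → X x q ≡ true → x ≡ a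
    col′ x ix e with col x ix e
    ... | inj₁ refl = ⊥-elim (true≢false ix i)
    ... | inj₂ z    = z
  ... | inj₂ i | inj₂ j = k I J W (λ _ e → e) (λ _ e → e) i j (λ _ _ → inj₁)

Within : ℕ → ℕ → (Ix → Bool) → Set
Within n k I = (∀ x → I (core x) ≡ true → x < n) × (∀ i → I (path i) ≡ true → i < k)

within-⊑ : ∀ {n k I I′} → Within n k I → I′ ⊑ I → Within n k I′
within-⊑ (cs , ps) s = (λ x e → cs x (s _ e)) , (λ i e → ps i (s _ e))

module BrokenPath (F : Frame) (a b m : ℕ) (Corner : Ix → Ix → Set)
                  (corner-inner : ∀ i j → ¬ Corner (path i) (path j)) where
  open Frame F
  open Elimination _≟I_ _≟I_ (X m)
  open Stripping _≟I_ _≟I_ (X m)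

  -- The invariant of the stripping. Each elimination marks an entry of the apex row, whatever its
  -- column, so all of them have to be tolerated; other marks come from the stretched entries.
  Marks : (Ix → Ix → Bool) → Set
  Marks W = ∀ x y → W x y ≡ true → x ≡ core r ⊎ Corner x y

  RowsIn ColsIn : (Ix → Bool) → Set
  RowsIn = Within a (suc m)
  ColsIn = Within b m

  NoRows NoCols : ℕ → (Ix → Bool) → Set
  NoRows k I = ∀ i → i < k → I (path i) ≡ false
  NoCols k J = ∀ j → j < k → J (path j) ≡ false

  private
    marks-inner : ∀ {W} i j → Marks W → W (path i) (path j) ≡ false
    marks-inner i j mk = ≢true λ e → [ (λ ()) , corner-inner i j ]′ (mk _ _ e)

    marks-step : ∀ {W W′ b} → Marks W → (∀ x y → W′ x y ≡ true → W x y ≡ true ⊎ (x ≡ core r × y ≡ b)) → Marks W′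
    marks-step mk inv x y e with inv x y e
    ... | inj₁ e′      = mk x y e′
    ... | inj₂ (z , _) = inj₁ z

    extend : ∀ (I : Ix → Bool) {k} → NoRows k I → I (path k) ≡ false → NoRows (suc k) I
    extend I {k} nr e i i<k+1 with N.m<1+n⇒m<n∨m≡n i<k+1
    ... | inj₁ i<k  = nr i i<k
    ... | inj₂ refl = e

  -- With row `path (suc i)` missing, column `path i` meets only row `path i` and the apex, while
  -- row `path i` has just the columns `prev i` and `path i`. Stripping this pair moves the gap one
  -- step towards `c`.
  left : ∀ k {I J W} → Marks W → k ≤ m → I (path k) ≡ false →
    (∀ I′ J′ W′ → I′ ⊑ I → J′ ⊑ J → Marks W′ → NoRows (suc k) I′ → NoCols k J′ → TightM I′ J′ W′) →
    TightM I J W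
  left zero {I} mk _ e cont = cont _ _ _ (λ _ z → z) (λ _ z → z) mk (extend I (λ _ ()) e) (λ _ ())
  left (suc i) {I} {J} mk si≤m e cont =
    strip (path i) (path i) (core r) (prev i) row col (X-same m i) (X-prev m i) (≡ᵇ-refl r) (X-r-prev m i)
      (marks-inner i i mk) λ I′ J′ W′ I⊑ J⊑ ei ej w →
      left i (marks-step mk w) (N.<⇒≤ si≤m) ei λ I″ J″ W″ I⊑′ J⊑′ mk′ nr nc →
        cont I″ J″ W″ (λ x z → I⊑ x (I⊑′ x z)) (λ x z → J⊑ x (J⊑′ x z)) mk′
          (extend I″ nr (⊑-false I⊑′ (⊑-false I⊑ e)))
          (extend J″ nc (⊑-false J⊑′ ej))
    where
    row : ∀ y → J y ≡ true → X m (path i) y ≡ true → y ≡ prev i ⊎ y ≡ path i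
    row (core y) _ e′ with X-path-core m i y e′
    ... | inj₁ (refl , refl) = inj₁ refl
    ... | inj₂ (refl , _) = contradiction si≤m N.1+n≰n
    row (path j) _ e′ with X-path-path m i j e′
    ... | inj₁ refl = inj₂ refl
    ... | inj₂ refl = inj₁ refl
    col : ∀ x → I x ≡ true → X m x (path i) ≡ true → x ≡ path i ⊎ x ≡ core r
    col (core x) _ e′ = inj₂ (cong core (≡ᵇ-sound e′))
    col (path j) jx e′ with X-path-path m j i e′
    ... | inj₁ refl = inj₁ refl
    ... | inj₂ refl = ⊥-elim (true≢false jx e)

  -- The column in which row `path k` leaves the path towards `d`; `n` counts the path rows beyond
  -- it, so `n = 0` means the end of the path.
  next : ℕ → ℕ → Ix
  next zero    k = core d
  next (suc n) k = path k

  private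
    next-on : ∀ n k → suc n + k ≡ m → X m (path (suc k)) (next n (suc k)) ≡ true
    next-on zero    k refl = X-last (suc k)
    next-on (suc n) k _    = X-same m (suc k)

    r-next : ∀ n k → X m (core r) (next n k) ≡ true
    r-next zero    k = K-rd
    r-next (suc n) k = ≡ᵇ-refl r

    next-row : ∀ n k {J} → suc n + k ≡ m → ColsIn J →
               ∀ y → J y ≡ true → X m (path (suc k)) y ≡ true → y ≡ next n (suc k) ⊎ y ≡ path k
    next-row n k eq ci (core y) _ e with X-path-core m (suc k) y e
    next-row zero    k eq ci (core y) _ e | inj₂ (_ , refl) = inj₁ refl
    next-row (suc n) k eq ci (core y) _ e | inj₂ (refl , refl) =
      contradiction (N.suc-injective eq) (N.m+1+n≢n n ∘ trans (N.+-suc n k))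
    next-row n k eq ci (path j) jj e with X-path-path m (suc k) j e
    next-row n       k eq   ci (path j) jj e | inj₂ refl = inj₂ refl
    next-row zero    k refl ci (path j) jj e | inj₁ refl = contradiction (proj₂ ci _ jj) N.1+n≰n
    next-row (suc n) k eq   ci (path j) jj e | inj₁ refl = inj₁ refl

  -- Mirror image of `left`: with row `path k` missing, column `path k` meets only row
  -- `path (suc k)` and the apex. The number `n` of path rows still to be stripped drives the
  -- recursion.
  right : ∀ n k {I J W} → n + k ≡ m → Marks W → RowsIn I → ColsIn J → NoRows (suc k) I → NoCols k J →
    (∀ I′ J′ W′ → I′ ⊑ I → J′ ⊑ J → Marks W′ → NoRows (suc m) I′ → NoCols m J′ → TightM I′ J′ W′) →
    TightM I J W
  right zero k refl mk _ _ nr nc cont = cont _ _ _ (λ _ z → z) (λ _ z → z) mk nr nc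
  right (suc n) k {I} {J} eq mk ri ci nr nc cont =
    strip (path (suc k)) (path k) (core r) (next n (suc k)) (next-row n k eq ci) col
      (X-prev m (suc k)) (next-on n k eq) (≡ᵇ-refl r) (r-next n (suc k))
      (marks-inner (suc k) k mk) λ I′ J′ W′ I⊑ J⊑ ei ej w →
      right n (suc k) (trans (N.+-suc n k) eq) (marks-step mk w) (within-⊑ ri I⊑) (within-⊑ ci J⊑)
        (extend I′ (λ i lt → ⊑-false I⊑ (nr i lt)) ei) (extend J′ (λ i lt → ⊑-false J⊑ (nc i lt)) ej)
        λ I″ J″ W″ I⊑′ J⊑′ → cont I″ J″ W″ (λ x z → I⊑ x (I⊑′ x z)) (λ x z → J⊑ x (J⊑′ x z))
    where
    col : ∀ x → I x ≡ true → X m x (path k) ≡ true → x ≡ path (suc k) ⊎ x ≡ core r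
    col (core x) _ e = inj₂ (cong core (≡ᵇ-sound e))
    col (path i) ii e with X-path-path m i k e
    ... | inj₁ refl = ⊥-elim (true≢false ii (nr k (N.n<1+n k)))
    ... | inj₂ refl = inj₁ refl

  module _ (core-tight : ∀ I J W → Marks W → RowsIn I → ColsIn J → (∀ i → I (path i) ≡ false) →
                         (∀ j → J (path j) ≡ false) → TightM I J W) where

    no-row-tight : ∀ k {I J W} → k ≤ m → Marks W → RowsIn I → ColsIn J → I (path k) ≡ false → TightM I J W
    no-row-tight k {I} {J} k≤m mk ri ci e =
      left k mk k≤m e λ I′ J′ W′ I⊑ J⊑ mk′ nr nc →
      right (m ∸ k) k (N.m∸n+n≡m k≤m) mk′ (within-⊑ ri I⊑) (within-⊑ ci J⊑) nr nc
        λ I″ J″ W″ I⊑′ J⊑′ mk″ nr′ nc′ → let ri′ = within-⊑ (within-⊑ ri I⊑) I⊑′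
                                             ci′ = within-⊑ (within-⊑ ci J⊑) J⊑′ in
          core-tight I″ J″ W″ mk″ ri′ ci′
            (λ i → ≢true λ z → true≢false z (nr′ i (proj₂ ri′ i z)))
            (λ j → ≢true λ z → true≢false z (nc′ j (proj₂ ci′ j z)))

    -- A missing column, be it a path column, `c` or `d`, leaves some path row with a single
    -- available one. Cutting that row opens a gap from which both sides can be stripped.
    cut-tight : ∀ k b {I J W} → k ≤ m → Marks W → RowsIn I → ColsIn J → X m (path k) b ≡ true →
      (∀ y → J y ≡ true → X m (path k) y ≡ true → y ≡ b) → TightM I J W
    cut-tight k b k≤m mk ri ci kb row = cut-row (path k) b kb row λ I′ J′ I⊑ J⊑ e →
      no-row-tight k k≤m mk (within-⊑ ri I⊑) (within-⊑ ci J⊑) e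

    no-col-tight : ∀ k {I J W} → k < m → Marks W → RowsIn I → ColsIn J → J (path k) ≡ false → TightM I J W
    no-col-tight k {I} {J} k<m mk ri ci e = cut-tight k (prev k) (N.<⇒≤ k<m) mk ri ci (X-prev m k) row
      where
      row : ∀ y → J y ≡ true → X m (path k) y ≡ true → y ≡ prev k
      row (core y) _ e′ with X-path-core m k y e′
      ... | inj₁ (refl , refl) = refl
      ... | inj₂ (refl , _) = contradiction k<m N.1+n≰n
      row (path j) jj e′ with X-path-path m k j e′
      ... | inj₁ refl = ⊥-elim (true≢false jj e)
      ... | inj₂ refl = refl

    no-d-tight : ∀ {I J W} → Marks W → RowsIn I → ColsIn J → J (core d) ≡ false → TightM I J W
    no-d-tight {I} {J} mk ri ci e = cut-tight m (prev m) N.≤-refl mk ri ci (X-prev m m) row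
      where
      row : ∀ y → J y ≡ true → X m (path m) y ≡ true → y ≡ prev m
      row (core y) jy e′ with X-path-core m m y e′
      ... | inj₁ (refl , refl) = refl
      ... | inj₂ (_ , refl) = ⊥-elim (true≢false jy e)
      row (path j) jj e′ with X-path-path m m j e′
      ... | inj₁ refl = contradiction (proj₂ ci _ jj) N.1+n≰n
      ... | inj₂ refl = refl

    no-c-tight : ∀ {I J W} → Marks W → RowsIn I → ColsIn J → J (core c) ≡ false → TightM I J W
    no-c-tight {I} {J} mk ri ci e = cut-tight 0 (next m 0) z≤n mk ri ci (on m) (row m (proj₂ ci))
      where
      on : ∀ n → X n (path 0) (next n 0) ≡ true
      on zero    = X-last 0
      on (suc n) = refl
      row : ∀ n → (∀ j → J (path j) ≡ true → j < n) → ∀ y → J y ≡ true → X n (path 0) y ≡ true → y ≡ next n 0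
      row n ci′ (core y) jy e′ with X-path-core n 0 y e′
      ... | inj₁ (_ , refl) = ⊥-elim (true≢false jy e)
      ... | inj₂ (refl , refl) = refl
      row n ci′ (path j) jj e′ with X-path-path n 0 j e′
      row zero    ci′ (path _) jj e′ | inj₁ refl with () ← ci′ _ jj
      row (suc n) ci′ (path _) jj e′ | inj₁ refl = refl

-- Exhaustive search for equality, and counting against it

T⇒≡ : ∀ {b} → T b → b ≡ true
T⇒≡ = Equivalence.to T-≡

≡⇒T : ∀ {b} → b ≡ true → T b
≡⇒T = Equivalence.from T-≡

any-sound : ∀ {V : Set} (p : V → Bool) xs → any p xs ≡ true → ∃ λ x → x ∈ xs × p x ≡ true
any-sound p xs e with find (Any.any⁻ p xs (≡⇒T e))
... | x , x∈ , px = x , x∈ , T⇒≡ px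

any-complete : ∀ {V : Set} (p : V → Bool) {xs x} → x ∈ xs → p x ≡ true → any p xs ≡ true
any-complete p x∈ e = T⇒≡ (Any.any⁺ p (lose x∈ (≡⇒T e)))

all-sound : ∀ {V : Set} (p : V → Bool) {xs x} → all p xs ≡ true → x ∈ xs → p x ≡ true
all-sound p {xs} e x∈ = T⇒≡ (All.lookup (All.all⁺ p xs (≡⇒T e)) x∈)

filterᵇ⁺ : ∀ {V : Set} (p : V → Bool) {xs x} → x ∈ xs → p x ≡ true → x ∈ filterᵇ p xs
filterᵇ⁺ p x∈ e = ∈-filter⁺ (T? ∘ p) x∈ (≡⇒T e)

filterᵇ⁻ : ∀ {V : Set} (p : V → Bool) {xs x} → x ∈ filterᵇ p xs → x ∈ xs × p x ≡ true
filterᵇ⁻ p {xs} x∈ with ∈-filter⁻ (T? ∘ p) {xs = xs} x∈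
... | m , e = m , T⇒≡ e

not-true : ∀ {b} → not b ≡ true → b ≡ false
not-true {false} _ = refl

not-false : ∀ {b} → b ≡ false → not b ≡ true
not-false refl = refl

module Search {V : Set} (adj : V → V → Bool)
              (adj-sym : ∀ u v → adj u v ≡ true → adj v u ≡ true) where

  cliqueᵇ : List V → Bool
  cliqueᵇ K = all (λ u → all (adj u) K) K

  -- Backtracking for a cover of A by cliques, one for each of a set of pairwise non-adjacent elements of B.
  search : ℕ → List V → List V → Bool
  search n       []        B = true
  search zero    (_ ∷ _)   B = false
  search (suc n) A@(_ ∷ _) B =
    -- The candidate clique is the common neighbourhood of `v` and `w`. It contains `w`, which need
    -- not be the representative `v`: `v` may already have been covered by an earlier clique.
    any (λ v → any (λ w → cliqueᵇ (filterᵇ (λ u → adj v u ∧ adj w u) A) ∧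
                          search n (filterᵇ (λ u → not (adj v u ∧ adj w u)) A) (filterᵇ (not ∘ adj v) B))
                   (filterᵇ (adj v) A)) B

  search-sound : ∀ n A B → search n A B ≡ true → TightIn adj (_∈ A) (_∈ B)
  search-sound n [] B e = tight 0 (λ _ ()) (λ _ _ ()) (λ ()) (λ ()) (λ ())
  search-sound (suc n) A@(_ ∷ _) B e with any-sound _ B e
  ... | v , v∈ , e′ with any-sound _ (filterᵇ (adj v) A) e′
  ... | w , w∈ , e″ = record
    { size = suc size ; colour = λ u p → col u p _ refl ; clique = λ u u′ p q → cliq u u′ p q _ _ refl refl
    ; rep = rp ; rep∈ = rp∈ ; indep = ind }
    where
    P : V → Bool
    P u = adj v u ∧ adj w u
    open TightIn (search-sound n (filterᵇ (not ∘ P) A) (filterᵇ (not ∘ adj v) B) (∧-right {cliqueᵇ (filterᵇ P A)} e″))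
    col : ∀ u → u ∈ A → (b : Bool) → P u ≡ b → Fin (suc size)
    col u p true  e = zero
    col u p false e = suc (colour u (filterᵇ⁺ (not ∘ P) p (not-false e)))
    cliq : ∀ u u′ p q b b′ e e′ → col u p b e ≡ col u′ q b′ e′ → adj u u′ ≡ true
    cliq u u′ p q true true e e′ _ =
      all-sound _ (all-sound _ (∧-left {cliqueᵇ (filterᵇ P A)} e″) (filterᵇ⁺ P p e)) (filterᵇ⁺ P q e′)
    cliq u u′ p q false false e e′ eq = clique u u′ _ _ (F.suc-injective eq)
    rp : Fin (suc size) → V
    rp zero    = v
    rp (suc a) = rep a
    rp∈ : ∀ a → rp a ∈ B
    rp∈ zero    = v∈
    rp∈ (suc a) = proj₁ (filterᵇ⁻ (not ∘ adj v) (rep∈ a))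
    far : ∀ a → adj v (rep a) ≡ false
    far a = not-true (proj₂ (filterᵇ⁻ (not ∘ adj v) {B} (rep∈ a)))
    ind : ∀ a b → adj (rp a) (rp b) ≡ true → a ≡ b
    ind zero    zero    _ = refl
    ind zero    (suc b) e = ⊥-elim (true≢false e (far b))
    ind (suc a) zero    e = ⊥-elim (true≢false (adj-sym _ _ e) (far a))
    ind (suc a) (suc b) e = cong suc (indep a b e)

  independentᵇ : ℕ → List V → Bool
  independentᵇ zero    B = true
  independentᵇ (suc k) B = any (λ v → independentᵇ k (filterᵇ (not ∘ adj v) B)) B

  -- The contrapositive is what counts: a negative outcome of the test bounds the independence
  -- number.
  independentᵇ-complete : ∀ k r B (rep : Fin r → V) → k ≤ r → (∀ a → rep a ∈ B) →
    (∀ a b → adj (rep a) (rep b) ≡ true → a ≡ b) → independentᵇ k B ≡ true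
  independentᵇ-complete zero    r       B rep _         _  _   = refl
  independentᵇ-complete (suc k) (suc r) B rep (s≤s k≤r) in′ ind =
    any-complete _ (in′ zero) (independentᵇ-complete k r _ (rep ∘ suc) k≤r
      (λ a → filterᵇ⁺ _ (in′ (suc a)) (not-false (≢true λ e → F.0≢1+n (ind zero (suc a) e))))
      (λ a b e → F.suc-injective (ind (suc a) (suc b) e)))

module _ {r n : ℕ} (f : Fin n → Fin r) where
  private
    Repeat : Fin n → Set
    Repeat j = ∃ λ i → i Fin.< j × f i ≡ f j

    repeat? : ∀ j → Dec (Repeat j)
    repeat? j = F.any? λ i → (i F.<? j) ×-dec (f i F.≟ f j)

    side : ∀ j → Dec (Repeat j) → Fin r ⊎ Fin r
    side j (yes _) = inj₁ (f j)
    side j (no _)  = inj₂ (f j)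

    Triple : Set
    Triple = ∃ λ i → ∃ λ j → ∃ λ k → i Fin.< j × j Fin.< k × f i ≡ f j × f j ≡ f k

    triple : ∀ {j k} d d′ → j Fin.< k → side j d ≡ side k d′ → Triple
    triple {j} {k} (yes (i , i<j , fij)) (yes _) j<k eq = i , j , k , i<j , j<k , fij , inj₁-injective eq
    triple {j} {k} (no _) (no none) j<k eq = contradiction (j , j<k , inj₂-injective eq) none

  -- Each index is filed under its value and whether that value occurred before, which gives `r + r`
  -- boxes. Two indices in one box cannot both be first occurrences, so the value has an earlier
  -- third one.
  pigeonhole₃ : r + r < n → Triple
  pigeonhole₃ r+r<n with F.pigeonhole r+r<n (λ j → Fin.join r r (side j (repeat? j)))
  ... | j , k , j<k , e = triple (repeat? j) (repeat? k) j<k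
    (trans (sym (F.splitAt-join r r _)) (trans (cong (Fin.splitAt r) e) (F.splitAt-join r r _)))

module Oddness {V : Set} (adj : V → V → Bool) (adj-sym : ∀ u v → adj u v ≡ true → adj v u ≡ true) where
  open Search adj adj-sym

  -- With at most N independent elements, a cover by cliques of the same number would have to cover
  -- 2N + 1 elements no three of which lie in a clique.
  not-tight : ∀ N {A : V → Set} B → (∀ u → A u → u ∈ B) → independentᵇ (suc N) B ≡ false →
    (h : Fin (suc (N + N)) → V) → (∀ i → A (h i)) →
    (∀ i j k → i Fin.< j → j Fin.< k → adj (h i) (h j) ∧ adj (h j) (h k) ∧ adj (h i) (h k) ≡ false) →
    ¬ Tight adj A
  not-tight N B A⊆B none h hA flat (tight size colour clique rep rep∈ indep) with size N.≤? N
  ... | no r≰N = true≢false (independentᵇ-complete (suc N) size B rep (N.≰⇒> r≰N) (λ a → A⊆B _ (rep∈ a)) indep) none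
  ... | yes r≤N with pigeonhole₃ (λ i → colour (h i) (hA i)) (s≤s (N.+-mono-≤ r≤N r≤N))
  ... | i , j , k , i<j , j<k , e , e′ =
    true≢false (∧-intro (clique _ _ _ _ e) (∧-intro (clique _ _ _ _ e′) (clique _ _ _ _ (trans e e′)))) (flat i j k i<j j<k)

⌊⌋-sound : ∀ {P : Set} (d : Dec P) → ⌊ d ⌋ ≡ true → P
⌊⌋-sound (yes p) _ = p

⌊⌋-complete : ∀ {P : Set} (d : Dec P) → P → ⌊ d ⌋ ≡ true
⌊⌋-complete (yes _) _ = refl
⌊⌋-complete (no n)  p = contradiction p n

-- Enumeration of submatrices and marks

cons : Bool → (ℕ → Bool) → ℕ → Bool
cons b f zero    = b
cons b f (suc n) = f n

-- `allBits` runs only through functions built by `cons`. This brings `f` to that form, and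
-- `truncate-≗` compares the values.
truncate : ℕ → (ℕ → Bool) → ℕ → Bool
truncate zero    f = λ _ → false
truncate (suc n) f = cons (f 0) (truncate n (f ∘ suc))

truncate-≗ : ∀ n f → (∀ x → f x ≡ true → x < n) → ∀ x → truncate n f x ≡ f x
truncate-≗ zero    f h x       = sym (≢true λ e → N.n≮0 (h x e))
truncate-≗ (suc n) f h zero    = refl
truncate-≗ (suc n) f h (suc x) = truncate-≗ n (f ∘ suc) (λ y e → N.≤-pred (h (suc y) e)) x

allBits : ℕ → ((ℕ → Bool) → Bool) → Bool
allBits zero    k = k (λ _ → false)
allBits (suc n) k = allBits n (k ∘ cons true) ∧ allBits n (k ∘ cons false)

allBits-sound : ∀ n k → allBits n k ≡ true → ∀ f → k (truncate n f) ≡ true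
allBits-sound zero    k e f = e
allBits-sound (suc n) k e f with f 0
... | true  = allBits-sound n (k ∘ cons true) (∧-left e) (f ∘ suc)
... | false = allBits-sound n (k ∘ cons false) (∧-right {allBits n (k ∘ cons true)} e) (f ∘ suc)

module Enumeration {R C : Set} where

  liveᵇ : (R → Bool) → (C → Bool) → (R → C → Bool) → R × C → Bool
  liveᵇ I J W (x , y) = I x ∧ J y ∧ not (W x y)

  -- k holds for the surviving part of the given list of ones whenever the marks are among M.
  allMarks : (R → Bool) → (C → Bool) → (R → C → Bool) → List (R × C) → (List (R × C) → Bool) → Bool
  allMarks I J M []             k = k []
  allMarks I J M ((x , y) ∷ es) k =
    if I x ∧ J y
    then allMarks I J M es (k ∘ ((x , y) ∷_)) ∧ (not (M x y) ∨ allMarks I J M es k)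
    else allMarks I J M es k

  allMarks-sound : ∀ {I J M W} es k → (∀ x y → W x y ≡ true → M x y ≡ true) →
                   allMarks I J M es k ≡ true → k (filterᵇ (liveᵇ I J W) es) ≡ true
  allMarks-sound [] k WM e = e
  allMarks-sound {I} {J} {M} {W} ((x , y) ∷ es) k WM e with I x | J y | W x y in w
  ... | false | _     | _     = allMarks-sound es k WM e
  ... | true  | false | _     = allMarks-sound es k WM e
  ... | true  | true  | false = allMarks-sound es _ WM (∧-left e)
  ... | true  | true  | true  with ∨-elim {not (M x y)} (∧-right {allMarks I J M es (k ∘ ((x , y) ∷_))} e)
  ...   | inj₁ e′ = ⊥-elim (true≢false (WM x y w) (not-true e′))
  ...   | inj₂ e′ = allMarks-sound es k WM e′

-- Families of matrices and their finite checks

coreOnes : List (ℕ × ℕ) → List (Ix × Ix)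
coreOnes = map λ { (x , y) → core x , core y }

listed : List (ℕ × ℕ) → ℕ → ℕ → Bool
listed es x y = any (λ { (x′ , y′) → (x′ ≡ᵇ x) ∧ (y′ ≡ᵇ y) }) es

listed-∈ : ∀ es x y → listed es x y ≡ true → (x , y) ∈ es
listed-∈ es x y e with any-sound _ es e
... | (x′ , y′) , m , e′ with ≡ᵇ-sound {x′} (∧-left e′) | ≡ᵇ-sound {y′} (∧-right {x′ ≡ᵇ x} e′)
... | refl | refl = m

listed-core : ∀ es x y → listed es x y ≡ true → (core x , core y) ∈ coreOnes es
listed-core es x y e = ∈-map⁺ _ (listed-∈ es x y e)

-- `a` and `b` count the core rows and columns that occur in the matrix, `t` the stretched entries;
-- the `s`-th of these is at `(cR m s , cC m s)`. It depends on `m` since it may sit at the far end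
-- of the path, and `corner-suc` says that it survives the contraction.
record Family : Set where
  field
    frame : Frame
  open Frame frame public
  field
    a b t       : ℕ
    ones        : List (ℕ × ℕ)
    K-listed    : ∀ x y → K x y ≡ listed ones x y
    cR cC       : ℕ → ℕ → Ix
    corner-suc  : ∀ m s → cR (suc m) s ≡ up (cR m s) × cC (suc m) s ≡ up (cC m s)
    corner-row  : ∀ m s → s < t → (∃ λ x → x < a × cR m s ≡ core x) ⊎ (cR m s ≡ path m × cC m s ≡ core d)
    corner-col  : ∀ m s → s < t → ∃ λ y → y < b × cC m s ≡ core y
    corner-inj  : ∀ m s s′ → s < t → s′ < t → cR m s ≡ cR m s′ → cC m s ≡ cC m s′ → s ≡ s′
    corner-one  : ∀ m s → s < t → X m (cR m s) (cC m s) ≡ true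

  cornerᵇ : ℕ → Ix × Ix → Bool
  cornerᵇ m u = any (λ s → ⌊ u ≟E (cR m s , cC m s) ⌋) (upTo t)

  Corner : ℕ → Ix → Ix → Set
  Corner m x y = ∃ λ s → s < t × x ≡ cR m s × y ≡ cC m s

  cornerᵇ-complete : ∀ m {x y} → Corner m x y → cornerᵇ m (x , y) ≡ true
  cornerᵇ-complete m (s , s<t , refl , refl) =
    any-complete _ (∈-upTo⁺ s<t) (⌊⌋-complete ((cR m s , cC m s) ≟E (cR m s , cC m s)) refl)

  coreIx : (ℕ → Bool) → Ix → Bool
  coreIx f (core x) = f x
  coreIx f (path i) = false

  withPath : (ℕ → Bool) → Ix → Bool
  withPath f (core x) = f x
  withPath f (path i) = i ≡ᵇ 0

  open Enumeration {Ix} {Ix}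

  searchX : ℕ → List (Ix × Ix) → Bool
  -- The bound 20 on the number of cliques is never reached: each clique covers something new and
  -- the lists have at most 13 entries.
  searchX m L = Search.search (entry-adj (X m)) (entry-adj-sym (X m)) 20 L L

  -- Stripping may have marked anything in the apex row, whereas contraction introduces no marks, so
  -- only the corners are optional in the base.
  coreMarks baseMarks : ℕ → Ix → Ix → Bool
  coreMarks m x y = ⌊ x ≟I core r ⌋ ∨ cornerᵇ m (x , y)
  baseMarks m x y = cornerᵇ m (x , y)

  coreCheck : ℕ → Bool
  coreCheck m = allBits a λ I → allBits b λ J →
    allMarks (coreIx I) (coreIx J) (coreMarks m) (coreOnes ones) (searchX m)

  baseOnes : List (Ix × Ix)
  baseOnes = (path 0 , core c) ∷ (path 0 , core d) ∷ coreOnes ones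

  isFull : (ℕ → Bool) → (ℕ → Bool) → List (Ix × Ix) → Bool
  -- With every row and column present, a corner can be missing from `L` only because it is marked.
  isFull I J L = all I (upTo a) ∧ all J (upTo b) ∧ not (any (cornerᵇ 0) L)

  baseCheck : Bool
  -- If column `c` or `d` is missing, the path counts as damaged and belongs to the core check.
  baseCheck = allBits a λ I → allBits b λ J → not (J c ∧ J d) ∨
    allMarks (withPath I) (coreIx J) (baseMarks 0) baseOnes (λ L → isFull I J L ∨ searchX 0 L)

record Checked (F : Family) : Set where
  field
    coreOK : ∀ m → Family.coreCheck F m ≡ true
    baseOK : Family.baseCheck F ≡ true

bounded-all : ∀ n (f : ℕ → Bool) → (∀ i → i < n → f i ≡ true) ⊎ (∃ λ i → i < n × f i ≡ false)
bounded-all zero f = inj₁ λ _ ()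
bounded-all (suc n) f with f n in e | bounded-all n f
... | false | _ = inj₂ (n , N.≤-refl , e)
... | true  | inj₂ (i , i<n , e′) = inj₂ (i , N.m<n⇒m<1+n i<n , e′)
... | true  | inj₁ h = inj₁ λ i i<n+1 → [ h i , (λ { refl → e }) ]′ (N.m<1+n⇒m<n∨m≡n i<n+1)

flat? : ∀ {n} {V : Set} (adj : V → V → Bool) (h : Fin n → V) →
  Dec (∀ i j l → i Fin.< j → j Fin.< l → adj (h i) (h j) ∧ adj (h j) (h l) ∧ adj (h i) (h l) ≡ false)
flat? adj h = F.all? λ i → F.all? λ j → F.all? λ l → (i F.<? j) →-dec ((j F.<? l) →-dec (_ B≟ false))

-- Every configuration is tight, except possibly the full one

module Family-tight (Fam : Family) (checked : Checked Fam) where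
  open Family Fam
  open Checked checked

  module E (m : ℕ) = Elimination _≟I_ _≟I_ (X m)

  Valid : ℕ → (Ix → Bool) → (Ix → Bool) → (Ix → Ix → Bool) → Set
  Valid m I J W = Within a (suc m) I × Within b m J × (∀ x y → W x y ≡ true → Corner m x y)

  -- The one exception: nothing is missing and every corner has become optional, as happens after
  -- the removal of all squares from the whole matrix.
  record Full (m : ℕ) (I J : Ix → Bool) (W : Ix → Ix → Bool) : Set where
    field
      rows    : ∀ x → x < a → I (core x) ≡ true
      p-rows  : ∀ i → i ≤ m → I (path i) ≡ true
      cols    : ∀ y → y < b → J (core y) ≡ true
      p-cols  : ∀ j → j < m → J (path j) ≡ true
      corners : ∀ s → s < t → W (cR m s) (cC m s) ≡ true

  listed-tight : ∀ m I J W I° J° es → searchX m (filterᵇ (Enumeration.liveᵇ I° J° W) es) ≡ true →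
    (∀ x → I° x ≡ I x) → (∀ y → J° y ≡ J y) →
    (∀ x y → Alive (X m) I J W (x , y) → (x , y) ∈ es) →
    (∀ x y → (x , y) ∈ es → X m x y ≡ true) → E.TightM m I J W
  listed-tight m I J W I° J° es e Ieq Jeq complete sound =
    cast to from (Search.search-sound (entry-adj (X m)) (entry-adj-sym (X m)) 20 L L e)
    where
    L : List (Ix × Ix)
    L = filterᵇ (Enumeration.liveᵇ I° J° W) es
    to : ∀ u → Alive (X m) I J W u → u ∈ L
    to (x , y) v∈@(i , j , _ , w) = filterᵇ⁺ _ (complete x y v∈)
      (∧-intro (trans (Ieq x) i) (∧-intro (trans (Jeq y) j) (not-false w)))
    from : ∀ u → u ∈ L → Alive (X m) I J W u
    from (x , y) u∈ with filterᵇ⁻ (Enumeration.liveᵇ I° J° W) {es} u∈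
    ... | u∈es , l = trans (sym (Ieq x)) (∧-left l) , trans (sym (Jeq y)) (∧-left (∧-right {I° x} l)) ,
                     sound x y u∈es , not-true (∧-right {J° y} (∧-right {I° x} l))

  listed-sound : ∀ es x y → (x , y) ∈ coreOnes es → ∃ λ x′ → ∃ λ y′ → x ≡ core x′ × y ≡ core y′ × listed es x′ y′ ≡ true
  listed-sound es x y u∈ with ∈-map⁻ _ u∈
  ... | (x′ , y′) , m , refl = x′ , y′ , refl , refl , any-complete _ m (∧-intro (≡ᵇ-refl x′) (≡ᵇ-refl y′))

  core-listed : ∀ m x y → (x , y) ∈ coreOnes ones → X m x y ≡ true
  core-listed m x y u∈ with listed-sound ones x y u∈
  ... | x′ , y′ , refl , refl , e = trans (K-listed x′ y′) e

  trunc : ∀ {n k} I → Within n k I → ∀ x → truncate n (I ∘ core) x ≡ I (core x)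
  trunc {n} {k} I within = truncate-≗ n (I ∘ core) (proj₁ within)

  module Broken (m : ℕ) where
    corner-inner : ∀ i j → ¬ Corner m (path i) (path j)
    corner-inner i j (s , s<t , _ , e) with corner-col m s s<t
    ... | _ , _ , e′ with () ← trans e e′

    open BrokenPath frame a b m (Corner m) corner-inner public

    core-tight : ∀ I J W → Marks W → RowsIn I → ColsIn J → (∀ i → I (path i) ≡ false) →
                 (∀ j → J (path j) ≡ false) → E.TightM m I J W
    core-tight I J W mk ri ci nr nc = listed-tight m I J W (coreIx tI) (coreIx tJ) (coreOnes ones)
      (Enumeration.allMarks-sound {I = coreIx tI} {coreIx tJ} {coreMarks m} {W} (coreOnes ones) (searchX m) marked
        (allBits-sound b (λ fJ → allMarks (coreIx tI) (coreIx fJ) (coreMarks m) (coreOnes ones) (searchX m))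
          (allBits-sound a (λ fI → allBits b λ fJ → allMarks (coreIx fI) (coreIx fJ) (coreMarks m) (coreOnes ones) (searchX m))
            (coreOK m) (I ∘ core)) (J ∘ core)))
      (λ { (core x) → trunc I ri x ; (path i) → sym (nr i) })
      (λ { (core y) → trunc J ci y ; (path j) → sym (nc j) })
      complete (core-listed m)
      where
      open Enumeration {Ix} {Ix} using (allMarks)
      tI : ℕ → Bool
      tI = truncate a (I ∘ core)
      tJ : ℕ → Bool
      tJ = truncate b (J ∘ core)
      marked : ∀ x y → W x y ≡ true → coreMarks m x y ≡ true
      marked x y e with mk x y e
      ... | inj₁ p  = ∨-introˡ (⌊⌋-complete (x ≟I core r) p)
      ... | inj₂ cn = ∨-introʳ {⌊ x ≟I core r ⌋} (cornerᵇ-complete m cn)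
      complete : ∀ x y → Alive (X m) I J W (x , y) → (x , y) ∈ coreOnes ones
      complete (core x) (core y) (_ , _ , e , _) = listed-core ones x y (trans (sym (K-listed x y)) e)
      complete (path i) y (i∈ , _) = ⊥-elim (true≢false i∈ (nr i))
      complete (core x) (path j) (_ , j∈ , _) = ⊥-elim (true≢false j∈ (nc j))

  PathPresent : ℕ → (Ix → Bool) → (Ix → Bool) → Set
  PathPresent m I J = (∀ i → i ≤ m → I (path i) ≡ true) × (∀ j → j < m → J (path j) ≡ true) ×
                      J (core c) ≡ true × J (core d) ≡ true

  base-rows : ∀ x y → (x , y) ∈ baseOnes → X 0 x y ≡ true
  base-rows x y (here refl) = X-prev 0 0
  base-rows x y (there (here refl)) = X-last 0
  base-rows x y (there (there u∈)) = core-listed 0 x y u∈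

  base-complete : ∀ x y I J W → Within b 0 J → Within a 1 I → Alive (X 0) I J W (x , y) → (x , y) ∈ baseOnes
  base-complete (core x) (core y) I J W ci ri (_ , _ , e , _) = there (there (listed-core ones x y (trans (sym (K-listed x y)) e)))
  base-complete x (path j) I J W ci ri (_ , j∈ , _) with () ← proj₂ ci j j∈
  base-complete (path i) (core y) I J W ci ri (i∈ , _ , e , _) with proj₂ ri i i∈
  ... | s≤s z≤n with X-path-core 0 0 y e
  ... | inj₁ (_ , refl) = here refl
  ... | inj₂ (_ , refl) = there (here refl)

  base-row≡ : ∀ I J → Within a 1 I → PathPresent 0 I J → ∀ x → withPath (truncate a (I ∘ core)) x ≡ I x
  base-row≡ I J ri pp (core x) = trunc I ri x
  base-row≡ I J ri pp (path zero) = sym (proj₁ pp 0 z≤n)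
  base-row≡ I J ri pp (path (suc i)) = sym (≢true λ e → N.<⇒≱ (proj₂ ri (suc i) e) (s≤s z≤n))

  base-col≡ : ∀ J → Within b 0 J → ∀ x → coreIx (truncate b (J ∘ core)) x ≡ J x
  base-col≡ J ci (core y) = trunc J ci y
  base-col≡ J ci (path j) = sym (≢true λ e → N.n≮0 (proj₂ ci j e))

  base-tight : ∀ {I J W} → Valid 0 I J W → PathPresent 0 I J → E.TightM 0 I J W ⊎ Full 0 I J W
  base-tight {I} {J} {W} (ri , ci , mk) pp = decide (∨-elim {not (tJ c ∧ tJ d)} step)
    where
    open Enumeration {Ix} {Ix} using (allMarks; allMarks-sound; liveᵇ)
    tI tJ : ℕ → Bool
    tI = truncate a (I ∘ core)
    tJ = truncate b (J ∘ core)
    k : (ℕ → Bool) → (ℕ → Bool) → List (Ix × Ix) → Bool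
    k fI fJ L = isFull fI fJ L ∨ searchX 0 L
    test : (ℕ → Bool) → (ℕ → Bool) → Bool
    test fI fJ = not (fJ c ∧ fJ d) ∨ allMarks (withPath fI) (coreIx fJ) (baseMarks 0) baseOnes (k fI fJ)
    step : test tI tJ ≡ true
    step = allBits-sound b (test tI) (allBits-sound a (λ fI → allBits b (test fI)) baseOK (I ∘ core)) (J ∘ core)
    L : List (Ix × Ix)
    L = filterᵇ (liveᵇ (withPath tI) (coreIx tJ) W) baseOnes
    full : isFull tI tJ L ≡ true → Full 0 I J W
    full e = record
      { rows = λ x lt → trans (sym (trunc I ri x)) (all-sound tI (∧-left e) (∈-upTo⁺ lt))
      ; p-rows = proj₁ pp
      ; cols = λ y lt → trans (sym (trunc J ci y)) (all-sound tJ (∧-left e′) (∈-upTo⁺ lt))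
      ; p-cols = proj₁ (proj₂ pp)
      ; corners = λ n s<t → [ id , (λ w → ⊥-elim (unmarked n s<t w)) ]′ (bool-cases (W (cR 0 n) (cC 0 n))) }
      where
      e′ : all tJ (upTo b) ∧ not (any (cornerᵇ 0) L) ≡ true
      e′ = ∧-right {all tI (upTo a)} e
      row-in : ∀ n → n < t → I (cR 0 n) ≡ true
      row-in n n<t with corner-row 0 n n<t
      ... | inj₁ (x , lt , eq) = trans (cong I eq) (trans (sym (trunc I ri x)) (all-sound tI (∧-left e) (∈-upTo⁺ lt)))
      ... | inj₂ (eq , _) = trans (cong I eq) (proj₁ pp 0 z≤n)
      col-in : ∀ n → n < t → J (cC 0 n) ≡ true
      col-in n n<t with corner-col 0 n n<t
      ... | y , lt , eq = trans (cong J eq) (trans (sym (trunc J ci y)) (all-sound tJ (∧-left e′) (∈-upTo⁺ lt)))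
      unmarked : ∀ n → n < t → W (cR 0 n) (cC 0 n) ≡ false → ⊥
      unmarked n n<t w = true≢false
        (any-complete (cornerᵇ 0) (filterᵇ⁺ (liveᵇ (withPath tI) (coreIx tJ) W) (base-complete _ _ I J W ci ri alive)
          (∧-intro (trans (base-row≡ I J ri pp _) (row-in n n<t))
            (∧-intro (trans (base-col≡ J ci _) (col-in n n<t)) (not-false w))))
          (cornerᵇ-complete 0 (n , n<t , refl , refl)))
        (not-true (∧-right {all tJ (upTo b)} e′))
        where
        alive : Alive (X 0) I J W (cR 0 n , cC 0 n)
        alive = row-in n n<t , col-in n n<t , corner-one 0 n n<t , w
    decide : not (tJ c ∧ tJ d) ≡ true ⊎ allMarks (withPath tI) (coreIx tJ) (baseMarks 0) baseOnes (k tI tJ) ≡ true →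
             E.TightM 0 I J W ⊎ Full 0 I J W
    decide (inj₁ e) = ⊥-elim (true≢false (∧-intro (trans (trunc J ci c) (proj₁ (proj₂ (proj₂ pp))))
                                                  (trans (trunc J ci d) (proj₂ (proj₂ (proj₂ pp))))) (not-true e))
    decide (inj₂ e) with ∨-elim {isFull tI tJ L} (allMarks-sound {withPath tI} {coreIx tJ} {baseMarks 0} {W} baseOnes (k tI tJ) (λ x y w → cornerᵇ-complete 0 (mk x y w)) e)
    ... | inj₁ e′ = inj₂ (full e′)
    ... | inj₂ e′ = inj₁ (listed-tight 0 I J W (withPath tI) (coreIx tJ) baseOnes e′ (base-row≡ I J ri pp) (base-col≡ J ci)
                           (λ x y → base-complete x y I J W ci ri) base-rows)

  up-inj : ∀ {x y} → up x ≡ up y → x ≡ y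
  up-inj {core x} {core y} refl = refl
  up-inj {path x} {path y} refl = refl

  -- A corner in a path row can only be `(path m , core d)`. This keeps the four cells involved in a
  -- contraction unmarked.
  path-marked : ∀ {m} (W : Ix → Ix → Bool) → (∀ x y → W x y ≡ true → Corner m x y) → ∀ i y → W (path i) y ≡ true → i ≡ m × y ≡ core d
  path-marked {m} W mk i y w with mk _ _ w
  ... | s , s<t , e , e′ with corner-row m s s<t
  ... | inj₁ (_ , _ , e″) with () ← trans e e″
  ... | inj₂ (e″ , e‴) = path-inj (trans e e″) , trans e′ e‴
    where
    path-inj : ∀ {i j} → path i ≡ path j → i ≡ j
    path-inj refl = refl

  private
    core≢path : ∀ {j x} → path j ≢ core x
    core≢path ()

  module Step (m : ℕ) (I J : Ix → Bool) (W : Ix → Ix → Bool) (v : Valid (suc m) I J W)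
              (pp : PathPresent (suc m) I J) where
    private
      mk : ∀ x y → W x y ≡ true → Corner (suc m) x y
      mk = proj₂ (proj₂ v)

    I′ J′ : Ix → Bool
    I′ x = I (up x)
    J′ y = J (up y)
    W′ : Ix → Ix → Bool
    W′ x y = W (up x) (up y)

    private
      module S = Frame.Shrink frame m {I} {J} {W}
        (proj₁ pp 0 z≤n) (proj₁ pp 1 (s≤s z≤n)) (proj₁ (proj₂ (proj₂ pp))) (proj₁ (proj₂ pp) 0 (s≤s z≤n))
        (≢true λ w → c≢d (core-inj (proj₂ (path-marked W mk _ _ w))))
        (≢true λ w → core≢path (proj₂ (path-marked W mk _ _ w)))
        (≢true λ w → core≢path (proj₂ (path-marked W mk _ _ w)))
        (≢true λ w → c≢d (core-inj (proj₂ (path-marked W mk _ _ w))))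

    grow : E.TightM m I′ J′ W′ → E.TightM (suc m) I J W
    grow = S.shrink-up

    shrink : E.TightM (suc m) I J W → E.TightM m I′ J′ W′
    shrink = S.shrink-down

    valid : Valid m I′ J′ W′
    valid = (proj₁ (proj₁ v) , λ i e → N.≤-pred (proj₂ (proj₁ v) (suc i) e))
          , (proj₁ (proj₁ (proj₂ v)) , λ j e → N.≤-pred (proj₂ (proj₁ (proj₂ v)) (suc j) e))
          , λ x y w → lower x y (mk _ _ w)
      where
      lower : ∀ x y → Corner (suc m) (up x) (up y) → Corner m x y
      lower x y (s , s<t , e , e′) =
        s , s<t , up-inj (trans e (proj₁ (corner-suc m s))) , up-inj (trans e′ (proj₂ (corner-suc m s)))

    present : PathPresent m I′ J′
    present = (λ i le → proj₁ pp (suc i) (s≤s le)) , (λ j lt → proj₁ (proj₂ pp) (suc j) (s≤s lt)) , proj₂ (proj₂ pp)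

    full-up : Full m I′ J′ W′ → Full (suc m) I J W
    full-up f = record
      { rows = Full.rows f ; p-rows = proj₁ pp ; cols = Full.cols f ; p-cols = proj₁ (proj₂ pp)
      ; corners = λ s s<t → trans (cong₂ W (proj₁ (corner-suc m s)) (proj₂ (corner-suc m s))) (Full.corners f s s<t) }

    full-down : Full (suc m) I J W → Full m I′ J′ W′
    full-down f = record
      { rows = Full.rows f ; p-rows = proj₁ present ; cols = Full.cols f ; p-cols = proj₁ (proj₂ present)
      ; corners = λ s s<t → trans (cong₂ W (sym (proj₁ (corner-suc m s))) (sym (proj₂ (corner-suc m s)))) (Full.corners f s s<t) }

  unbroken : ∀ m {I J W} → Valid m I J W → PathPresent m I J → E.TightM m I J W ⊎ Full m I J W
  unbroken zero    v pp = base-tight v pp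
  unbroken (suc m) {I} {J} {W} v pp = Sum.map grow full-up (unbroken m valid present)
    where open Step m I J W v pp

  -- A missing path row, a missing path column or a missing end `c` or `d` allows stripping;
  -- otherwise the path is intact and contracts to length zero.
  tight-or-full : ∀ m {I J W} → Valid m I J W → E.TightM m I J W ⊎ Full m I J W
  tight-or-full m {I} {J} v@(ri , ci , mk)
    with bounded-all (suc m) (I ∘ path) | bounded-all m (J ∘ path) | bool-cases (J (core c)) | bool-cases (J (core d))
  ... | inj₂ (k , k≤m , e) | _ | _ | _ = inj₁ (B.no-row-tight B.core-tight k (N.≤-pred k≤m) (λ x y w → inj₂ (mk x y w)) ri ci e)
    where module B = Broken m
  ... | inj₁ _ | inj₂ (k , k<m , e) | _ | _ = inj₁ (B.no-col-tight B.core-tight k k<m (λ x y w → inj₂ (mk x y w)) ri ci e)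
    where module B = Broken m
  ... | inj₁ _ | inj₁ _ | inj₂ e | _ = inj₁ (B.no-c-tight B.core-tight (λ x y w → inj₂ (mk x y w)) ri ci e)
    where module B = Broken m
  ... | inj₁ _ | inj₁ _ | inj₁ _ | inj₂ e = inj₁ (B.no-d-tight B.core-tight (λ x y w → inj₂ (mk x y w)) ri ci e)
    where module B = Broken m
  ... | inj₁ rs | inj₁ cs | inj₁ ec | inj₁ ed = unbroken m v ((λ i le → rs i (s≤s le)) , cs , ec , ed)

  open Search (entry-adj (X 0)) (entry-adj-sym (X 0)) using (independentᵇ)

  inRange : Ix × Ix → Bool
  inRange (core x , core y) = (x <ᵇ a) ∧ (y <ᵇ b)
  inRange (path i , core y) = (i ≡ᵇ 0) ∧ (y <ᵇ b)
  inRange (_ , path _)      = false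

  fullOnes : List (Ix × Ix)
  fullOnes = filterᵇ (λ u → inRange u ∧ not (cornerᵇ 0 u)) baseOnes

  alive₀ : Ix × Ix → Bool
  alive₀ (x , y) = inRange (x , y) ∧ not (cornerᵇ 0 (x , y)) ∧ X 0 x y

  -- The data for `Oddness.not-tight` at `m = 0`, in decided form so that each family supplies them
  -- by evaluation.
  record OddHole : Set where
    field
      k         : ℕ
      hole      : Fin (suc (k + k)) → Ix × Ix
      on-hole   : ⌊ F.all? (λ i → alive₀ (hole i) B≟ true) ⌋ ≡ true
      flat-hole : ⌊ flat? (entry-adj (X 0)) hole ⌋ ≡ true
      few       : independentᵇ (suc k) fullOnes ≡ false
      c<b       : c < b
      d<b       : d < b

  module NotFirm (odd : OddHole) where
    open OddHole odd

    full-not-tight : ∀ m {I J W} → Valid m I J W → Full m I J W → ¬ E.TightM m I J W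
    full-not-tight (suc m) {I} {J} {W} v f t = full-not-tight m valid (full-down f) (shrink t)
      where
      open Step m I J W v (Full.p-rows f , Full.p-cols f , Full.cols f c c<b , Full.cols f d d<b)
    full-not-tight zero {I} {J} {W} (ri , ci , mk) f =
      Oddness.not-tight (entry-adj (X 0)) (entry-adj-sym (X 0)) k fullOnes on few hole hole∈
        (⌊⌋-sound (flat? (entry-adj (X 0)) hole) flat-hole)
      where
      range : ∀ x y → I x ≡ true → J y ≡ true → inRange (x , y) ≡ true
      range (core x) (core y) i j = ∧-intro (T⇒≡ (N.<⇒<ᵇ (proj₁ ri x i))) (T⇒≡ (N.<⇒<ᵇ (proj₁ ci y j)))
      range (path i) (core y) ii j with proj₂ ri i ii
      ... | s≤s z≤n = T⇒≡ (N.<⇒<ᵇ (proj₁ ci y j))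
      range x (path j) _ jj with () ← proj₂ ci j jj
      range⁻ : ∀ x y → inRange (x , y) ≡ true → I x ≡ true × J y ≡ true
      range⁻ (core x) (core y) e = Full.rows f x (N.<ᵇ⇒< x a (≡⇒T (∧-left e))) , Full.cols f y (N.<ᵇ⇒< y b (≡⇒T (∧-right {x <ᵇ a} e)))
      range⁻ (path zero) (core y) e = Full.p-rows f 0 z≤n , Full.cols f y (N.<ᵇ⇒< y b (≡⇒T e))
      not-corner : ∀ x y → W x y ≡ false → cornerᵇ 0 (x , y) ≡ false
      not-corner x y w = ≢true λ e → case (any-sound _ (upTo t) e)
        where
        case : (∃ λ s → s ∈ upTo t × ⌊ (x , y) ≟E (cR 0 s , cC 0 s) ⌋ ≡ true) → ⊥
        case (s , s∈ , e) with ⌊⌋-sound ((x , y) ≟E (cR 0 s , cC 0 s)) e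
        ... | refl = true≢false (Full.corners f s (∈-upTo⁻ s∈)) w
      on : ∀ u → Alive (X 0) I J W u → u ∈ fullOnes
      on (x , y) v∈@(i , j , e , w) = filterᵇ⁺ (λ u → inRange u ∧ not (cornerᵇ 0 u)) (base-complete x y I J W ci ri v∈)
        (∧-intro (range x y i j) (not-false (not-corner x y w)))
      hole∈ : ∀ i → Alive (X 0) I J W (hole i)
      hole∈ i with hole i | ⌊⌋-sound (F.all? (λ i → alive₀ (hole i) B≟ true)) on-hole i
      ... | x , y | e with range⁻ x y (∧-left e)
      ... | ix , jy = ix , jy , ∧-right {not (cornerᵇ 0 (x , y))} e′ ,
                      ≢true λ w → true≢false (cornerᵇ-complete 0 (mk x y w)) (not-true (∧-left e′))
        where
        e′ : not (cornerᵇ 0 (x , y)) ∧ X 0 x y ≡ true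
        e′ = ∧-right {inRange (x , y)} e

-- Removing the squares added by stretching

module Stretched (Fam : Family) (checked : Checked Fam) (m : ℕ) where
  open Family Fam
  open Family-tight Fam checked

  Line : Set
  Line = Ix ⊎ ℕ

  _≟L_ : DecidableEquality Line
  _≟L_ = ⊎-≡-dec _≟I_ N._≟_

  Y : Line → Line → Bool
  Y (inj₁ x) (inj₁ y) = X m x y
  Y (inj₁ x) (inj₂ s) = ⌊ x ≟I cR m s ⌋
  Y (inj₂ s) (inj₁ y) = ⌊ y ≟I cC m s ⌋
  Y (inj₂ s) (inj₂ u) = s ≡ᵇ u

  open Elimination _≟L_ _≟L_ Y

  -- The state after the squares `k`, ..., `t - 1` have been dealt with: only smaller ones may be
  -- present, and only corners of the removed ones may be marked.
  record Valid′ (k : ℕ) (I J : Line → Bool) (W : Line → Line → Bool) : Set where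
    field
      rows   : Within a (suc m) (I ∘ inj₁)
      cols   : Within b m (J ∘ inj₁)
      s-rows : ∀ s → I (inj₂ s) ≡ true → s < k
      s-cols : ∀ s → J (inj₂ s) ≡ true → s < k
      marks  : ∀ x y → W x y ≡ true → ∃ λ s → k ≤ s × s < t × x ≡ inj₁ (cR m s) × y ≡ inj₁ (cC m s)

  record Full′ (k : ℕ) (I J : Line → Bool) (W : Line → Line → Bool) : Set where
    field
      -- The constant marking makes `corners` vacuous here; the true state of the marks is recorded
      -- in `marked`.
      full   : Full m (I ∘ inj₁) (J ∘ inj₁) (λ _ _ → true)
      s-rows : ∀ s → s < k → I (inj₂ s) ≡ true
      s-cols : ∀ s → s < k → J (inj₂ s) ≡ true
      marked : ∀ s → k ≤ s → s < t → W (inj₁ (cR m s)) (inj₁ (cC m s)) ≡ true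

  private
    corner-row-in : ∀ {I J W} → Full m I J W → ∀ s → s < t → I (cR m s) ≡ true
    corner-row-in {I} f s s<t with corner-row m s s<t
    ... | inj₁ (x , lt , e) = trans (cong I e) (Full.rows f x lt)
    ... | inj₂ (e , _)      = trans (cong I e) (Full.p-rows f m N.≤-refl)

    corner-col-in : ∀ {I J W} → Full m I J W → ∀ s → s < t → J (cC m s) ≡ true
    corner-col-in {J = J} f s s<t with corner-col m s s<t
    ... | y , lt , e = trans (cong J e) (Full.cols f y lt)

    unwrap : Line → Ix
    unwrap (inj₁ x) = x
    unwrap (inj₂ _) = core 0

    module Bottom {I J W} (v : Valid′ 0 I J W) where
      open Valid′ v
      Base Top : _ → Set
      Base = Alive (X m) (I ∘ inj₁) (J ∘ inj₁) (λ x y → W (inj₁ x) (inj₁ y))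
      Top  = Alive Y I J W

      up∈ : ∀ u → Base u → Top (inj₁ (proj₁ u) , inj₁ (proj₂ u))
      up∈ u p = p
      down∈ : ∀ u → Top u → Base (unwrap (proj₁ u) , unwrap (proj₂ u))
      down∈ (inj₁ x , inj₁ y) p = p
      down∈ (inj₂ s , _) (i , _) = ⊥-elim (N.n≮0 (s-rows s i))
      down∈ (inj₁ _ , inj₂ s) (_ , j , _) = ⊥-elim (N.n≮0 (s-cols s j))
      same : ∀ u u′ → Top u → Top u′ →
        entry-adj (X m) (unwrap (proj₁ u) , unwrap (proj₂ u)) (unwrap (proj₁ u′) , unwrap (proj₂ u′)) ≡ entry-adj Y u u′
      same (inj₁ _ , inj₁ _) (inj₁ _ , inj₁ _) _ _ = refl
      same (inj₂ s , _) _ (i , _) _ = ⊥-elim (N.n≮0 (s-rows s i))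
      same (inj₁ _ , inj₂ s) _ (_ , j , _) _ = ⊥-elim (N.n≮0 (s-cols s j))
      same (inj₁ _ , inj₁ _) (inj₂ s , _) _ (i , _) = ⊥-elim (N.n≮0 (s-rows s i))
      same (inj₁ _ , inj₁ _) (inj₁ _ , inj₂ s) _ (_ , j , _) = ⊥-elim (N.n≮0 (s-cols s j))

      raise : Tight (entry-adj (X m)) Base → TightM I J W
      raise = transport _ (λ u → inj₁ (proj₁ u) , inj₁ (proj₂ u)) down∈ up∈
        (λ u u′ p q e → trans (sym (same u u′ p q)) e) (λ _ _ _ _ e → e)

      lower : TightM I J W → Tight (entry-adj (X m)) Base
      lower = transport (λ u → inj₁ (proj₁ u) , inj₁ (proj₂ u)) _ up∈ down∈
        (λ _ _ _ _ e → e) (λ u u′ p q e → trans (sym (same u u′ p q)) e)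

      valid : Valid m (I ∘ inj₁) (J ∘ inj₁) (λ x y → W (inj₁ x) (inj₁ y))
      valid = rows , cols , λ x y e → corner x y (marks _ _ e)
        where
        corner : ∀ x y → _ → Corner m x y
        corner x y (s , _ , s<t , e , e′) = s , s<t , inj₁-injective e , inj₁-injective e′

    forget : ∀ {I J W} → Full m I J W → Full m I J (λ _ _ → true)
    forget f = record { Full f ; corners = λ _ _ → refl }

  module Peel (k : ℕ) (k<t : k < t) {I J : Line → Bool} {W : Line → Line → Bool} (v : Valid′ (suc k) I J W) where
    open Valid′ v

    p : Line
    p = inj₂ k
    a′ b′ : Line
    a′ = inj₁ (cR m k)
    b′ = inj₁ (cC m k)

    row : ∀ y → J y ≡ true → Y p y ≡ true → y ≡ b′ ⊎ y ≡ p
    row (inj₁ y) _ e = inj₁ (cong inj₁ (⌊⌋-sound (y ≟I cC m k) e))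
    row (inj₂ s) _ e = inj₂ (cong inj₂ (sym (≡ᵇ-sound {k} e)))

    col : ∀ x → I x ≡ true → Y x p ≡ true → x ≡ p ⊎ x ≡ a′
    col (inj₁ x) _ e = inj₂ (cong inj₁ (⌊⌋-sound (x ≟I cR m k) e))
    col (inj₂ s) _ e = inj₁ (cong inj₂ (≡ᵇ-sound e))

    pb : Y p b′ ≡ true
    pb = ⌊⌋-complete (cC m k ≟I cC m k) refl
    ap : Y a′ p ≡ true
    ap = ⌊⌋-complete (cR m k ≟I cR m k) refl

    unmarked : ∀ {x y} → (∀ s → x ≡ inj₁ (cR m s) → y ≡ inj₁ (cC m s) → ⊥) → W x y ≡ false
    unmarked n = ≢true λ e → case (marks _ _ e)
      where
      case : _ → ⊥
      case (s , _ , _ , e , e′) = n s e e′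

    fresh : W a′ b′ ≡ false
    fresh = ≢true λ e → case (marks _ _ e)
      where
      case : _ → ⊥
      case (s , k<s , s<t , e , e′) =
        N.<-irrefl (corner-inj m k s k<t s<t (inj₁-injective e) (inj₁-injective e′)) k<s

    descend : ∀ {I′ J′} → I′ ⊑ I → J′ ⊑ J → I′ p ≡ false → J′ p ≡ false → Valid′ k I′ J′ W
    descend I⊑ J⊑ ip jp = record
      { rows = within-⊑ rows (λ x → I⊑ (inj₁ x)) ; cols = within-⊑ cols (λ x → J⊑ (inj₁ x))
      ; s-rows = λ s e → below (s-rows s (I⊑ _ e)) λ { refl → true≢false e ip }
      ; s-cols = λ s e → below (s-cols s (J⊑ _ e)) λ { refl → true≢false e jp }
      ; marks = λ x y e → weaken (marks x y e) }
      where
      below : ∀ {s} → s < suc k → s ≢ k → s < k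
      below lt n = N.≤∧≢⇒< (N.≤-pred lt) n
      weaken : ∀ {x y} → (∃ λ s → suc k ≤ s × s < t × x ≡ inj₁ (cR m s) × y ≡ inj₁ (cC m s)) → _
      weaken (s , k<s , r) = s , N.<⇒≤ k<s , r

    module Both (ip : I p ≡ true) (jp : J p ≡ true) where
      W⁺ : Line → Line → Bool
      W⁺ = mark _≟L_ _≟L_ a′ b′ W

      module Sq = Square {I} {J} {W} p p a′ b′ row col pb ap (corner-one m k k<t)
        (ip , jp , ≡ᵇ-refl k , unmarked λ _ ())

      valid : Valid′ k (I ∖R p) (J ∖C p) W⁺
      valid = record { Valid′ (descend {I ∖R p} {J ∖C p} (λ _ → ∧-left) (λ _ → ∧-left) (remove-self _≟L_ {p} {I}) (remove-self _≟L_ {p} {J}))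
                     ; marks = λ x y e → marks⁺ x y (mark-inv _≟L_ _≟L_ {a′} {b′} {W} {x} {y} e) }
        where
        marks⁺ : ∀ x y → W x y ≡ true ⊎ (x ≡ a′ × y ≡ b′) →
                 ∃ λ s → k ≤ s × s < t × x ≡ inj₁ (cR m s) × y ≡ inj₁ (cC m s)
        marks⁺ x y (inj₂ (e , e′)) = k , N.≤-refl , k<t , e , e′
        marks⁺ x y (inj₁ e) with marks x y e
        ... | s , k<s , r = s , N.<⇒≤ k<s , r

      full-up : Full′ k (I ∖R p) (J ∖C p) W⁺ → Full′ (suc k) I J W
      full-up f = record
        { full = record { rows = λ x lt → ∧-left (Full.rows Φ.full x lt) ; p-rows = λ x lt → ∧-left (Full.p-rows Φ.full x lt)
                        ; cols = λ x lt → ∧-left (Full.cols Φ.full x lt) ; p-cols = λ x lt → ∧-left (Full.p-cols Φ.full x lt)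
                        ; corners = λ _ _ → refl }
        ; s-rows = λ s lt → [ (λ l → ∧-left (Φ.s-rows s l)) , (λ { refl → ip }) ]′ (N.m<1+n⇒m<n∨m≡n lt)
        ; s-cols = λ s lt → [ (λ l → ∧-left (Φ.s-cols s l)) , (λ { refl → jp }) ]′ (N.m<1+n⇒m<n∨m≡n lt)
        ; marked = λ s k<s s<t → old s k<s s<t (mark-inv _≟L_ _≟L_ {a′} {b′} {W} (Φ.marked s (N.<⇒≤ k<s) s<t)) }
        where
        module Φ = Full′ f
        old : ∀ s → k < s → s < t → _ → W (inj₁ (cR m s)) (inj₁ (cC m s)) ≡ true
        old s k<s s<t (inj₁ e) = e
        old s k<s s<t (inj₂ (e , e′)) = ⊥-elim
          (N.<-irrefl (sym (corner-inj m s k s<t k<t (inj₁-injective e) (inj₁-injective e′))) k<s)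

      full-down : Full′ (suc k) I J W → Full′ k (I ∖R p) (J ∖C p) W⁺
      full-down f = record
        { full = record { rows = λ x lt → keepR (Full.rows Φ.full x lt) (λ ()) ; p-rows = λ x lt → keepR (Full.p-rows Φ.full x lt) (λ ())
                        ; cols = λ x lt → keepC (Full.cols Φ.full x lt) (λ ()) ; p-cols = λ x lt → keepC (Full.p-cols Φ.full x lt) (λ ())
                        ; corners = λ _ _ → refl }
        ; s-rows = λ s lt → keepR (Φ.s-rows s (N.m<n⇒m<1+n lt)) (λ { refl → N.<-irrefl refl lt })
        ; s-cols = λ s lt → keepC (Φ.s-cols s (N.m<n⇒m<1+n lt)) (λ { refl → N.<-irrefl refl lt })
        ; marked = λ s k≤s s<t → [ (λ k<s → mark-old _≟L_ _≟L_ {a′} {b′} {W} (Φ.marked s k<s s<t)) , (λ { refl → marked-here }) ]′ (N.m≤n⇒m<n∨m≡n k≤s) }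
        where
        module Φ = Full′ f
        keepR : ∀ {x} → I x ≡ true → x ≢ p → (I ∖R p) x ≡ true
        keepR = remove-∈ _≟L_ I
        keepC : ∀ {x} → J x ≡ true → x ≢ p → (J ∖C p) x ≡ true
        keepC = remove-∈ _≟L_ J
        marked-here : W⁺ a′ b′ ≡ true
        marked-here = ∨-introʳ {W a′ b′} (∧-intro (⌊⌋-complete (a′ ≟L a′) refl) (⌊⌋-complete (b′ ≟L b′) refl))

  -- With both lines of square `k` present, its corner becomes optional and fullness is passed on.
  -- With one line, either the core line through the corner vanishes together with it or was missing
  -- before, which excludes fullness. With none, the corner is unmarked (`fresh`), which excludes
  -- fullness as well.
  squares : ∀ k → k ≤ t → ∀ {I J W} → Valid′ k I J W → TightM I J W ⊎ Full′ k I J W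
  squares zero _ v = Sum.map raise
    (λ f → record { full = forget f ; s-rows = λ _ () ; s-cols = λ _ () ; marked = λ s _ → Full.corners f s })
    (tight-or-full m valid)
    where open Bottom v
  squares (suc k) k<t {I} {J} {W} v = go (bool-cases (I p)) (bool-cases (J p))
    where
    open Peel k k<t v
    IH : ∀ {I J W} → Valid′ k I J W → TightM I J W ⊎ Full′ k I J W
    IH = squares k (N.<⇒≤ k<t)
    go : I p ≡ true ⊎ I p ≡ false → J p ≡ true ⊎ J p ≡ false → TightM I J W ⊎ Full′ (suc k) I J W
    go (inj₁ ip) (inj₁ jp) = Sum.map Sq.square-up full-up (IH valid)
      where open Both ip jp
    go (inj₁ ip) (inj₂ jp) with bool-cases (J b′)
    ... | inj₁ jb = inj₁ ([ pendant-row p b′ only (ip , jb , pb , unmarked λ _ ()) , (λ f →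
            ⊥-elim (true≢false (corner-col-in (Full′.full f) k k<t) (remove-self _≟L_ {b′} {J}))) ]′
            (IH (descend {I ∖R p} {J ∖C b′} (λ _ → ∧-left) (λ _ → ∧-left) (remove-self _≟L_ {p} {I}) (remove-false _≟L_ {b′} {J} jp))))
      where
      only : ∀ y → J y ≡ true → Y p y ≡ true → y ≡ b′
      only y jy e = [ id , (λ { refl → ⊥-elim (true≢false jy jp) }) ]′ (row y jy e)
    ... | inj₂ jb = inj₁ ([ drop-row p none , (λ f →
            ⊥-elim (true≢false (corner-col-in (Full′.full f) k k<t) jb)) ]′
            (IH (descend {I ∖R p} {J} (λ _ → ∧-left) (λ _ e → e) (remove-self _≟L_ {p} {I}) jp)))
      where
      none : ∀ y → ¬ Alive Y I J W (p , y)
      none y (_ , jy , e , _) = [ (λ { refl → true≢false jy jb }) , (λ { refl → true≢false jy jp }) ]′ (row y jy e)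
    go (inj₂ ip) (inj₁ jp) with bool-cases (I a′)
    ... | inj₁ ia = inj₁ ([ pendant-col a′ p only (ia , jp , ap , unmarked λ _ _ ()) , (λ f →
            ⊥-elim (true≢false (corner-row-in (Full′.full f) k k<t) (remove-self _≟L_ {a′} {I}))) ]′
            (IH (descend {I ∖R a′} {J ∖C p} (λ _ → ∧-left) (λ _ → ∧-left) (remove-false _≟L_ {a′} {I} ip) (remove-self _≟L_ {p} {J}))))
      where
      only : ∀ x → I x ≡ true → Y x p ≡ true → x ≡ a′
      only x ix e = [ (λ { refl → ⊥-elim (true≢false ix ip) }) , id ]′ (col x ix e)
    ... | inj₂ ia = inj₁ ([ drop-col p none , (λ f →
            ⊥-elim (true≢false (corner-row-in (Full′.full f) k k<t) ia)) ]′
            (IH (descend {I} {J ∖C p} (λ _ e → e) (λ _ → ∧-left) ip (remove-self _≟L_ {p} {J}))))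
      where
      none : ∀ x → ¬ Alive Y I J W (x , p)
      none x (ix , _ , e , _) = [ (λ { refl → true≢false ix ip }) , (λ { refl → true≢false ix ia }) ]′ (col x ix e)
    go (inj₂ ip) (inj₂ jp) = inj₁ ([ id , (λ f →
      ⊥-elim (true≢false (Full′.marked f k N.≤-refl k<t) fresh)) ]′ (IH (descend (λ _ e → e) (λ _ e → e) ip jp)))

  -- In the full configuration only the case with both lines present occurs, so a supposed tightness
  -- descends through all squares to the unstretched matrix.
  squares-not : (∀ {I J W} → Valid m I J W → Full m I J W → ¬ E.TightM m I J W) →
                ∀ k → k ≤ t → ∀ {I J W} → Valid′ k I J W → Full′ k I J W → ¬ TightM I J W
  squares-not nt zero _ v f τ = nt valid (record { Full (Full′.full f) ; corners = λ s → Full′.marked f s z≤n }) (lower τ)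
    where open Bottom v
  squares-not nt (suc k) k<t v f τ = squares-not nt k (N.<⇒≤ k<t) valid (full-down f) (Sq.square-down τ)
    where
    open Peel k k<t v
    open Both (Full′.s-rows f k (N.n<1+n k)) (Full′.s-cols f k (N.n<1+n k))

-- From tight graphs to Boolean rank and isolation number

module Rank {M N : ℕ} (Z : BMat M N) where

  Entries : Subset M → Subset N → Fin M × Fin N → Set
  Entries I J (i , j) = InSupp Z I J i j

  TightZ : Subset M → Subset N → Set
  TightZ I J = Tight (entry-adj Z) (Entries I J)

  -- Two entries of an isolated set in one rectangle would make both opposite corners ones, so
  -- choosing a rectangle for each entry is injective.
  isolated≤cover : ∀ {I J k r p} → HasCover Z I J k → IsIsolated Z I J r p → r ≤ k
  isolated≤cover {I} {J} {k} {r} {p} (rs , rect , covers) (in′ , iso) = F.injective⇒≤ {f = λ x → proj₁ (at x)} inj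
    where
    at : ∀ x → ∃ λ y → proj₁ (p x) ∈ₛ proj₁ (rs y) × proj₂ (p x) ∈ₛ proj₂ (rs y)
    at x = covers _ _ (in′ x)
    inj : ∀ {x y} → proj₁ (at x) ≡ proj₁ (at y) → x ≡ y
    inj {x} {y} e with x F.≟ y
    ... | yes x≡y = x≡y
    ... | no x≢y = ⊥-elim ([ true≢false (ones _ _ (proj₁ (proj₂ (at x))) y∈) ,
                             true≢false (ones _ _ x∈ (proj₂ (proj₂ (at x)))) ]′ (proj₂ (proj₂ (iso x y x≢y))))
      where
      ones : ∀ i j → i ∈ₛ proj₁ (rs (proj₁ (at x))) → j ∈ₛ proj₂ (rs (proj₁ (at x))) → Z i j ≡ true
      ones = proj₂ (proj₂ (rect (proj₁ (at x))))
      x∈ : proj₁ (p y) ∈ₛ proj₁ (rs (proj₁ (at x)))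
      x∈ = subst (λ z → proj₁ (p y) ∈ₛ proj₁ (rs z)) (sym e) (proj₁ (proj₂ (at y)))
      y∈ : proj₂ (p y) ∈ₛ proj₂ (rs (proj₁ (at x)))
      y∈ = subst (λ z → proj₂ (p y) ∈ₛ proj₂ (rs z)) (sym e) (proj₂ (proj₂ (at y)))

  module _ {I : Subset M} {J : Subset N} where

    entry? : ∀ u → Dec (Entries I J u)
    entry? (i , j) = (i ∈? I) ×-dec (j ∈? J) ×-dec (Z i j B≟ true)

    tight⇒cover : (t : TightZ I J) → HasCover Z I J (TightIn.size t)
    tight⇒cover t = rect , is-rect , covers
      where
      open TightIn t
      -- Membership always goes through the decision `entry?`, so each entry has one definite colour
      -- here.
      Has : Fin size → ∀ u → Dec (Entries I J u) → Set
      Has x u (yes p) = colour u p ≡ x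
      Has x u (no _)  = ⊥
      has? : ∀ x u d → Dec (Has x u d)
      has? x u (yes p) = colour u p F.≟ x
      has? x u (no _)  = no λ ()
      In : Fin size → Fin M × Fin N → Set
      In x u = Has x u (entry? u)
      in? : ∀ x u → Dec (In x u)
      in? x u = has? x u (entry? u)
      rows : Fin size → Subset M
      rows x = tabulate λ i → ⌊ F.any? (λ j → in? x (i , j)) ⌋
      cols : Fin size → Subset N
      cols x = tabulate λ j → ⌊ F.any? (λ i → in? x (i , j)) ⌋
      rect : Fin size → Subset M × Subset N
      rect x = rows x , cols x
      row⁻ : ∀ x i → i ∈ₛ rows x → ∃ λ j → In x (i , j)
      row⁻ x i i∈ = ⌊⌋-sound (F.any? (λ j → in? x (i , j))) (trans (sym (lookup∘tabulate _ i)) ([]=⇒lookup i∈))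
      col⁻ : ∀ x j → j ∈ₛ cols x → ∃ λ i → In x (i , j)
      col⁻ x j j∈ = ⌊⌋-sound (F.any? (λ i → in? x (i , j))) (trans (sym (lookup∘tabulate _ j)) ([]=⇒lookup j∈))
      row⁺ : ∀ x i j → In x (i , j) → i ∈ₛ rows x
      row⁺ x i j h = lookup⇒[]= i _ (trans (lookup∘tabulate _ i) (⌊⌋-complete (F.any? (λ j → in? x (i , j))) (j , h)))
      col⁺ : ∀ x i j → In x (i , j) → j ∈ₛ cols x
      col⁺ x i j h = lookup⇒[]= j _ (trans (lookup∘tabulate _ j) (⌊⌋-complete (F.any? (λ i → in? x (i , j))) (i , h)))
      entry : ∀ x u d → Has x u d → Σ (Entries I J u) λ p → colour u p ≡ x
      entry x u (yes p) e = p , e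
      is-rect : ∀ x → IsRect Z I J (rect x)
      is-rect x = (λ {i} i∈ → proj₁ (proj₁ (entry x _ _ (proj₂ (row⁻ x i i∈))))) ,
                  (λ {j} j∈ → proj₁ (proj₂ (proj₁ (entry x _ _ (proj₂ (col⁻ x j j∈)))))) , ones
        where
        ones : ∀ i j → i ∈ₛ rows x → j ∈ₛ cols x → Z i j ≡ true
        ones i j i∈ j∈ with row⁻ x i i∈ | col⁻ x j j∈
        ... | j′ , h | i′ , h′ with entry x (i , j′) _ h | entry x (i′ , j) _ h′
        ... | p , e | p′ , e′ = ∧-left (clique _ _ p p′ (trans e (sym e′)))
      covers : ∀ i j → InSupp Z I J i j → ∃ λ x → i ∈ₛ rows x × j ∈ₛ cols x
      covers i j p = go (entry? (i , j)) refl
        where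
        go : ∀ d → entry? (i , j) ≡ d → ∃ λ x → i ∈ₛ rows x × j ∈ₛ cols x
        go (no n) _ = contradiction p n
        go (yes q) e = colour (i , j) q , row⁺ _ i j h , col⁺ _ i j h
          where
          h : In (colour (i , j) q) (i , j)
          h = subst (Has _ (i , j)) (sym e) refl

    tight⇒isolated : (t : TightZ I J) → IsIsolated Z I J (TightIn.size t) (TightIn.rep t)
    tight⇒isolated t = rep∈ , λ x y x≢y →
      (λ e → x≢y (indep x y (∧-intro (trans (cong (λ i → Z i (proj₂ (rep y))) e) (on y)) (trans (cong (λ i → Z i (proj₂ (rep x))) (sym e)) (on x))))) ,
      (λ e → x≢y (indep x y (∧-intro (trans (cong (Z _) (sym e)) (on x)) (trans (cong (Z _) e) (on y))))) ,
      apart x y x≢y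
      where
      open TightIn t
      on : ∀ x → Z (proj₁ (rep x)) (proj₂ (rep x)) ≡ true
      on x = proj₂ (proj₂ (rep∈ x))
      apart : ∀ x y → x ≢ y → _ ⊎ _
      apart x y x≢y with bool-cases (Z (proj₁ (rep x)) (proj₂ (rep y)))
      ... | inj₂ e = inj₁ e
      ... | inj₁ e = inj₂ (≢true λ e′ → x≢y (indep x y (∧-intro e e′)))

    tight⇒equal : TightZ I J → Σ ℕ λ r → IsBoolRank Z I J r × IsIsolationNumber Z I J r
    tight⇒equal t = TightIn.size t ,
      (tight⇒cover t , λ k cov → isolated≤cover cov (tight⇒isolated t)) ,
      ((TightIn.rep t , tight⇒isolated t) , λ k p iso → isolated≤cover (tight⇒cover t) iso)

    equal⇒tight : (Σ ℕ λ r → IsBoolRank Z I J r × IsIsolationNumber Z I J r) → TightZ I J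
    equal⇒tight (r , ((rs , rect , covers) , _) , ((p , in′ , iso) , _)) = record
      { size = r
      ; colour = λ u h → proj₁ (covers _ _ h)
      ; clique = λ u v h h′ e → clq u v h h′ e
      ; rep = p ; rep∈ = in′
      ; indep = ind }
      where
      clq : ∀ u v h h′ → proj₁ (covers (proj₁ u) (proj₂ u) h) ≡ proj₁ (covers (proj₁ v) (proj₂ v) h′) → entry-adj Z u v ≡ true
      clq u v h h′ e with covers _ _ h | covers _ _ h′
      clq u v h h′ refl | x , ui , uj | .x , vi , vj =
        ∧-intro (proj₂ (proj₂ (rect x)) _ _ ui vj) (proj₂ (proj₂ (rect x)) _ _ vi uj)
      ind : ∀ x y → entry-adj Z (p x) (p y) ≡ true → x ≡ y
      ind x y e with x F.≟ y
      ... | yes x≡y = x≡y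
      ... | no x≢y = ⊥-elim ([ true≢false (∧-left e) ,
              true≢false (∧-right {Z (proj₁ (p x)) (proj₂ (p y))} e) ]′ (proj₂ (proj₂ (iso x y x≢y))))

MinimallyNonTight : ∀ {M N} → BMat M N → Set
MinimallyNonTight Z = (∀ I J → I ≢ ⊤ ⊎ J ≢ ⊤ → Rank.TightZ Z I J) × ¬ Rank.TightZ Z ⊤ ⊤

-- A submatrix of a proper submatrix is proper, so the hereditary clause of firmness follows from
-- tightness of single submatrices.
minimally-non-firm : ∀ {M N} {Z : BMat M N} → MinimallyNonTight Z → MinimallyNonFirm Z
minimally-non-firm {Z = Z} (proper , full) =
  (λ firm → full (Rank.equal⇒tight Z (firm ⊤ ⊤ ⊆⊤ ⊆⊤))) ,
  λ I J ne I′ J′ I⊆ J⊆ → Rank.tight⇒equal Z (proper I′ J′ (Sum.map (λ n e → n (above I⊆ e)) (λ n e → n (above J⊆ e)) ne))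
  where
  above : ∀ {k} {I I′ : Subset k} → I′ ⊆ I → I′ ≡ ⊤ → I ≡ ⊤
  above I⊆ refl = ⊆-antisym ⊆⊤ I⊆

transposed : ∀ {M N} {Z : BMat M N} → MinimallyNonTight (flip Z) → MinimallyNonTight Z
transposed {Z = Z} (proper , full) =
  (λ I J ne → turn {Z = Z} (proper J I (Sum.swap ne))) , λ t → full (turn {Z = flip Z} t)
  where
  turn : ∀ {M N} {Z : BMat M N} {I J} → Rank.TightZ (flip Z) J I → Rank.TightZ Z I J
  turn {Z = Z} = transport swap swap (λ { _ (i , j , e) → j , i , e }) (λ { _ (i , j , e) → j , i , e })
    (λ { (i , j) (p , q) _ _ e → ∧-intro (∧-right {Z p j} e) (∧-left e) })
    (λ { (j , i) (q , p) _ _ e → ∧-intro (∧-right {Z i q} e) (∧-left e) })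

-- Placing the abstract rows and columns in a concrete matrix

module Placement (Fam : Family) (checked : Checked Fam) (m : ℕ)
  {M N : ℕ} (Z : BMat M N) where
  open Family Fam
  open Family-tight Fam checked using (Full; module E)
  open Stretched Fam checked m

  rowOK colOK : Line → Bool
  rowOK (inj₁ (core x)) = x <ᵇ a
  rowOK (inj₁ (path i)) = i <ᵇ suc m
  rowOK (inj₂ s)        = s <ᵇ t
  colOK (inj₁ (core y)) = y <ᵇ b
  colOK (inj₁ (path j)) = j <ᵇ m
  colOK (inj₂ s)        = s <ᵇ t

  module _ (ρ : Line → Fin M) (γ : Line → Fin N)
           (ρ-onto : ∀ i → ∃ λ x → rowOK x ≡ true × ρ x ≡ i) (γ-onto : ∀ j → ∃ λ y → colOK y ≡ true × γ y ≡ j)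
           (table : ∀ x y → rowOK x ≡ true → colOK y ≡ true → Z (ρ x) (γ y) ≡ Y x y) where

    private
      σ : Fin M → Line
      σ i = proj₁ (ρ-onto i)
      τ : Fin N → Line
      τ j = proj₁ (γ-onto j)

      <ᵇ-sound : ∀ {m n} → (m <ᵇ n) ≡ true → m < n
      <ᵇ-sound e = N.<ᵇ⇒< _ _ (≡⇒T e)

      table′ : ∀ i j → Z i j ≡ Y (σ i) (τ j)
      table′ i j = trans (cong₂ Z (sym (proj₂ (proj₂ (ρ-onto i)))) (sym (proj₂ (proj₂ (γ-onto j)))))
                         (table _ _ (proj₁ (proj₂ (ρ-onto i))) (proj₁ (proj₂ (γ-onto j))))

    module _ (I : Subset M) (J : Subset N) where
      private
        I° J° : Line → Bool
        I° x = rowOK x ∧ lookup I (ρ x)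
        J° y = colOK y ∧ lookup J (γ y)

        unmarked : Line → Line → Bool
        unmarked _ _ = false

        Top : Line × Line → Set
        Top = Alive Y I° J° unmarked

        to : ∀ u → Rank.Entries Z I J u → Top (σ (proj₁ u) , τ (proj₂ u))
        to (i , j) (i∈ , j∈ , e) =
          ∧-intro (proj₁ (proj₂ (ρ-onto i))) (trans (cong (lookup I) (proj₂ (proj₂ (ρ-onto i)))) ([]=⇒lookup i∈)) ,
          ∧-intro (proj₁ (proj₂ (γ-onto j))) (trans (cong (lookup J) (proj₂ (proj₂ (γ-onto j)))) ([]=⇒lookup j∈)) ,
          trans (sym (table′ i j)) e , refl

        table″ : ∀ u v → Top u → Top v → entry-adj Z (ρ (proj₁ u) , γ (proj₂ u)) (ρ (proj₁ v) , γ (proj₂ v)) ≡ entry-adj Y u v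
        table″ (x , y) (x′ , y′) (i , j , _) (i′ , j′ , _) =
          cong₂ _∧_ (table x y′ (∧-left i) (∧-left j′)) (table x′ y (∧-left i′) (∧-left j))

        from : ∀ u → Top u → Rank.Entries Z I J (ρ (proj₁ u) , γ (proj₂ u))
        from (x , y) (i , j , e , _) =
          lookup⇒[]= _ I (∧-right {rowOK x} i) , lookup⇒[]= _ J (∧-right {colOK y} j) ,
          trans (table x y (∧-left i) (∧-left j)) e

        edge : ∀ u v → entry-adj Y (σ (proj₁ u) , τ (proj₂ u)) (σ (proj₁ v) , τ (proj₂ v)) ≡ entry-adj Z u v
        edge (i , j) (p , q) = sym (cong₂ _∧_ (table′ i q) (table′ p j))

      lift : Tight (entry-adj Y) Top → Rank.TightZ Z I J
      lift = transport _ _ to from (λ u v _ _ e → trans (sym (edge u v)) e) (λ u v p q e → trans (sym (table″ u v p q)) e)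

      lower : Rank.TightZ Z I J → Tight (entry-adj Y) Top
      lower = transport _ _ from to (λ u v p q e → trans (sym (table″ u v p q)) e) (λ u v _ _ e → trans (sym (edge u v)) e)

      valid : Valid′ t I° J° unmarked
      valid = record
        { rows = (λ x e → <ᵇ-sound (∧-left e)) , (λ i e → <ᵇ-sound (∧-left {i <ᵇ suc m} e))
        ; cols = (λ y e → <ᵇ-sound (∧-left e)) , (λ j e → <ᵇ-sound (∧-left e))
        ; s-rows = λ s e → <ᵇ-sound (∧-left e) ; s-cols = λ s e → <ᵇ-sound (∧-left e)
        ; marks = λ _ _ () }

      module _ (f : Full′ t I° J° unmarked) where
        module Φ = Full′ f
        row-full : ∀ x → rowOK x ≡ true → I° x ≡ true
        row-full (inj₁ (core x)) e = Full.rows Φ.full x (<ᵇ-sound e)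
        row-full (inj₁ (path i)) e = Full.p-rows Φ.full i (N.≤-pred (<ᵇ-sound {i} {suc m} e))
        row-full (inj₂ s) e = Φ.s-rows s (<ᵇ-sound e)
        col-full : ∀ y → colOK y ≡ true → J° y ≡ true
        col-full (inj₁ (core y)) e = Full.cols Φ.full y (<ᵇ-sound e)
        col-full (inj₁ (path j)) e = Full.p-cols Φ.full j (<ᵇ-sound e)
        col-full (inj₂ s) e = Φ.s-cols s (<ᵇ-sound e)
        I-full : I ≡ ⊤
        I-full = ⊆-antisym ⊆⊤ λ {i} _ → lookup⇒[]= i I (trans (cong (lookup I) (sym (proj₂ (proj₂ (ρ-onto i)))))
          (∧-right {rowOK (σ i)} (row-full (σ i) (proj₁ (proj₂ (ρ-onto i))))))
        J-full : J ≡ ⊤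
        J-full = ⊆-antisym ⊆⊤ λ {j} _ → lookup⇒[]= j J (trans (cong (lookup J) (sym (proj₂ (proj₂ (γ-onto j)))))
          (∧-right {colOK (τ j)} (col-full (τ j) (proj₁ (proj₂ (γ-onto j))))))

      proper : I ≢ ⊤ ⊎ J ≢ ⊤ → Rank.TightZ Z I J
      proper ne = [ lift , (λ f → ⊥-elim ([ (λ n → n (I-full f)) , (λ n → n (J-full f)) ]′ ne)) ]′
                    (squares t N.≤-refl valid)

    all-full : Full′ t (λ x → rowOK x ∧ lookup (⊤ {M}) (ρ x)) (λ y → colOK y ∧ lookup (⊤ {N}) (γ y)) (λ _ _ → false)
    all-full = record
      { full = record { rows = λ x lt → ∧-intro (<⇒ lt) (on (ρ _)) ; p-rows = λ i le → ∧-intro (<⇒ (s≤s le)) (on (ρ _))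
                      ; cols = λ y lt → ∧-intro (<⇒ lt) (on (γ _)) ; p-cols = λ j lt → ∧-intro (<⇒ lt) (on (γ _))
                      ; corners = λ _ _ → refl }
      ; s-rows = λ s lt → ∧-intro (<⇒ lt) (on (ρ _)) ; s-cols = λ s lt → ∧-intro (<⇒ lt) (on (γ _))
      ; marked = λ s t≤s s<t → contradiction s<t (N.≤⇒≯ t≤s) }
      where
      <⇒ : ∀ {m n} → m < n → (m <ᵇ n) ≡ true
      <⇒ lt = T⇒≡ (N.<⇒<ᵇ lt)
      on : ∀ {k} (i : Fin k) → lookup (⊤ {k}) i ≡ true
      on i = []=⇒lookup (∈⊤ {x = i})

    minimal : (∀ {I J W} → Family-tight.Valid Fam checked m I J W → Full m I J W → ¬ E.TightM m I J W) →
              MinimallyNonTight Z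
    minimal nt = proper , λ τ′ → squares-not nt t N.≤-refl (valid ⊤ ⊤) all-full (lower ⊤ ⊤ τ′)

-- Entries of a stretched matrix and the numbering of its rows and columns

≤ᵇ-true : ∀ {m n} → m ≤ n → (m ≤ᵇ n) ≡ true
≤ᵇ-true le = T⇒≡ (N.≤⇒≤ᵇ le)

<ᵇ-true : ∀ {m n} → m < n → (m <ᵇ n) ≡ true
<ᵇ-true lt = T⇒≡ (N.<⇒<ᵇ lt)

<ᵇ-true⁻ : ∀ {m n} → (m <ᵇ n) ≡ true → m < n
<ᵇ-true⁻ e = N.<ᵇ⇒< _ _ (≡⇒T e)

≡ᵇ-comm : ∀ m n → (m ≡ᵇ n) ≡ (n ≡ᵇ m)
≡ᵇ-comm m n = bool-ext (λ e → subst (λ z → (z ≡ᵇ m) ≡ true) (≡ᵇ-sound {m} {n} e) (≡ᵇ-refl m))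
                       (λ e → subst (λ z → (z ≡ᵇ n) ≡ true) (≡ᵇ-sound {n} {m} e) (≡ᵇ-refl n))

+suc≰ᵇ : ∀ n s → (n + suc s ≤ᵇ n) ≡ false
+suc≰ᵇ n s = ≢true λ e → N.<⇒≱ (N.m<m+n n (s≤s z≤n)) (N.≤ᵇ⇒≤ (n + suc s) n (≡⇒T e))

module _ (m n : ℕ) (P : ℕ → ℕ → Bool) (Q : List (ℕ × ℕ)) where

  stretch-old : ∀ {i j} → i ≤ m → j ≤ n → Stretchℕ m n P Q i j ≡ P i j
  stretch-old {i} {j} i≤m j≤n rewrite ≤ᵇ-true i≤m | ≤ᵇ-true j≤n = refl

  stretch-row : ∀ {i s l k} → i ≤ m → nth Q (suc s) ≡ just (l , k) → Stretchℕ m n P Q i (n + suc s) ≡ (i ≡ᵇ l)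
  stretch-row {i} {s} i≤m e rewrite ≤ᵇ-true i≤m | +suc≰ᵇ n s | N.m+n∸m≡n n (suc s) | e = refl

  stretch-col : ∀ {j s l k} → j ≤ n → nth Q (suc s) ≡ just (l , k) → Stretchℕ m n P Q (m + suc s) j ≡ (j ≡ᵇ k)
  stretch-col {j} {s} j≤n e rewrite ≤ᵇ-true j≤n | +suc≰ᵇ m s | N.m+n∸m≡n m (suc s) | e = refl

  stretch-new : ∀ s u → Stretchℕ m n P Q (m + suc s) (n + suc u) ≡ (u ≡ᵇ s)
  stretch-new s u rewrite +suc≰ᵇ m s | +suc≰ᵇ n u | N.m+n∸m≡n m (suc s) | N.m+n∸m≡n n (suc u) = refl

-- Positions are thus defined for all lines. Lines outside the matrix land on the default `zero`,
-- where they are harmless because `okL` excludes them.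
clamp : ∀ n → ℕ → Fin (suc n)
clamp n k with k N.<? suc n
... | yes lt = fromℕ< lt
... | no _   = zero

toℕ-clamp : ∀ n {k} → k < suc n → toℕ (clamp n k) ≡ k
toℕ-clamp n {k} lt with k N.<? suc n
... | yes lt′ = F.toℕ-fromℕ< lt′
... | no n≮   = contradiction lt n≮

record Numbering (ok : Ix → Bool) (n : ℕ) : Set where
  field
    num   : Ix → ℕ
    low   : ∀ x → ok x ≡ true → 1 ≤ num x
    high  : ∀ x → ok x ≡ true → num x ≤ n
    index : ∀ k → 1 ≤ k → k ≤ n → ∃ λ x → ok x ≡ true × num x ≡ k
    inj   : ∀ x y → ok x ≡ true → ok y ≡ true → num x ≡ num y → x ≡ y

module Lines (ok : Ix → Bool) (n t : ℕ) (ν : Numbering ok (suc n)) where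
  open Numbering ν

  okL : Ix ⊎ ℕ → Bool
  okL (inj₁ x) = ok x
  okL (inj₂ s) = s <ᵇ t

  numL : Ix ⊎ ℕ → ℕ
  numL (inj₁ x) = num x
  -- Squares are counted from 0, positions from 1, and the unstretched matrix has `suc n` lines.
  numL (inj₂ s) = suc n + suc s

  lowL : ∀ x → okL x ≡ true → 1 ≤ numL x
  lowL (inj₁ x) e = low x e
  lowL (inj₂ s) e = s≤s z≤n

  highL : ∀ x → okL x ≡ true → numL x ≤ suc n + t
  highL (inj₁ x) e = N.≤-trans (high x e) (N.m≤m+n (suc n) t)
  highL (inj₂ s) e = N.+-monoʳ-≤ (suc n) (<ᵇ-true⁻ e)

  pos : Ix ⊎ ℕ → Fin (suc n + t)
  pos x = clamp (n + t) (pred (numL x))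

  pos-num : ∀ x → okL x ≡ true → suc (toℕ (pos x)) ≡ numL x
  pos-num x e = trans (cong suc (toℕ-clamp (n + t) (bound (numL x) (highL x e)))) (suc-pred (lowL x e))
    where
    bound : ∀ k → k ≤ suc n + t → pred k < suc (n + t)
    bound zero    _  = s≤s z≤n
    bound (suc k) le = le
    suc-pred : ∀ {k} → 1 ≤ k → suc (pred k) ≡ k
    suc-pred (s≤s _) = refl

  pos-onto : ∀ i → ∃ λ x → okL x ≡ true × pos x ≡ i
  pos-onto i with toℕ i N.<? suc n
  ... | yes lt with index (suc (toℕ i)) (s≤s z≤n) lt
  ...   | x , e , eq = inj₁ x , e , F.toℕ-injective (N.suc-injective (trans (pos-num (inj₁ x) e) eq))
  pos-onto i | no n≮ = inj₂ s , s∈ , F.toℕ-injective (N.suc-injective (trans (pos-num (inj₂ s) s∈) eq))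
    where
    s : ℕ
    s = toℕ i ∸ suc n
    split : suc n + s ≡ toℕ i
    split = N.m+[n∸m]≡n (N.≮⇒≥ n≮)
    s∈ : (s <ᵇ t) ≡ true
    s∈ = <ᵇ-true (N.+-cancelˡ-< (suc n) s t (subst (_< suc n + t) (sym split) (F.toℕ<n i)))
    eq : suc n + suc s ≡ suc (toℕ i)
    eq = trans (N.+-suc (suc n) s) (cong suc split)

module Fitting (Fam : Family) (checked : Checked Fam) (m : ℕ) where
  open Family Fam
  open Family-tight Fam checked using (Valid; Full; module E)
  open Stretched Fam checked m using (Line; Y)

  okR okC : Ix → Bool
  okR (core x) = x <ᵇ a
  okR (path i) = i <ᵇ suc m
  okC (core y) = y <ᵇ b
  okC (path j) = j <ᵇ m

  module _ (M N : ℕ) (ν : Numbering okR (suc M)) (μ : Numbering okC (suc N)) where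
    private
      module R = Lines okR M t ν
      module S = Lines okC N t μ
    open Numbering ν using () renaming (num to ρ)
    open Numbering μ using () renaming (num to γ)

    module _ (G : ℕ → ℕ → Bool)
      (old : ∀ x y → okR x ≡ true → okC y ≡ true → G (ρ x) (γ y) ≡ X m x y)
      (row : ∀ x s → okR x ≡ true → s < t → G (ρ x) (suc N + suc s) ≡ (ρ x ≡ᵇ ρ (cR m s)))
      (col : ∀ y s → okC y ≡ true → s < t → G (suc M + suc s) (γ y) ≡ (γ y ≡ᵇ γ (cC m s)))
      (new : ∀ s u → s < t → u < t → G (suc M + suc s) (suc N + suc u) ≡ (s ≡ᵇ u)) where

      Z : BMat (suc M + t) (suc N + t)
      Z = toMat (suc M + t) (suc N + t) G

      private
        open Placement Fam checked m Z using (rowOK; colOK; minimal)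

        rows : ∀ x → rowOK x ≡ R.okL x
        rows (inj₁ (core x)) = refl
        rows (inj₁ (path x)) = refl
        rows (inj₂ s) = refl
        cols : ∀ x → colOK x ≡ S.okL x
        cols (inj₁ (core x)) = refl
        cols (inj₁ (path x)) = refl
        cols (inj₂ s) = refl

        corner-okR : ∀ s → s < t → okR (cR m s) ≡ true
        corner-okR s s<t with corner-row m s s<t
        ... | inj₁ (x , lt , e) = trans (cong okR e) (<ᵇ-true lt)
        ... | inj₂ (e , _)      = trans (cong okR e) (<ᵇ-true (N.n<1+n m))
        corner-okC : ∀ s → s < t → okC (cC m s) ≡ true
        corner-okC s s<t with corner-col m s s<t
        ... | y , lt , e = trans (cong okC e) (<ᵇ-true lt)

        same : ∀ {ok n} (κ : Numbering ok n) x y → ok x ≡ true → ok y ≡ true →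
               (Numbering.num κ x ≡ᵇ Numbering.num κ y) ≡ ⌊ x ≟I y ⌋
        same κ x y p q = bool-ext
          (λ e → ⌊⌋-complete (x ≟I y) (Numbering.inj κ x y p q (≡ᵇ-sound e)))
          (λ e → subst (λ z → (Numbering.num κ x ≡ᵇ Numbering.num κ z) ≡ true) (⌊⌋-sound (x ≟I y) e) (≡ᵇ-refl (Numbering.num κ x)))

        entry : ∀ x y → R.okL x ≡ true → S.okL y ≡ true → G (R.numL x) (S.numL y) ≡ Y x y
        entry (inj₁ x) (inj₁ y) p q = old x y p q
        entry (inj₁ x) (inj₂ s) p q = trans (row x s p (<ᵇ-true⁻ q)) (same ν x (cR m s) p (corner-okR s (<ᵇ-true⁻ q)))
        entry (inj₂ s) (inj₁ y) p q = trans (col y s q (<ᵇ-true⁻ p)) (same μ y (cC m s) q (corner-okC s (<ᵇ-true⁻ p)))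
        entry (inj₂ s) (inj₂ u) p q = new s u (<ᵇ-true⁻ p) (<ᵇ-true⁻ q)

      fits : (∀ {I J W} → Valid m I J W → Full m I J W → ¬ E.TightM m I J W) → MinimallyNonTight Z
      fits = minimal R.pos S.pos
        (λ i → let x , p , e = R.pos-onto i in x , trans (rows x) p , e)
        (λ j → let y , q , e = S.pos-onto j in y , trans (cols y) q , e)
        (λ x y p q → let p′ = trans (sym (rows x)) p ; q′ = trans (sym (cols y)) q in
          trans (cong₂ G (R.pos-num x p′) (S.pos-num y q′)) (entry x y p′ q′))

      placed : ∀ i j → Z i j ≡ Y (proj₁ (R.pos-onto i)) (proj₁ (S.pos-onto j))
      placed i j with R.pos-onto i | S.pos-onto j
      ... | x , p , refl | y , q , refl = trans (cong₂ G (R.pos-num x p) (S.pos-num y q)) (entry x y p q)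

    row-line : ∀ i → ∃ λ x → R.okL x ≡ true × R.pos x ≡ i
    row-line = R.pos-onto

    col-line : ∀ j → ∃ λ y → S.okL y ≡ true × S.pos y ≡ j
    col-line = S.pos-onto

    module Upright (P : ℕ → ℕ → Bool) (Q : List (ℕ × ℕ))
      (old : ∀ x y → okR x ≡ true → okC y ≡ true → P (ρ x) (γ y) ≡ X m x y)
      (corners : ∀ s → s < t → nth Q (suc s) ≡ just (ρ (cR m s) , γ (cC m s))) where

      private
        G : ℕ → ℕ → Bool
        G = Stretchℕ (suc M) (suc N) P Q
        old′ : ∀ x y → okR x ≡ true → okC y ≡ true → G (ρ x) (γ y) ≡ X m x y
        old′ x y p q = trans (stretch-old (suc M) (suc N) P Q (Numbering.high ν x p) (Numbering.high μ y q)) (old x y p q)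
        row′ : ∀ x s → okR x ≡ true → s < t → G (ρ x) (suc N + suc s) ≡ (ρ x ≡ᵇ ρ (cR m s))
        row′ x s p s<t = stretch-row (suc M) (suc N) P Q (Numbering.high ν x p) (corners s s<t)
        col′ : ∀ y s → okC y ≡ true → s < t → G (suc M + suc s) (γ y) ≡ (γ y ≡ᵇ γ (cC m s))
        col′ y s q s<t = stretch-col (suc M) (suc N) P Q (Numbering.high μ y q) (corners s s<t)
        new′ : ∀ s u → s < t → u < t → G (suc M + suc s) (suc N + suc u) ≡ (s ≡ᵇ u)
        new′ s u _ _ = trans (stretch-new (suc M) (suc N) P Q s u) (≡ᵇ-comm u s)

      upright : (∀ {I J W} → Valid m I J W → Full m I J W → ¬ E.TightM m I J W) →
        MinimallyNonTight (toMat (suc M + t) (suc N + t) G)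
      upright = fits G old′ row′ col′ new′

      upright-placed : ∀ i j → toMat (suc M + t) (suc N + t) G i j ≡ Y (proj₁ (row-line i)) (proj₁ (col-line j))
      upright-placed = placed G old′ row′ col′ new′

    module Sideways (P : ℕ → ℕ → Bool) (Q : List (ℕ × ℕ))
      (old : ∀ x y → okR x ≡ true → okC y ≡ true → P (γ y) (ρ x) ≡ X m x y)
      (corners : ∀ s → s < t → nth Q (suc s) ≡ just (γ (cC m s) , ρ (cR m s))) where

      sideways : (∀ {I J W} → Valid m I J W → Full m I J W → ¬ E.TightM m I J W) →
        MinimallyNonTight (toMat (suc N + t) (suc M + t) (Stretchℕ (suc N) (suc M) P Q))
      sideways nt = transposed (fits (flip (Stretchℕ (suc N) (suc M) P Q))
        (λ x y p q → trans (stretch-old (suc N) (suc M) P Q (Numbering.high μ y q) (Numbering.high ν x p)) (old x y p q))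
        (λ x s p s<t → stretch-col (suc N) (suc M) P Q (Numbering.high ν x p) (corners s s<t))
        (λ y s q s<t → stretch-row (suc N) (suc M) P Q (Numbering.high μ y q) (corners s s<t))
        (λ s u _ _ → stretch-new (suc N) (suc M) P Q u s) nt)

-- p core indices, then k path indices, then q core indices, numbered from 1.
module Layout (p k q : ℕ) where
  ok : Ix → Bool
  ok (core x) = x <ᵇ p + q
  ok (path i) = i <ᵇ k

  number : Ix → ℕ
  number (core x) = if x <ᵇ p then suc x else suc (x + k)
  number (path i) = suc (p + i)

  private
    data Kind (x : ℕ) : Set where
      before : x < p → number (core x) ≡ suc x → Kind x
      after  : p ≤ x → number (core x) ≡ suc (x + k) → Kind x

    kind : ∀ x → Kind x
    kind x with x <ᵇ p in e
    ... | true  = before (<ᵇ-true⁻ e) (cong (λ b → if b then suc x else suc (x + k)) e)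
    ... | false = after (N.≮⇒≥ λ lt → true≢false (<ᵇ-true lt) e) (cong (λ b → if b then suc x else suc (x + k)) e)

    p+k+q : (p + q) + k ≡ p + k + q
    p+k+q = trans (N.+-assoc p q k) (trans (cong (p +_) (N.+-comm q k)) (sym (N.+-assoc p k q)))

    high : ∀ x → ok x ≡ true → number x ≤ p + k + q
    high (core x) e with kind x
    ... | before x<p eq rewrite eq = N.≤-trans x<p (N.≤-trans (N.m≤m+n p k) (N.m≤m+n (p + k) q))
    ... | after  _ eq rewrite eq = subst (suc x + k ≤_) p+k+q (N.+-monoˡ-≤ k (<ᵇ-true⁻ e))
    high (path i) e = N.≤-trans (N.+-monoʳ-< p (<ᵇ-true⁻ e)) (N.m≤m+n (p + k) q)

    low : ∀ x → ok x ≡ true → 1 ≤ number x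
    low (core x) e with kind x
    ... | before _ eq rewrite eq = s≤s z≤n
    ... | after  _ eq rewrite eq = s≤s z≤n
    low (path i) e = s≤s z≤n

    index : ∀ n → 1 ≤ n → n ≤ p + k + q → ∃ λ x → ok x ≡ true × number x ≡ n
    index (suc n) _ n< with n N.<? p | n N.<? p + k
    ... | yes n<p | _ = core n , <ᵇ-true (N.≤-trans n<p (N.m≤m+n p q)) , on (kind n)
      where
      on : Kind n → number (core n) ≡ suc n
      on (before _ e) = e
      on (after p≤n _) = contradiction n<p (N.≤⇒≯ p≤n)
    ... | no n≮p | yes n<p+k = path (n ∸ p) ,
          <ᵇ-true (N.+-cancelˡ-< p _ _ (subst (_< p + k) (sym (N.m+[n∸m]≡n (N.≮⇒≥ n≮p))) n<p+k)) ,
          cong suc (N.m+[n∸m]≡n (N.≮⇒≥ n≮p))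
    ... | no n≮p | no n≮p+k = core x , <ᵇ-true x< , on (kind x)
      where
      x : ℕ
      x = n ∸ k
      k≤n : k ≤ n
      k≤n = N.≤-trans (N.m≤n+m k p) (N.≮⇒≥ n≮p+k)
      x+k : x + k ≡ n
      x+k = N.m∸n+n≡m k≤n
      p≤x : p ≤ x
      p≤x = N.+-cancelʳ-≤ k p x (subst (p + k ≤_) (sym x+k) (N.≮⇒≥ n≮p+k))
      x< : x < p + q
      x< = N.+-cancelʳ-< k x (p + q) (N.≤-trans (s≤s (N.≤-reflexive x+k)) (subst (suc n ≤_) (sym p+k+q) n<))
      on : Kind x → number (core x) ≡ suc n
      on (before x<p _) = contradiction x<p (N.≤⇒≯ p≤x)
      on (after _ e) = trans e (cong suc x+k)

    core-path : ∀ x i → i < k → number (core x) ≢ number (path i)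
    core-path x i i<k e with kind x
    ... | before x<p eq = N.<⇒≱ x<p (subst (p ≤_) (sym (N.suc-injective (trans (sym eq) e))) (N.m≤m+n p i))
    ... | after p≤x eq = N.<⇒≱ (N.+-monoʳ-< p i<k)
            (subst (p + k ≤_) (N.suc-injective (trans (sym eq) e)) (N.+-monoˡ-≤ k p≤x))

    inj : ∀ x y → ok x ≡ true → ok y ≡ true → number x ≡ number y → x ≡ y
    inj (core x) (core y) _ _ e with kind x | kind y
    ... | before _ eq | before _ eq′ = cong core (N.suc-injective (trans (sym eq) (trans e eq′)))
    ... | after _ eq | after _ eq′ = cong core (N.+-cancelʳ-≡ k x y (N.suc-injective (trans (sym eq) (trans e eq′))))
    ... | before x<p eq | after p≤y eq′ = contradiction x<p (N.≤⇒≯ (N.≤-trans p≤y (N.≤-trans (N.m≤m+n y k)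
            (N.≤-reflexive (sym (N.suc-injective (trans (sym eq) (trans e eq′))))))))
    ... | after p≤x eq | before y<p eq′ = contradiction y<p (N.≤⇒≯ (N.≤-trans p≤x (N.≤-trans (N.m≤m+n x k)
            (N.≤-reflexive (N.suc-injective (trans (sym eq) (trans e eq′)))))))
    inj (core x) (path i) _ i∈ e = contradiction e (core-path x i (<ᵇ-true⁻ i∈))
    inj (path i) (core x) i∈ _ e = contradiction (sym e) (core-path x i (<ᵇ-true⁻ i∈))
    inj (path i) (path j) _ _ e = cong path (N.+-cancelˡ-≡ p i j (N.suc-injective e))

  numbering : ∀ {ok′ n} → (∀ x → ok′ x ≡ ok x) → p + k + q ≡ n → Numbering ok′ n
  numbering same size = record
    { num = number
    ; low = λ x e → low x (trans (sym (same x)) e)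
    ; high = λ x e → subst (number x ≤_) size (high x (trans (sym (same x)) e))
    ; index = λ n l h → let x , e , eq = index n l (subst (n ≤_) (sym size) h) in x , trans (same x) e , eq
    ; inj = λ x y e e′ → inj x y (trans (sym (same x)) e) (trans (sym (same y)) e′) }

<⇒≢ᵇ : ∀ {m n} → m < n → (m ≡ᵇ n) ≡ false
<⇒≢ᵇ lt = ≡ᵇ-≢ (N.<⇒≢ lt)

>⇒≢ᵇ : ∀ {m n} → n < m → (m ≡ᵇ n) ≡ false
>⇒≢ᵇ lt = ≡ᵇ-≢ (N.>⇒≢ lt)

module Near (m : ℕ) where
  m<m+1 : (m <ᵇ suc m) ≡ true
  m<m+1 = <ᵇ-true (N.n<1+n m)
  mm : (m ≡ᵇ m) ≡ true
  mm = ≡ᵇ-refl m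
  m≢m+1 : (m ≡ᵇ suc m) ≡ false
  m≢m+1 = <⇒≢ᵇ (N.n<1+n m)
  m≢m+2 : (m ≡ᵇ suc (suc m)) ≡ false
  m≢m+2 = <⇒≢ᵇ (N.m<n⇒m<1+n (N.n<1+n m))
  m+2≢m : (suc (suc m) ≡ᵇ m) ≡ false
  m+2≢m = >⇒≢ᵇ (N.m<n⇒m<1+n (N.n<1+n m))
  m+1≢m : (suc m ≡ᵇ m) ≡ false
  m+1≢m = >⇒≢ᵇ (N.n<1+n m)
  m≮m : (m <ᵇ m) ≡ false
  m≮m = ≢true λ e → N.<-irrefl refl (<ᵇ-true⁻ {m} e)
  m+1≮m : (suc m <ᵇ m) ≡ false
  m+1≮m = ≢true λ e → N.<-asym (N.n<1+n m) (<ᵇ-true⁻ {suc m} {m} e)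

-- Entries of path rows in core columns

module _ (F : Frame) where
  open Frame F

  X-c : ∀ m i → X m (path i) (core c) ≡ (i ≡ᵇ 0)
  X-c m i rewrite ≡ᵇ-refl c | ≡ᵇ-≢ c≢d | ∧-zeroʳ (i ≡ᵇ m) | ∧-identityʳ (i ≡ᵇ 0) = ∨-identityʳ (i ≡ᵇ 0)

  X-d : ∀ m i → X m (path i) (core d) ≡ (i ≡ᵇ m)
  X-d m i rewrite ≡ᵇ-refl d | ≡ᵇ-≢ (c≢d ∘ sym) | ∧-zeroʳ (i ≡ᵇ 0) = ∧-identityʳ (i ≡ᵇ m)

  X-off : ∀ m i y → (y ≡ᵇ c) ≡ false → (y ≡ᵇ d) ≡ false → X m (path i) (core y) ≡ false
  X-off m i y e e′ rewrite e | e′ | ∧-zeroʳ (i ≡ᵇ 0) = ∧-zeroʳ (i ≡ᵇ m)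

-- Total balancedness from an ordering without Γ

module Cycle (k : ℕ) (3≤k : 3 ≤ k) where

  -- The cyclic successor: the ones of `C k` are the pairs of an index with itself and with its
  -- successor. Since `3 ≤ k`, neither two steps nor a step backwards is again one of them.
  Step : Fin k → Fin k → Set
  Step a b = toℕ b ≡ suc (toℕ a) ⊎ (suc (toℕ a) ≡ k × toℕ b ≡ 0)

  private
    pos-k : 0 < k
    pos-k = N.≤-trans (s≤s z≤n) 3≤k

    k≢1 : k ≢ 1
    k≢1 refl = contradiction 3≤k λ { (s≤s ()) }
    k≢2 : k ≢ 2
    k≢2 refl = contradiction 3≤k λ { (s≤s (s≤s ())) }

  step-from : ∀ a → ∃ (Step a)
  step-from a with suc (toℕ a) N.<? k
  ... | yes lt = fromℕ< lt , inj₁ (F.toℕ-fromℕ< lt)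
  ... | no n≮  = fromℕ< pos-k , inj₂ (N.≤-antisym (F.toℕ<n a) (N.≮⇒≥ n≮) , F.toℕ-fromℕ< pos-k)

  step-to : ∀ b → ∃ λ a → Step a b
  step-to b with toℕ b in e
  ... | zero  = fromℕ< {pred k} (N.≤-reflexive (N.suc-pred k {{>-nonZero pos-k}})) ,
                inj₂ (trans (cong suc (F.toℕ-fromℕ< _)) (N.suc-pred k {{>-nonZero pos-k}}) , refl)
  ... | suc n = fromℕ< n<k , inj₁ (cong suc (sym (F.toℕ-fromℕ< n<k)))
    where
    n<k : n < k
    n<k = N.<-trans (N.n<1+n n) (subst (_< k) e (F.toℕ<n b))

  step-irrefl : ∀ a → ¬ Step a a
  step-irrefl a (inj₁ e) = N.1+n≢n (sym e)
  step-irrefl a (inj₂ (e , e′)) = k≢1 (trans (sym e) (cong suc e′))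

  step-asym : ∀ a b → Step a b → ¬ Step b a
  step-asym a b (inj₁ e) (inj₁ e′) = N.m≢1+n+m (toℕ a) {1} (trans e′ (cong suc e))
  step-asym a b (inj₁ e) (inj₂ (e′ , e″)) = k≢2 (trans (sym e′) (cong suc (trans e (cong suc e″))))
  step-asym a b (inj₂ (e , e′)) (inj₁ e″) = k≢2 (trans (sym e) (cong suc (trans e″ (cong suc e′))))
  step-asym a b (inj₂ (e , e′)) (inj₂ (_ , e″)) = k≢1 (trans (sym e) (cong suc e″))

  step-unique : ∀ {a b b′} → Step a b → Step a b′ → b ≡ b′
  step-unique (inj₁ e) (inj₁ e′) = F.toℕ-injective (trans e (sym e′))
  step-unique (inj₂ (_ , e)) (inj₂ (_ , e′)) = F.toℕ-injective (trans e (sym e′))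
  step-unique {b = b} (inj₁ e) (inj₂ (e′ , _)) = contradiction (trans e e′) (N.<⇒≢ (F.toℕ<n b))
  step-unique {b′ = b} (inj₂ (e′ , _)) (inj₁ e) = contradiction (trans e e′) (N.<⇒≢ (F.toℕ<n b))

  C-same : ∀ a → C k a a ≡ true
  C-same a = ∨-introˡ (≡ᵇ-refl (toℕ a))

  C-step : ∀ {a b} → Step a b → C k a b ≡ true
  C-step {a} {b} (inj₁ e) = ∨-introʳ {toℕ b ≡ᵇ toℕ a} (∨-introˡ (∧-intro
    (<ᵇ-true (subst (_< k) e (F.toℕ<n b))) (subst (λ z → (z ≡ᵇ suc (toℕ a)) ≡ true) (sym e) (≡ᵇ-refl (toℕ a)))))
  C-step {a} {b} (inj₂ (e , e′)) = ∨-introʳ {toℕ b ≡ᵇ toℕ a} (∨-introʳ {(suc (toℕ a) <ᵇ k) ∧ (toℕ b ≡ᵇ suc (toℕ a))}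
    (∧-intro (subst (λ z → (suc (toℕ a) ≡ᵇ z) ≡ true) e (≡ᵇ-refl (suc (toℕ a)))) (cong (_≡ᵇ 0) e′)))

  C-inv : ∀ a b → C k a b ≡ true → b ≡ a ⊎ Step a b
  C-inv a b e with ∨-elim {toℕ b ≡ᵇ toℕ a} e
  ... | inj₁ e₁ = inj₁ (F.toℕ-injective (≡ᵇ-sound e₁))
  ... | inj₂ e₂ with ∨-elim {(suc (toℕ a) <ᵇ k) ∧ (toℕ b ≡ᵇ suc (toℕ a))} e₂
  ... | inj₁ e₃ = inj₂ (inj₁ (≡ᵇ-sound {toℕ b} (∧-right {suc (toℕ a) <ᵇ k} e₃)))
  ... | inj₂ e₃ = inj₂ (inj₂ (≡ᵇ-sound {suc (toℕ a)} (∧-left e₃) , ≡ᵇ-sound {toℕ b} {0} (∧-right {suc (toℕ a) ≡ᵇ k} e₃)))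

  C-short : ∀ {a b} → Step a b → C k b a ≡ false
  C-short {a} {b} st = ≢true λ e → [ (λ { refl → step-irrefl a st }) , step-asym a b st ]′ (C-inv b a e)

  C-skip : ∀ {p a b} → Step p a → Step a b → C k p b ≡ false
  C-skip {p} {a} {b} st st′ = ≢true λ e → [ (λ { refl → step-asym p a st st′ }) ,
    (λ st″ → step-irrefl a (subst (Step a) (step-unique st″ st) st′)) ]′ (C-inv p b e)

least : ∀ {n} (v : Fin (suc n) → ℕ) → ∃ λ a → ∀ b → v a ≤ v b
least {zero}  v = zero , λ { zero → N.≤-refl }
least {suc n} v with least (v ∘ suc)
... | a , h with N.≤-total (v zero) (v (suc a))
... | inj₁ le = zero , λ { zero → N.≤-refl ; (suc b) → N.≤-trans le (h b) }
... | inj₂ ge = suc a , λ { zero → ge ; (suc b) → h b }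

-- Look at the first row of a cycle and at the first of its two ones: the other row through that
-- one comes later, so it would also contain the second one.
Γ-free⇒balanced : ∀ {M N} (Z : BMat M N) (rr : Fin M → ℕ) (cc : Fin N → ℕ) →
  Injective _≡_ _≡_ rr → Injective _≡_ _≡_ cc →
  (∀ i i′ j j′ → rr i < rr i′ → cc j < cc j′ → Z i j ≡ true → Z i j′ ≡ true → Z i′ j ≡ true → Z i′ j′ ≡ true) →
  TotallyBalanced Z
Γ-free⇒balanced Z rr cc rr-inj cc-inj Γ k@(suc _) 3≤k f g f-inj g-inj eq = clash (least (rr ∘ f))
  where
  open Cycle k 3≤k
  on : ∀ {a b} → C k a b ≡ true → Z (f a) (g b) ≡ true
  on {a} {b} e = trans (eq a b) e
  clash : (∃ λ a → ∀ b → rr (f a) ≤ rr (f b)) → ⊥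
  clash (a , first) with step-from a | step-to a
  ... | b , st | p , st′ = go (N.<-cmp (cc (g a)) (cc (g b)))
    where
    later : ∀ x → a ≢ x → rr (f a) < rr (f x)
    later x n = N.≤∧≢⇒< (first x) λ e → n (f-inj (rr-inj e))
    go : _ → ⊥
    go (tri< lt _ _) = true≢false
      (trans (sym (eq p b)) (Γ (f a) (f p) (g a) (g b) (later p λ { refl → step-irrefl a st′ }) lt (on (C-same a)) (on (C-step st)) (on (C-step st′))))
      (C-skip st′ st)
    go (tri≈ _ e _) = step-irrefl a (subst (Step a) (sym (g-inj (cc-inj e))) st)
    go (tri> _ _ gt) = true≢false
      (trans (sym (eq b a)) (Γ (f a) (f b) (g b) (g a) (later b λ { refl → step-irrefl a st }) gt (on (C-step st)) (on (C-same a)) (on (C-same b))))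
      (C-short st)

Γ-check : List (ℕ × ℕ) → Bool
Γ-check es = all (λ (x , y) → all (λ (x₁ , y′) → all (λ (x′ , y₁) →
  not ((x₁ ≡ᵇ x) ∧ (y₁ ≡ᵇ y) ∧ (x <ᵇ x′) ∧ (y <ᵇ y′)) ∨ listed es x′ y′) es) es) es

Γ-check-sound : ∀ es → Γ-check es ≡ true → ∀ x x′ y y′ → x < x′ → y < y′ →
  listed es x y ≡ true → listed es x y′ ≡ true → listed es x′ y ≡ true → listed es x′ y′ ≡ true
Γ-check-sound es ok x x′ y y′ x< y< e₁ e₂ e₃
  with ∨-elim {not ((x ≡ᵇ x) ∧ (y ≡ᵇ y) ∧ (x <ᵇ x′) ∧ (y <ᵇ y′))}
         (all-sound _ (all-sound _ (all-sound _ ok (listed-∈ es x y e₁)) (listed-∈ es x y′ e₂)) (listed-∈ es x′ y e₃))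
... | inj₁ e = ⊥-elim (true≢false (∧-intro (≡ᵇ-refl x) (∧-intro (≡ᵇ-refl y) (∧-intro (<ᵇ-true x<) (<ᵇ-true y<)))) (not-true e))
... | inj₂ e = e

-- Order the rows as squares, core, path, r and the columns as squares, core, path, d.
module Balanced (Fam : Family) (checked : Checked Fam) (m : ℕ) where
  open Family Fam
  open Fitting Fam checked m
  open Stretched Fam checked m using (Line; Y)

  module _ (a≡ : a ≡ suc r) (b≡ : b ≡ suc d) (d≡ : d ≡ suc c)
           (Γ-core : ∀ x x′ y y′ → x < x′ → y < y′ → K x y ≡ true → K x y′ ≡ true → K x′ y ≡ true → K x′ y′ ≡ true)
           (d-only : ∀ x → K x d ≡ true → x ≡ r) where
    module R = Layout r (suc m) 1
    module S = Layout d m 1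

    data RowView : Ix → Set where
      low  : ∀ x → x < r → R.number (core x) ≡ suc x → RowView (core x)
      apex : R.number (core r) ≡ suc (r + suc m) → RowView (core r)
      link : ∀ i → i ≤ m → RowView (path i)

    data ColView : Ix → Set where
      low  : ∀ y → y ≤ c → S.number (core y) ≡ suc y → ColView (core y)
      last : S.number (core d) ≡ suc (d + m) → ColView (core d)
      link : ∀ j → j < m → ColView (path j)

    private
      n≮n : ∀ n → (n <ᵇ n) ≡ false
      n≮n n = ≢true λ e → N.<-irrefl refl (<ᵇ-true⁻ {n} e)

    row-view : ∀ x → okR x ≡ true → RowView x
    row-view (core x) e with N.m<1+n⇒m<n∨m≡n (subst (x <_) a≡ (<ᵇ-true⁻ e))
    ... | inj₁ lt   = low x lt (cong (λ z → if z then suc x else suc (x + suc m)) (<ᵇ-true lt))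
    ... | inj₂ refl = apex (cong (λ z → if z then suc r else suc (r + suc m)) (n≮n r))
    row-view (path i) e = link i (N.≤-pred (<ᵇ-true⁻ {i} {suc m} e))

    col-view : ∀ y → okC y ≡ true → ColView y
    col-view (core y) e with N.m<1+n⇒m<n∨m≡n (subst (y <_) b≡ (<ᵇ-true⁻ e))
    ... | inj₁ lt   = low y (N.≤-pred (subst (y <_) d≡ lt)) (cong (λ z → if z then suc y else suc (y + m)) (<ᵇ-true lt))
    ... | inj₂ refl = last (cong (λ z → if z then suc d else suc (d + m)) (n≮n d))
    col-view (path j) e = link j (<ᵇ-true⁻ e)

    r-last : ∀ {x} → RowView x → ¬ (R.number (core r) < R.number x)
    r-last {x} v lt = beyond v (subst (_< R.number x) eq lt)
      where
      eq : R.number (core r) ≡ suc (r + suc m)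
      eq = cong (λ z → if z then suc r else suc (r + suc m)) (n≮n r)
      beyond : ∀ {x} → RowView x → ¬ (suc (r + suc m) < R.number x)
      beyond (low x x<r e) lt = N.<⇒≱ (subst (suc (r + suc m) <_) e lt) (s≤s (N.≤-trans (N.<⇒≤ x<r) (N.m≤m+n r (suc m))))
      beyond (apex e) lt = N.<-irrefl refl (subst (suc (r + suc m) <_) e lt)
      beyond (link i i≤m) lt = N.<⇒≱ lt (s≤s (N.+-monoʳ-≤ r (N.≤-trans i≤m (N.n≤1+n m))))

    private
      r-full : ∀ i y → X m (path i) y ≡ true → X m (core r) y ≡ true
      r-full i (path j) e = ≡ᵇ-refl r
      r-full i (core y) e with X-path-core m i y e
      ... | inj₁ (_ , refl) = K-rc
      ... | inj₂ (_ , refl) = K-rd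

      not-r : ∀ {x} → x < r → x ≢ r
      not-r lt refl = N.<-irrefl refl lt

    -- Core rows above the apex meet neither path columns nor `d`, so the one column they can share
    -- with a path row, `c`, is the last of their ones. Likewise two path rows share at most one
    -- column, the last one of the earlier row. The apex comes last and contains all path rows; core
    -- against core is the finite check.
    Γ-base : ∀ {x x′ y y′} → RowView x → RowView x′ → ColView y → ColView y′ →
      R.number x < R.number x′ → S.number y < S.number y′ →
      X m x y ≡ true → X m x y′ ≡ true → X m x′ y ≡ true → X m x′ y′ ≡ true
    Γ-base (apex _) v′ _ _ lt = ⊥-elim (r-last v′ lt)
    Γ-base (low x x<r _) _ (link j _) _ _ _ e = contradiction (≡ᵇ-sound e) (not-r x<r)
    Γ-base (low x x<r _) _ _ (link j _) _ _ _ e = contradiction (≡ᵇ-sound e) (not-r x<r)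
    Γ-base (low x x<r _) _ (last _) _ _ _ e = contradiction (d-only x e) (not-r x<r)
    Γ-base (low x x<r _) _ _ (last _) _ _ _ e = contradiction (d-only x e) (not-r x<r)
    Γ-base (low x x<r ex) (low x′ _ ex′) (low y _ ey) (low y′ _ ey′) lx ly = Γ-core x x′ y y′
      (N.≤-pred (subst (_< suc x′) ex (subst (R.number (core x) <_) ex′ lx)))
      (N.≤-pred (subst (_< suc y′) ey (subst (S.number (core y) <_) ey′ ly)))
    Γ-base (low x x<r ex) (apex _) (low y _ ey) (low y′ _ ey′) lx ly = Γ-core x r y y′ x<r
      (N.≤-pred (subst (_< suc y′) ey (subst (S.number (core y) <_) ey′ ly)))
    Γ-base (low x x<r ex) (link i _) (low y y≤c ey) (low y′ y′≤c ey′) lx ly e e′ e″ with X-path-core m i y e″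
    ... | inj₁ (_ , refl) = contradiction (N.≤-pred (subst (_< suc y′) ey (subst (S.number (core y) <_) ey′ ly))) (N.≤⇒≯ y′≤c)
    ... | inj₂ (_ , refl) = contradiction (d-only x e) (not-r x<r)
    Γ-base (link i i≤m) (low x x<r ex) _ _ lx _ = contradiction (N.≤-trans (N.≤-trans (N.<⇒≤ x<r) (N.m≤m+n r i)) N.≤-refl)
      (N.<⇒≱ (N.≤-pred (subst (suc (r + i) <_) ex lx)))
    Γ-base {y′ = y′} (link i _) (apex _) _ _ _ _ _ e′ _ = r-full i y′ e′
    Γ-base (link i i≤m) (link i′ i′≤m) (link j j<m) v lx ly e e′ e″ =
      go (X-path-path m i j e) (X-path-path m i′ j e″)
      where
      i<i′ : i < i′
      i<i′ = N.+-cancelˡ-< r i i′ (N.≤-pred lx)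
      after : j ≡ i → ∀ {y′} → ColView y′ → S.number (path j) < S.number y′ → X m (path i) y′ ≡ true → ⊥
      after refl (link j′ _) ly e with X-path-path m i j′ e
      ... | inj₁ refl = N.<-irrefl refl ly
      ... | inj₂ refl = N.<-asym (N.+-cancelˡ-< d _ _ (N.≤-pred ly)) (N.n<1+n j′)
      after refl (low y′ y′≤c ey′) ly e = N.<⇒≱ (N.≤-pred (subst (suc (d + j) <_) ey′ ly))
        (N.≤-trans y′≤c (N.≤-trans (N.≤-trans (N.n≤1+n c) (N.≤-reflexive (sym d≡))) (N.m≤m+n d j)))
      after refl (last _) ly e with X-path-core m i d e
      ... | inj₁ (_ , q) = c≢d (sym q)
      ... | inj₂ (refl , _) = N.<-irrefl refl j<m
      go : _ → _ → _
      go (inj₁ p) _ = ⊥-elim (after p v ly e′)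
      go (inj₂ refl) (inj₁ refl) = ⊥-elim (N.<-asym i<i′ (N.n<1+n _))
      go (inj₂ refl) (inj₂ refl) = ⊥-elim (N.<-irrefl refl i<i′)
    Γ-base (link i i≤m) (link i′ i′≤m) (low y y≤c ey) v lx ly e e′ e″ with X-path-core m i y e | X-path-core m i′ y e″
    ... | inj₁ (refl , _) | inj₁ (refl , _) = ⊥-elim (N.<-irrefl refl lx)
    ... | inj₂ (_ , refl) | _ = contradiction (N.≤-trans (N.≤-reflexive (sym d≡)) y≤c) N.1+n≰n
    ... | _ | inj₂ (_ , refl) = contradiction (N.≤-trans (N.≤-reflexive (sym d≡)) y≤c) N.1+n≰n
    Γ-base (link i i≤m) (link i′ i′≤m) (last _) v lx ly e e′ e″ with X-path-core m i d e | X-path-core m i′ d e″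
    ... | inj₂ (refl , _) | inj₂ (refl , _) = ⊥-elim (N.<-irrefl refl lx)
    ... | inj₁ (_ , q) | _ = contradiction (sym q) c≢d
    ... | _ | inj₁ (_ , q) = contradiction (sym q) c≢d

    okL : (Ix → Bool) → Line → Bool
    okL ok (inj₁ x) = ok x
    okL ok (inj₂ s) = s <ᵇ t

    rank : (Ix → ℕ) → Line → ℕ
    rank num (inj₁ x) = t + num x
    rank num (inj₂ s) = s

    private
      base<square : ∀ {n s} → (s <ᵇ t) ≡ true → ¬ (t + n < s)
      base<square e lt = N.<⇒≱ lt (N.≤-trans (N.<⇒≤ (<ᵇ-true⁻ e)) (N.m≤m+n t _))

      drop-t : ∀ {n n′} → t + n < t + n′ → n < n′
      drop-t = N.+-cancelˡ-< t _ _

    rank-inj : ∀ {ok n} (κ : Numbering ok n) x y → okL ok x ≡ true → okL ok y ≡ true →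
               rank (Numbering.num κ) x ≡ rank (Numbering.num κ) y → x ≡ y
    rank-inj κ (inj₁ x) (inj₁ y) p q e = cong inj₁ (Numbering.inj κ x y p q (N.+-cancelˡ-≡ t _ _ e))
    rank-inj κ (inj₂ s) (inj₂ u) p q e = cong inj₂ e
    rank-inj κ (inj₁ x) (inj₂ s) p q e = contradiction (N.≤-trans (N.m≤m+n t _) (N.≤-reflexive e)) (N.<⇒≱ (<ᵇ-true⁻ q))
    rank-inj κ (inj₂ s) (inj₁ x) p q e = contradiction (N.≤-trans (N.m≤m+n t _) (N.≤-reflexive (sym e))) (N.<⇒≱ (<ᵇ-true⁻ p))

    -- As squares precede everything, a Γ that involves one must start in a new row and its own new
    -- column. The other row and column are then those of the stretched entry, which is the fourth
    -- corner and is a one.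
    Γ-lines : ∀ x x′ y y′ → okL okR x ≡ true → okL okR x′ ≡ true → okL okC y ≡ true → okL okC y′ ≡ true →
      rank R.number x < rank R.number x′ → rank S.number y < rank S.number y′ →
      Y x y ≡ true → Y x y′ ≡ true → Y x′ y ≡ true → Y x′ y′ ≡ true
    Γ-lines (inj₁ x) (inj₁ x′) (inj₁ y) (inj₁ y′) p p′ q q′ lx ly =
      Γ-base (row-view x p) (row-view x′ p′) (col-view y q) (col-view y′ q′) (drop-t lx) (drop-t ly)
    Γ-lines (inj₁ x) (inj₂ s) _ _ p p′ _ _ lx = ⊥-elim (base<square p′ lx)
    Γ-lines _ _ (inj₁ y) (inj₂ s) _ _ q q′ _ ly = ⊥-elim (base<square q′ ly)
    Γ-lines (inj₂ s) x′ (inj₁ y) (inj₁ y′) p _ _ _ _ ly e e′ _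
      with ⌊⌋-sound (y ≟I cC m s) e | ⌊⌋-sound (y′ ≟I cC m s) e′
    ... | refl | refl = ⊥-elim (N.<-irrefl refl ly)
    Γ-lines (inj₁ x) (inj₁ x′) (inj₂ s) y′ _ _ _ _ lx _ e _ e″
      with ⌊⌋-sound (x ≟I cR m s) e | ⌊⌋-sound (x′ ≟I cR m s) e″
    ... | refl | refl = ⊥-elim (N.<-irrefl refl lx)
    Γ-lines (inj₂ u) (inj₂ u′) (inj₂ s) y′ _ _ _ _ lx _ e _ e″ with ≡ᵇ-sound {u} e | ≡ᵇ-sound {u′} e″
    ... | refl | refl = ⊥-elim (N.<-irrefl refl lx)
    Γ-lines (inj₂ u) (inj₁ x′) (inj₂ s) (inj₂ s′) _ _ _ _ _ ly e e′ _ with ≡ᵇ-sound {u} e | ≡ᵇ-sound {u} e′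
    ... | refl | refl = ⊥-elim (N.<-irrefl refl ly)
    Γ-lines (inj₂ u) (inj₁ x′) (inj₂ s) (inj₁ y′) p _ _ _ _ _ e e′ e″
      with ≡ᵇ-sound {u} e | ⌊⌋-sound (y′ ≟I cC m u) e′ | ⌊⌋-sound (x′ ≟I cR m s) e″
    ... | refl | refl | refl = corner-one m u (<ᵇ-true⁻ p)

    private
      rowκ : Numbering okR (r + suc m + 1)
      rowκ = R.numbering (λ { (core x) → cong (x <ᵇ_) (trans a≡ (N.+-comm 1 r)) ; (path _) → refl }) refl

      colκ : Numbering okC (d + m + 1)
      colκ = S.numbering (λ { (core y) → cong (y <ᵇ_) (trans b≡ (N.+-comm 1 d)) ; (path _) → refl }) refl

      same-okL : ∀ {ok n} (κ : Numbering ok (suc n)) x → Lines.okL ok n t κ x ≡ true → okL ok x ≡ true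
      same-okL κ (inj₁ x) e = e
      same-okL κ (inj₂ s) e = e

    balanced : ∀ {M N} (ν : Numbering okR (suc M)) (μ : Numbering okC (suc N)) (Z : BMat (suc M + t) (suc N + t)) →
      (∀ i j → Z i j ≡ Y (proj₁ (row-line M N ν μ i)) (proj₁ (col-line M N ν μ j))) → TotallyBalanced Z
    balanced {M} {N} ν μ Z placed = Γ-free⇒balanced Z (rank R.number ∘ σ) (rank S.number ∘ τ)
      (λ {i} {i′} e → trans (sym (σ-at i)) (trans (cong (Lines.pos okR M t ν) (rank-inj rowκ (σ i) (σ i′) (σ-ok i) (σ-ok i′) e)) (σ-at i′)))
      (λ {j} {j′} e → trans (sym (τ-at j)) (trans (cong (Lines.pos okC N t μ) (rank-inj colκ (τ j) (τ j′) (τ-ok j) (τ-ok j′) e)) (τ-at j′)))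
      λ i i′ j j′ lr lc e e′ e″ → trans (placed i′ j′) (Γ-lines (σ i) (σ i′) (τ j) (τ j′) (σ-ok i) (σ-ok i′) (τ-ok j) (τ-ok j′) lr lc
        (trans (sym (placed i j)) e) (trans (sym (placed i j′)) e′) (trans (sym (placed i′ j)) e″))
      where
      σ : Fin (suc M + t) → Line
      σ i = proj₁ (row-line M N ν μ i)
      τ : Fin (suc N + t) → Line
      τ j = proj₁ (col-line M N ν μ j)
      σ-ok : ∀ i → okL okR (σ i) ≡ true
      σ-ok i = same-okL ν (σ i) (proj₁ (proj₂ (row-line M N ν μ i)))
      τ-ok : ∀ j → okL okC (τ j) ≡ true
      τ-ok j = same-okL μ (τ j) (proj₁ (proj₂ (col-line M N ν μ j)))
      σ-at : ∀ i → Lines.pos okR M t ν (σ i) ≡ i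
      σ-at i = proj₂ (proj₂ (row-line M N ν μ i))
      τ-at : ∀ j → Lines.pos okC N t μ (τ j) ≡ j
      τ-at j = proj₂ (proj₂ (col-line M N ν μ j))

-- The four families

-- D: rows 1, 2, 3 and columns 1, 2, 3, n are core, with apex row 3 and c = 3, d = n.
module D-family where
  ones : List (ℕ × ℕ)
  ones = (0 , 1) ∷ (0 , 2) ∷ (1 , 0) ∷ (1 , 1) ∷ (1 , 2) ∷ (2 , 0) ∷ (2 , 1) ∷ (2 , 2) ∷ (2 , 3) ∷ []

  d-only : ∀ x → listed ones x 3 ≡ true → x ≡ 2
  d-only 0 ()
  d-only 1 ()
  d-only 2 _ = refl
  d-only (suc (suc (suc _))) ()

  frame : Frame
  frame = record { K = listed ones ; r = 2 ; c = 2 ; d = 3 ; K-rc = refl ; K-rd = refl ; c≢d = λ () ; only-r = λ x _ → d-only x }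

  cR cC : ℕ → ℕ → Ix
  cR m 0 = core 0
  cR m 1 = core 1
  cR m _ = path m
  cC m 0 = core 1
  cC m 1 = core 0
  cC m _ = core 3

  family : Family
  family = record
    { frame = frame ; a = 3 ; b = 4 ; t = 3 ; ones = ones ; K-listed = λ _ _ → refl
    ; cR = cR ; cC = cC
    ; corner-suc = λ { m 0 → refl , refl ; m 1 → refl , refl ; m (suc (suc s)) → refl , refl }
    ; corner-row = λ { m 0 _ → inj₁ (0 , s≤s z≤n , refl) ; m 1 _ → inj₁ (1 , s≤s (s≤s z≤n) , refl)
                     ; m (suc (suc s)) _ → inj₂ (refl , refl) }
    ; corner-col = λ { m 0 _ → 1 , s≤s (s≤s z≤n) , refl ; m 1 _ → 0 , s≤s z≤n , refl
                     ; m (suc (suc s)) _ → 3 , s≤s (s≤s (s≤s (s≤s z≤n))) , refl }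
    ; corner-inj = inj
    ; corner-one = λ { m 0 _ → refl ; m 1 _ → refl ; m (suc (suc s)) _ → Frame.X-last frame m } }
    where
    inj : ∀ m s s′ → s < 3 → s′ < 3 → cR m s ≡ cR m s′ → cC m s ≡ cC m s′ → s ≡ s′
    inj m 0 0 _ _ _ _ = refl
    inj m 1 1 _ _ _ _ = refl
    inj m 2 2 _ _ _ _ = refl
    inj m (suc (suc (suc _))) _ (s≤s (s≤s (s≤s ())))
    inj m _ (suc (suc (suc _))) _ (s≤s (s≤s (s≤s ())))

  open Family family using (X)

  checked : Checked family
  -- Comparisons between core cells and corners never inspect `m`, so the core check evaluates with
  -- `m` a variable.
  checked = record { coreOK = λ m → refl ; baseOK = refl }

  -- In this order an induced 5-cycle: consecutive entries share a rectangle, and so do the last and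
  -- the first.
  hole : Fin 5 → Ix × Ix
  hole = lookup ((path 0 , core 2) ∷ (core 0 , core 2) ∷ (core 1 , core 1) ∷ (core 2 , core 0) ∷ (core 2 , core 3) ∷ [])

  module FT = Family-tight family checked

  oddHole : FT.OddHole
  oddHole = record { k = 2 ; hole = hole ; on-hole = refl ; flat-hole = refl ; few = refl
                   ; c<b = s≤s (s≤s (s≤s z≤n)) ; d<b = s≤s (s≤s (s≤s (s≤s z≤n))) }

  module _ (m : ℕ) where
    -- In the matrix itself the apex row precedes the path rows; the ordering for total balancedness
    -- puts it last.
    module R = Layout 3 (suc m) 0
    module S = Layout 3 m 1
    open Fitting family checked m

    ν : Numbering okR (4 + m)
    ν = R.numbering (λ { (core _) → refl ; (path _) → refl }) (cong (3 +_) (N.+-identityʳ (suc m)))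
    μ : Numbering okC (4 + m)
    μ = S.numbering (λ { (core _) → refl ; (path _) → refl }) (cong (3 +_) (N.+-comm m 1))

    Q : List (ℕ × ℕ)
    Q = (1 , 2) ∷ (2 , 1) ∷ (4 + m , 4 + m) ∷ []

    old : ∀ x y → okR x ≡ true → okC y ≡ true → Dℕ (4 + m) (R.number x) (S.number y) ≡ X m x y
    old (core 0) (core 0) _ _ = refl
    old (core 0) (core 1) _ _ = refl
    old (core 0) (core 2) _ _ = refl
    old (core 0) (core 3) _ _ = refl
    old (core 0) (path j) _ _ = refl
    old (core 1) (core 0) _ _ = refl
    old (core 1) (core 1) _ _ = refl
    old (core 1) (core 2) _ _ = refl
    old (core 1) (core 3) _ _ = refl
    old (core 1) (path j) _ _ = refl
    old (core 2) (core 0) _ _ = refl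
    old (core 2) (core 1) _ _ = refl
    old (core 2) (core 2) _ _ = refl
    old (core 2) (core 3) _ _ = refl
    old (core 2) (path j) _ _ = refl
    old (path i) (core 0) _ _ = sym (X-off frame m i 0 refl refl)
    old (path i) (core 1) _ _ = sym (X-off frame m i 1 refl refl)
    old (path i) (core 2) _ _ = trans (∨-identityʳ (0 ≡ᵇ i)) (trans (≡ᵇ-comm 0 i) (sym (X-c frame m i)))
    old (path i) (core 3) i∈ _ rewrite >⇒≢ᵇ {suc m} {i} (<ᵇ-true⁻ i∈) = trans (≡ᵇ-comm m i) (sym (X-d frame m i))
    old (path i) (path j) _ _ = ∨-comm (suc j ≡ᵇ i) (j ≡ᵇ i)

    corners : ∀ s → s < 3 → nth Q (suc s) ≡ just (R.number (cR m s) , S.number (cC m s))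
    corners 0 _ = refl
    corners 1 _ = refl
    corners 2 _ = refl
    corners (suc (suc (suc _))) (s≤s (s≤s (s≤s ())))

    minimal : MinimallyNonFirm (Stretch (4 + m) (4 + m) (Dℕ (4 + m)) Q)
    minimal = minimally-non-firm (Upright.upright (3 + m) (3 + m) ν μ (Dℕ (4 + m)) Q old corners (FT.NotFirm.full-not-tight oddHole m))

    totally-balanced : TotallyBalanced (Stretch (4 + m) (4 + m) (Dℕ (4 + m)) Q)
    totally-balanced = Balanced.balanced family checked m refl refl refl (Γ-check-sound ones refl) d-only ν μ _
      (Upright.upright-placed (3 + m) (3 + m) ν μ (Dℕ (4 + m)) Q old corners)

-- T: rows 1, 2, 3, 4 and columns 1, 2, 3, 4, n + 1 are core, with apex row 4 and c = 4, d = n + 1.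
module T-family where
  ones : List (ℕ × ℕ)
  ones = (0 , 1) ∷ (0 , 3) ∷ (1 , 0) ∷ (1 , 2) ∷ (2 , 1) ∷ (2 , 2) ∷ (2 , 3) ∷
         (3 , 0) ∷ (3 , 2) ∷ (3 , 3) ∷ (3 , 4) ∷ []

  d-only : ∀ x → listed ones x 4 ≡ true → x ≡ 3
  d-only 0 ()
  d-only 1 ()
  d-only 2 ()
  d-only 3 _ = refl
  d-only (suc (suc (suc (suc _)))) ()

  frame : Frame
  frame = record { K = listed ones ; r = 3 ; c = 3 ; d = 4 ; K-rc = refl ; K-rd = refl ; c≢d = λ () ; only-r = λ x _ → d-only x }

  cR cC : ℕ → ℕ → Ix
  cR m 0 = core 0
  cR m 1 = core 1
  cR m _ = path m
  cC m 0 = core 1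
  cC m 1 = core 0
  cC m _ = core 4

  family : Family
  family = record
    { frame = frame ; a = 4 ; b = 5 ; t = 3 ; ones = ones ; K-listed = λ _ _ → refl
    ; cR = cR ; cC = cC
    ; corner-suc = λ { m 0 → refl , refl ; m 1 → refl , refl ; m (suc (suc s)) → refl , refl }
    ; corner-row = λ { m 0 _ → inj₁ (0 , s≤s z≤n , refl) ; m 1 _ → inj₁ (1 , s≤s (s≤s z≤n) , refl)
                     ; m (suc (suc s)) _ → inj₂ (refl , refl) }
    ; corner-col = λ { m 0 _ → 1 , s≤s (s≤s z≤n) , refl ; m 1 _ → 0 , s≤s z≤n , refl
                     ; m (suc (suc s)) _ → 4 , s≤s (s≤s (s≤s (s≤s (s≤s z≤n)))) , refl }
    ; corner-inj = inj
    ; corner-one = λ { m 0 _ → refl ; m 1 _ → refl ; m (suc (suc s)) _ → Frame.X-last frame m } }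
    where
    inj : ∀ m s s′ → s < 3 → s′ < 3 → cR m s ≡ cR m s′ → cC m s ≡ cC m s′ → s ≡ s′
    inj m 0 0 _ _ _ _ = refl
    inj m 1 1 _ _ _ _ = refl
    inj m 2 2 _ _ _ _ = refl
    inj m (suc (suc (suc _))) _ (s≤s (s≤s (s≤s ())))
    inj m _ (suc (suc (suc _))) _ (s≤s (s≤s (s≤s ())))

  open Family family using (X)

  checked : Checked family
  checked = record { coreOK = λ m → refl ; baseOK = refl }

  -- An induced 7-cycle in this order.
  hole : Fin 7 → Ix × Ix
  hole = lookup ((path 0 , core 3) ∷ (core 0 , core 3) ∷ (core 2 , core 1) ∷ (core 2 , core 2) ∷
                 (core 1 , core 2) ∷ (core 3 , core 0) ∷ (core 3 , core 4) ∷ [])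

  module FT = Family-tight family checked

  oddHole : FT.OddHole
  oddHole = record { k = 3 ; hole = hole ; on-hole = refl ; flat-hole = refl ; few = refl
                   ; c<b = s≤s (s≤s (s≤s (s≤s z≤n))) ; d<b = s≤s (s≤s (s≤s (s≤s (s≤s z≤n)))) }

  module _ (m : ℕ) where
    module R = Layout 4 (suc m) 0
    module S = Layout 4 m 1
    open Fitting family checked m

    ν : Numbering okR (5 + m)
    ν = R.numbering (λ { (core _) → refl ; (path _) → refl }) (cong (4 +_) (N.+-identityʳ (suc m)))
    μ : Numbering okC (5 + m)
    μ = S.numbering (λ { (core _) → refl ; (path _) → refl }) (cong (4 +_) (N.+-comm m 1))

    Q : List (ℕ × ℕ)
    Q = (1 , 2) ∷ (2 , 1) ∷ (5 + m , 5 + m) ∷ []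

    old : ∀ x y → okR x ≡ true → okC y ≡ true → Tℕ (5 + m) (R.number x) (S.number y) ≡ X m x y
    old (core 0) (core 0) _ _ = refl
    old (core 0) (core 1) _ _ = refl
    old (core 0) (core 2) _ _ = refl
    old (core 0) (core 3) _ _ = refl
    old (core 0) (core 4) _ _ = refl
    old (core 0) (path j) _ _ = refl
    old (core 1) (core 0) _ _ = refl
    old (core 1) (core 1) _ _ = refl
    old (core 1) (core 2) _ _ = refl
    old (core 1) (core 3) _ _ = refl
    old (core 1) (core 4) _ _ = refl
    old (core 1) (path j) _ _ = refl
    old (core 2) (core 0) _ _ = refl
    old (core 2) (core 1) _ _ = refl
    old (core 2) (core 2) _ _ = refl
    old (core 2) (core 3) _ _ = refl
    old (core 2) (core 4) _ _ = refl
    old (core 2) (path j) _ _ = refl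
    old (core 3) (core 0) _ _ = refl
    old (core 3) (core 1) _ _ = refl
    old (core 3) (core 2) _ _ = refl
    old (core 3) (core 3) _ _ = refl
    old (core 3) (core 4) _ _ = refl
    old (core 3) (path j) _ _ = refl
    old (path i) (core 0) _ _ = sym (X-off frame m i 0 refl refl)
    old (path i) (core 1) _ _ = sym (X-off frame m i 1 refl refl)
    old (path i) (core 2) _ _ = sym (X-off frame m i 2 refl refl)
    old (path i) (core 3) _ _ = trans (∨-identityʳ (0 ≡ᵇ i)) (trans (≡ᵇ-comm 0 i) (sym (X-c frame m i)))
    old (path i) (core 4) i∈ _ rewrite >⇒≢ᵇ {suc m} {i} (<ᵇ-true⁻ i∈) = trans (≡ᵇ-comm m i) (sym (X-d frame m i))
    old (path i) (path j) _ _ = ∨-comm (suc j ≡ᵇ i) (j ≡ᵇ i)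

    corners : ∀ s → s < 3 → nth Q (suc s) ≡ just (R.number (cR m s) , S.number (cC m s))
    corners 0 _ = refl
    corners 1 _ = refl
    corners 2 _ = refl
    corners (suc (suc (suc _))) (s≤s (s≤s (s≤s ())))

    minimal : MinimallyNonFirm (Stretch (5 + m) (5 + m) (Tℕ (5 + m)) Q)
    minimal = minimally-non-firm (Upright.upright (4 + m) (4 + m) ν μ (Tℕ (5 + m)) Q old corners (FT.NotFirm.full-not-tight oddHole m))

    totally-balanced : TotallyBalanced (Stretch (5 + m) (5 + m) (Tℕ (5 + m)) Q)
    totally-balanced = Balanced.balanced family checked m refl refl refl (Γ-check-sound ones refl) d-only ν μ _
      (Upright.upright-placed (4 + m) (4 + m) ν μ (Tℕ (5 + m)) Q old corners)

-- M: the path rows are rows 1, …, n − 3; core rows 0, 1, 2 are rows n − 2, n − 1, n, core row 3 is a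
-- dummy apex that does not occur in the matrix; core columns 0, …, 3 are columns 1, n − 2, n − 1, n.
module M-family where
  ones : List (ℕ × ℕ)
  ones = (0 , 1) ∷ (0 , 2) ∷ (1 , 0) ∷ (1 , 2) ∷ (1 , 3) ∷ (2 , 2) ∷ (2 , 3) ∷ (3 , 0) ∷ (3 , 1) ∷ []

  only-r : ∀ x → listed ones x 0 ≡ true → listed ones x 1 ≡ true → x ≡ 3
  only-r 0 ()
  only-r 1 _ ()
  only-r 2 ()
  only-r 3 _ _ = refl
  only-r (suc (suc (suc (suc _)))) ()

  frame : Frame
  frame = record { K = listed ones ; r = 3 ; c = 0 ; d = 1 ; K-rc = refl ; K-rd = refl ; c≢d = λ () ; only-r = only-r }

  family : Family
  family = record
    -- With `a = 3` the apex row 3 is never present: its ones need no cover, and marks in it have no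
    -- effect.
    { frame = frame ; a = 3 ; b = 4 ; t = 1 ; ones = ones ; K-listed = λ _ _ → refl
    ; cR = λ _ _ → core 2 ; cC = λ _ _ → core 3
    ; corner-suc = λ _ _ → refl , refl
    ; corner-row = λ _ _ _ → inj₁ (2 , s≤s (s≤s (s≤s z≤n)) , refl)
    ; corner-col = λ _ _ _ → 3 , s≤s (s≤s (s≤s (s≤s z≤n))) , refl
    ; corner-inj = λ { m zero zero _ _ _ _ → refl ; m (suc s) _ (s≤s ()) ; m zero (suc s) _ (s≤s ()) }
    ; corner-one = λ _ _ _ → refl }

  open Family family using (X)

  checked : Checked family
  checked = record { coreOK = λ m → refl ; baseOK = refl }

  -- An induced 7-cycle; its cyclic order visits the entries as 0, 1, 2, 3, 6, 5, 4.
  hole : Fin 7 → Ix × Ix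
  hole = lookup ((path 0 , core 0) ∷ (path 0 , core 1) ∷ (core 0 , core 1) ∷ (core 0 , core 2) ∷
                 (core 1 , core 0) ∷ (core 1 , core 3) ∷ (core 2 , core 2) ∷ [])

  module FT = Family-tight family checked

  oddHole : FT.OddHole
  oddHole = record { k = 3 ; hole = hole ; on-hole = refl ; flat-hole = refl ; few = refl
                   ; c<b = s≤s z≤n ; d<b = s≤s (s≤s z≤n) }

  module _ (m : ℕ) where
    module R = Layout 0 (suc m) 3
    module S = Layout 1 m 3
    open Fitting family checked m

    ν : Numbering okR (4 + m)
    ν = R.numbering (λ { (core _) → refl ; (path _) → refl }) (cong suc (N.+-comm m 3))
    μ : Numbering okC (4 + m)
    μ = S.numbering (λ { (core _) → refl ; (path _) → refl }) (cong suc (N.+-comm m 3))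

    Q : List (ℕ × ℕ)
    Q = (4 + m , 4 + m) ∷ []

    open Near m
    private
      row₀ : ∀ j → Mℕ (4 + m) (2 + m) j ≡ (j ≡ᵇ 2 + m) ∨ (j ≡ᵇ 3 + m)
      row₀ j rewrite m<m+1 | m≢m+1 | m≢m+2 = ∨-identityʳ _
      row₁ : ∀ j → Mℕ (4 + m) (3 + m) j ≡ (j ≡ᵇ 1) ∨ (j ≡ᵇ 3 + m) ∨ (j ≡ᵇ 4 + m)
      row₁ j rewrite m≮m | mm | m≢m+1 = ∨-identityʳ _
      row₂ : ∀ j → Mℕ (4 + m) (4 + m) j ≡ (j ≡ᵇ 3 + m) ∨ (j ≡ᵇ 4 + m)
      row₂ j rewrite m+1≮m | m+1≢m | mm = refl
      rowₚ : ∀ i j → i < suc m → Mℕ (4 + m) (suc i) j ≡ (j ≡ᵇ suc i) ∨ (j ≡ᵇ 2 + i)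
      rowₚ i j lt rewrite <ᵇ-true {i} {2 + m} (N.m<n⇒m<1+n lt) | <⇒≢ᵇ {i} {2 + m} (N.m<n⇒m<1+n lt)
        | <⇒≢ᵇ {i} {3 + m} (N.m<n⇒m<1+n (N.m<n⇒m<1+n lt)) = ∨-identityʳ _

    old : ∀ x y → okR x ≡ true → okC y ≡ true → Mℕ (4 + m) (R.number x) (S.number y) ≡ X m x y
    old (core 0) y _ y∈ = trans (row₀ (S.number y)) (cell y y∈)
      where
      cell : ∀ y → okC y ≡ true → (S.number y ≡ᵇ 2 + m) ∨ (S.number y ≡ᵇ 3 + m) ≡ X m (core 0) y
      cell (core 0) _ = refl
      cell (core 1) _ rewrite mm = refl
      cell (core 2) _ rewrite m+1≢m | mm = refl
      cell (core 3) _ rewrite m+1≢m | m+2≢m = refl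
      cell (path j) e rewrite <⇒≢ᵇ {j} {m} (<ᵇ-true⁻ e) | <⇒≢ᵇ {j} {suc m} (N.m<n⇒m<1+n (<ᵇ-true⁻ e)) = refl
    old (core 1) y _ y∈ = trans (row₁ (S.number y)) (cell y y∈)
      where
      cell : ∀ y → okC y ≡ true → (S.number y ≡ᵇ 1) ∨ (S.number y ≡ᵇ 3 + m) ∨ (S.number y ≡ᵇ 4 + m) ≡ X m (core 1) y
      cell (core 0) _ = refl
      cell (core 1) _ rewrite m≢m+1 | m≢m+2 = refl
      cell (core 2) _ rewrite mm = refl
      cell (core 3) _ rewrite m+1≢m | mm = refl
      cell (path j) e rewrite <⇒≢ᵇ {j} {suc m} (N.m<n⇒m<1+n (<ᵇ-true⁻ e))
        | <⇒≢ᵇ {j} {2 + m} (N.m<n⇒m<1+n (N.m<n⇒m<1+n (<ᵇ-true⁻ e))) = refl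
    old (core 2) y _ y∈ = trans (row₂ (S.number y)) (cell y y∈)
      where
      cell : ∀ y → okC y ≡ true → (S.number y ≡ᵇ 3 + m) ∨ (S.number y ≡ᵇ 4 + m) ≡ X m (core 2) y
      cell (core 0) _ = refl
      cell (core 1) _ rewrite m≢m+1 | m≢m+2 = refl
      cell (core 2) _ rewrite mm = refl
      cell (core 3) _ rewrite m+1≢m | mm = refl
      cell (path j) e rewrite <⇒≢ᵇ {j} {suc m} (N.m<n⇒m<1+n (<ᵇ-true⁻ e))
        | <⇒≢ᵇ {j} {2 + m} (N.m<n⇒m<1+n (N.m<n⇒m<1+n (<ᵇ-true⁻ e))) = refl
    old (path i) y i∈ y∈ = trans (rowₚ i (S.number y) i<) (cell y y∈)
      where
      i< : i < suc m
      i< = <ᵇ-true⁻ i∈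
      cell : ∀ y → okC y ≡ true → (S.number y ≡ᵇ suc i) ∨ (S.number y ≡ᵇ 2 + i) ≡ X m (path i) y
      cell (core 0) _ = trans (∨-identityʳ (0 ≡ᵇ i)) (trans (≡ᵇ-comm 0 i) (sym (X-c frame m i)))
      cell (core 1) _ rewrite >⇒≢ᵇ {suc m} {i} i< = trans (≡ᵇ-comm m i) (sym (X-d frame m i))
      cell (core 2) _ rewrite >⇒≢ᵇ {2 + m} {i} (N.m<n⇒m<1+n i<) | >⇒≢ᵇ {suc m} {i} i< = sym (X-off frame m i 2 refl refl)
      cell (core 3) _ rewrite >⇒≢ᵇ {3 + m} {i} (N.m<n⇒m<1+n (N.m<n⇒m<1+n i<)) | >⇒≢ᵇ {2 + m} {i} (N.m<n⇒m<1+n i<) =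
        sym (X-off frame m i 3 refl refl)
      cell (path j) _ = ∨-comm (suc j ≡ᵇ i) (j ≡ᵇ i)

    corners : ∀ s → s < 1 → nth Q (suc s) ≡ just (R.number (core 2) , S.number (core 3))
    corners 0 _ = refl
    corners (suc _) (s≤s ())

    minimal : MinimallyNonFirm (Stretch (4 + m) (4 + m) (Mℕ (4 + m)) Q)
    minimal = minimally-non-firm (Upright.upright (3 + m) (3 + m) ν μ (Mℕ (4 + m)) Q old corners (FT.NotFirm.full-not-tight oddHole m))

-- H transposed: its rows are the columns 1, 2, n of H (core 0, 1, 2) and a path; its columns are the rows
-- 1, n − 2, n − 1 of H (core 0, 1, 2) and a path.
module H-family where
  ones : List (ℕ × ℕ)
  ones = (0 , 0) ∷ (0 , 1) ∷ (0 , 2) ∷ (1 , 0) ∷ (1 , 2) ∷ (2 , 1) ∷ (2 , 2) ∷ []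

  only-r : ∀ x → listed ones x 0 ≡ true → listed ones x 1 ≡ true → x ≡ 0
  only-r 0 _ _ = refl
  only-r 1 _ ()
  only-r 2 ()
  only-r (suc (suc (suc _))) ()

  frame : Frame
  frame = record { K = listed ones ; r = 0 ; c = 0 ; d = 1 ; K-rc = refl ; K-rd = refl ; c≢d = λ () ; only-r = only-r }

  cR : ℕ → ℕ → Ix
  cR m 0 = core 1
  cR m _ = core 2

  family : Family
  family = record
    { frame = frame ; a = 3 ; b = 3 ; t = 2 ; ones = ones ; K-listed = λ _ _ → refl
    ; cR = cR ; cC = λ _ _ → core 2
    ; corner-suc = λ { m 0 → refl , refl ; m (suc s) → refl , refl }
    ; corner-row = λ { m 0 _ → inj₁ (1 , s≤s (s≤s z≤n) , refl) ; m (suc s) _ → inj₁ (2 , s≤s (s≤s (s≤s z≤n)) , refl) }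
    ; corner-col = λ _ _ _ → 2 , s≤s (s≤s (s≤s z≤n)) , refl
    ; corner-inj = inj
    ; corner-one = λ { m 0 _ → refl ; m (suc s) _ → refl } }
    where
    inj : ∀ m s s′ → s < 2 → s′ < 2 → cR m s ≡ cR m s′ → core 2 ≡ core 2 → s ≡ s′
    inj m 0 0 _ _ _ _ = refl
    inj m 1 1 _ _ _ _ = refl
    inj m 0 1 _ _ () _
    inj m 1 0 _ _ () _
    inj m (suc (suc _)) _ (s≤s (s≤s ()))
    inj m _ (suc (suc _)) _ (s≤s (s≤s ()))

  open Family family using (X)

  checked : Checked family
  checked = record { coreOK = λ m → refl ; baseOK = refl }

  -- An induced 5-cycle in this order.
  hole : Fin 5 → Ix × Ix
  hole = lookup ((path 0 , core 0) ∷ (path 0 , core 1) ∷ (core 2 , core 1) ∷ (core 0 , core 2) ∷ (core 1 , core 0) ∷ [])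

  module FT = Family-tight family checked

  oddHole : FT.OddHole
  oddHole = record { k = 2 ; hole = hole ; on-hole = refl ; flat-hole = refl ; few = refl
                   ; c<b = s≤s z≤n ; d<b = s≤s (s≤s z≤n) }

  module _ (m : ℕ) where
    module R = Layout 2 (suc m) 1
    module S = Layout 1 m 2
    open Fitting family checked m

    ν : Numbering okR (4 + m)
    ν = R.numbering (λ { (core _) → refl ; (path _) → refl }) (cong (2 +_) (N.+-comm (suc m) 1))
    μ : Numbering okC (3 + m)
    μ = S.numbering (λ { (core _) → refl ; (path _) → refl }) (cong suc (N.+-comm m 2))

    Q : List (ℕ × ℕ)
    Q = (3 + m , 2) ∷ (3 + m , 4 + m) ∷ []

    open Near m
    private
      inner : ∀ {j} → (j <ᵇ m) ≡ true → j < suc m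
      inner e = N.m<n⇒m<1+n (<ᵇ-true⁻ e)

    old : ∀ x y → okR x ≡ true → okC y ≡ true → Hℕ (3 + m) (S.number y) (R.number x) ≡ X m x y
    old (core 0) (core 0) _ _ = refl
    old (core 0) (core 1) _ _ = refl
    old (core 0) (core 2) _ _ = refl
    old (core 0) (path j) _ _ = refl
    old (core 1) (core 0) _ _ = refl
    old (core 1) (core 1) _ _ rewrite m<m+1 | m≢m+1 = refl
    old (core 1) (core 2) _ _ rewrite m≮m | mm = refl
    old (core 1) (path j) _ j∈ rewrite <ᵇ-true (inner j∈) | <⇒≢ᵇ (inner j∈) = refl
    old (core 2) (core 0) _ _ = refl
    old (core 2) (core 1) _ _ rewrite m<m+1 | mm | m+1≢m = refl
    old (core 2) (core 2) _ _ rewrite mm = refl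
    old (core 2) (path j) _ j∈ rewrite >⇒≢ᵇ (inner j∈) | <ᵇ-true (inner j∈) | >⇒≢ᵇ {m} {j} (<ᵇ-true⁻ j∈) | <⇒≢ᵇ (inner j∈) = refl
    old (path i) (core 0) _ _ = trans (∨-identityʳ (i ≡ᵇ 0)) (sym (X-c frame m i))
    old (path i) (core 1) i∈ _ rewrite m<m+1 | m≢m+1 | <⇒≢ᵇ {i} {suc m} (<ᵇ-true⁻ i∈) =
      trans (∨-identityʳ (i ≡ᵇ m)) (sym (X-d frame m i))
    old (path i) (core 2) i∈ _ rewrite m≮m | mm | <⇒≢ᵇ {i} {suc m} (<ᵇ-true⁻ i∈) = sym (X-off frame m i 2 refl refl)
    old (path i) (path j) _ j∈ rewrite <ᵇ-true (inner j∈) | <⇒≢ᵇ (inner j∈) | ∨-identityʳ (i ≡ᵇ suc j) =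
      cong₂ _∨_ (≡ᵇ-comm i j) (≡ᵇ-comm i (suc j))

    corners : ∀ s → s < 2 → nth Q (suc s) ≡ just (S.number (core 2) , R.number (cR m s))
    corners 0 _ = refl
    corners 1 _ = refl
    corners (suc (suc _)) (s≤s (s≤s ()))

    minimal : MinimallyNonFirm (Stretch (3 + m) (4 + m) (Hℕ (3 + m)) Q)
    minimal = minimally-non-firm (Sideways.sideways (3 + m) (2 + m) ν μ (Hℕ (3 + m)) Q old corners (FT.NotFirm.full-not-tight oddHole m))

theorem4 : ∀ (n : ℕ) → 4 ≤ n →
    MinimallyNonFirm (Stretch n n (Mℕ n) ((n , n) ∷ [])) ×
    MinimallyNonFirm (Stretch (n ∸ 1) n (Hℕ (n ∸ 1)) ((n ∸ 1 , 2) ∷ (n ∸ 1 , n) ∷ [])) ×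
    MinimallyNonFirm (Stretch n n (Dℕ n) ((1 , 2) ∷ (2 , 1) ∷ (n , n) ∷ [])) ×
    MinimallyNonFirm (Stretch (suc n) (suc n) (Tℕ (suc n)) ((1 , 2) ∷ (2 , 1) ∷ (suc n , suc n) ∷ [])) ×
    TotallyBalanced (Stretch n n (Dℕ n) ((1 , 2) ∷ (2 , 1) ∷ (n , n) ∷ [])) ×
    TotallyBalanced (Stretch (suc n) (suc n) (Tℕ (suc n)) ((1 , 2) ∷ (2 , 1) ∷ (suc n , suc n) ∷ []))
-- In all four families `n - 4` is the number of path columns, so `n = 4` is the base of the
-- contraction.
theorem4 .(4 + m) (s≤s (s≤s (s≤s (s≤s (z≤n {m}))))) =
  M-family.minimal m , H-family.minimal m , D-family.minimal m , T-family.minimal m ,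
  D-family.totally-balanced m , T-family.totally-balanced m
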